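{- There exist absolute constants $0<c<C$ and $n_0$ such that for every $n\ge n_0$, if $G\sim G(n,1/2)$ then $$e^{ -Cn}\le \mathbb{P}(G\text{ is not even-degenerate})\le e^{ -cn}.$$
   Context: $G(n,1/2)$ is the uniformly random graph on $n$ labelled vertices (each pair an edge independently with probability $1/2$). A graph $G$ on $n$ vertices is even-degenerate if there is an ordering $v_1,\dots,v_n$ of its vertices such that for each $1\le i\le n-2$, $v_i$ has an even number of neighbours in $\{v_{i+1},\dots,v_n\}$. (No parity condition is imposed on $e(G)$, and no condition on the pair $v_{n-1},v_n$.) -}

module Defs where

open import Algebra.Definitions.RawSemiring using ()
open import Data.Bool using (Bool; true; false; _∧_)
open import Data.Fin using (Fin; zero; suc; toℕ)
import Data.Fin as Fin
import Data.Fin.Properties as Fin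
open import Data.Fin.Permutation using (Permutation′; permutation; _⟨$⟩ʳ_; _⟨$⟩ˡ_; inverseˡ; inverseʳ)
open import Data.Fin.Subset using (Subset; ∣_∣)
open import Data.Integer using (+_)
import Data.Integer as ℤ
import Data.Integer.Properties as ℤ
open import Data.List using (List; []; _∷_; length; filter; cartesianProductWith)
import Data.List as List
import Data.List.Properties as List
open import Data.List.Membership.Propositional using (_∈_)
open import Data.List.Membership.Propositional.Properties using (∈-cartesianProductWith⁺)
open import Data.List.Relation.Unary.All using ([]; _∷_)
open import Data.List.Relation.Unary.AllPairs using ([]; _∷_)
open import Data.List.Relation.Unary.Any using (here; there)
open import Data.List.Relation.Unary.Unique.Propositional using (Unique)
open import Data.List.Relation.Unary.Unique.Propositional.Properties using (cartesianProductWith⁺)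
open import Data.Nat using (ℕ; zero; suc; _!)
import Data.Nat as ℕ
open import Data.Nat.Combinatorics using (_C_; nC1≡n; nCk+nC[k+1]≡[n+1]C[k+1])
open import Data.Nat.Divisibility using (_∣_; _∣?_)
import Data.Nat.Properties as ℕ
open import Data.Product using (∃; ∃-syntax; _×_; _,_; proj₁; proj₂)
open import Data.Rational using (ℚ; 0ℚ; 1ℚ; ½; _+_; _*_; _-_; -_; _/_; 1/_; _≤_; _<_; +-*-rawSemiring)
  renaming (∣_∣ to abs)
import Data.Rational as ℚ
open import Data.Rational.Properties
open import Data.Rational.Solver using (module +-*-Solver)
import Data.Rational.Unnormalised as ℚᵘ
import Data.Rational.Unnormalised.Properties as ℚᵘ
open import Data.Sum using (inj₁; inj₂)
open import Data.Vec using (Vec; []; _∷_; lookup; tabulate)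
import Data.Vec.Properties as Vec
open import Function using (_∘_)
open import Relation.Binary.PropositionalEquality
open import Relation.Nullary using (Dec; does)
open import Relation.Nullary.Decidable using (map′; _×-dec_; _→-dec_)
open import Relation.Unary using (Decidable)

-- A simple graph on the vertex set Fin n.  In S ▹ G the vertex zero is joined
-- to suc i for each i ∈ S, and the vertices suc i span a copy of G.  Thus each
-- unordered pair of vertices carries exactly one bit; graph-ext and
-- adj-fromMatrix below show that graphs are the same thing as symmetric
-- irreflexive adjacency matrices.
data Graph : ℕ → Set where
  ∅   : Graph 0
  _▹_ : ∀ {n} → Subset n → Graph n → Graph (suc n)

adj : ∀ {n} → Graph n → Fin n → Fin n → Bool
adj (S ▹ G) zero    zero    = false
adj (S ▹ G) zero    (suc j) = lookup S j
adj (S ▹ G) (suc i) zero    = lookup S i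
adj (S ▹ G) (suc i) (suc j) = adj G i j

adj-sym : ∀ {n} (G : Graph n) i j → adj G i j ≡ adj G j i
adj-sym (S ▹ G) zero    zero    = refl
adj-sym (S ▹ G) zero    (suc j) = refl
adj-sym (S ▹ G) (suc i) zero    = refl
adj-sym (S ▹ G) (suc i) (suc j) = adj-sym G i j

adj-irrefl : ∀ {n} (G : Graph n) i → adj G i i ≡ false
adj-irrefl (S ▹ G) zero    = refl
adj-irrefl (S ▹ G) (suc i) = adj-irrefl G i

graph-ext : ∀ {n} (G H : Graph n) → (∀ i j → adj G i j ≡ adj H i j) → G ≡ H
graph-ext ∅       ∅       _ = refl
graph-ext (S ▹ G) (T ▹ H) h = cong₂ _▹_
  (trans (sym (Vec.tabulate∘lookup S)) (trans (Vec.tabulate-cong (λ j → h zero (suc j))) (Vec.tabulate∘lookup T)))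
  (graph-ext G H (λ i j → h (suc i) (suc j)))

fromMatrix : ∀ {n} → (Fin n → Fin n → Bool) → Graph n
fromMatrix {zero}  A = ∅
fromMatrix {suc n} A = tabulate (λ j → A zero (suc j)) ▹ fromMatrix (λ i j → A (suc i) (suc j))

adj-fromMatrix : ∀ {n} (A : Fin n → Fin n → Bool) → (∀ i j → A i j ≡ A j i) → (∀ i → A i i ≡ false) →
                 ∀ i j → adj (fromMatrix A) i j ≡ A i j
adj-fromMatrix A s r zero    zero    = sym (r zero)
adj-fromMatrix A s r zero    (suc j) = Vec.lookup∘tabulate (λ j → A zero (suc j)) j
adj-fromMatrix A s r (suc i) zero    = trans (Vec.lookup∘tabulate (λ j → A zero (suc j)) i) (s zero (suc i))
adj-fromMatrix A s r (suc i) (suc j) =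
  adj-fromMatrix (λ i j → A (suc i) (suc j)) (λ i j → s (suc i) (suc j)) (r ∘ suc) i j

-- The set of positions j > i such that v j is a neighbour of v i.
laterNeighbours : ∀ {n} → Graph n → (Fin n → Fin n) → Fin n → Subset n
laterNeighbours G v i = tabulate λ j → does (i Fin.<? j) ∧ adj G (v i) (v j)

-- The index i : Fin n stands for the (toℕ i + 1)-st vertex of the ordering.
EvenDegenerate : ∀ {n} → Graph n → Set
EvenDegenerate {n} G = ∃[ π ] ∀ (i : Fin n) → suc (toℕ i) ℕ.≤ n ℕ.∸ 2 →
  2 ∣ ∣ laterNeighbours G (π ⟨$⟩ʳ_) i ∣

∃Vec? : ∀ {m n} {P : Vec (Fin m) n → Set} → Decidable P → Dec (∃ P)
∃Vec? {n = zero}  P? = map′ (λ p → [] , p) (λ { ([] , p) → p }) (P? [])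
∃Vec? {n = suc n} P? = map′ (λ { (x , xs , p) → (x ∷ xs) , p }) (λ { ((x ∷ xs) , p) → x , xs , p })
  (Fin.any? λ x → ∃Vec? λ xs → P? (x ∷ xs))

evenDegenerate? : ∀ {n} → Decidable (EvenDegenerate {n})
evenDegenerate? {n} G = map′ to from
  (∃Vec? λ f → ∃Vec? λ g →
    Fin.all? (λ i → lookup f (lookup g i) Fin.≟ i) ×-dec
    Fin.all? (λ i → lookup g (lookup f i) Fin.≟ i) ×-dec
    Fin.all? (λ i → (suc (toℕ i) ℕ.≤? n ℕ.∸ 2) →-dec (2 ∣? ∣ laterNeighbours G (lookup f) i ∣)))
  where
  Good : (f g : Vec (Fin n) n) → Set
  Good f g = (∀ i → lookup f (lookup g i) ≡ i) × (∀ i → lookup g (lookup f i) ≡ i) ×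
             (∀ i → suc (toℕ i) ℕ.≤ n ℕ.∸ 2 → 2 ∣ ∣ laterNeighbours G (lookup f) i ∣)

  to : (∃[ f ] ∃[ g ] Good f g) → EvenDegenerate G
  to (f , g , fg , gf , h) = permutation (lookup f) (lookup g) fg gf , h

  from : EvenDegenerate G → ∃[ f ] ∃[ g ] Good f g
  from (π , h) = tabulate v , tabulate w
    , (λ i → trans (lt v (lookup (tabulate w) i)) (trans (cong v (lt w i)) (inverseʳ π)))
    , (λ i → trans (lt w (lookup (tabulate v) i)) (trans (cong w (lt v i)) (inverseˡ π)))
    , λ i p → subst (λ S → 2 ∣ ∣ S ∣)
        (Vec.tabulate-cong λ j → cong₂ (λ a b → does (i Fin.<? j) ∧ adj G a b) (sym (lt v i)) (sym (lt v j))) (h i p)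
    where
    v = π ⟨$⟩ʳ_
    w = π ⟨$⟩ˡ_
    lt : (f : Fin n → Fin n) → ∀ i → lookup (tabulate f) i ≡ f i
    lt = Vec.lookup∘tabulate

subsets : ∀ n → List (Subset n)
subsets zero    = [] ∷ []
subsets (suc n) = cartesianProductWith _∷_ (true ∷ false ∷ []) (subsets n)

graphs : ∀ n → List (Graph n)
graphs zero    = ∅ ∷ []
graphs (suc n) = cartesianProductWith _▹_ (subsets n) (graphs n)

subsets-complete : ∀ {n} (S : Subset n) → S ∈ subsets n
subsets-complete []          = here refl
subsets-complete (true ∷ S)  = ∈-cartesianProductWith⁺ _∷_ {xs = true ∷ false ∷ []} (here refl) (subsets-complete S)
subsets-complete (false ∷ S) = ∈-cartesianProductWith⁺ _∷_ {xs = true ∷ false ∷ []} (there (here refl)) (subsets-complete S)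

graphs-complete : ∀ {n} (G : Graph n) → G ∈ graphs n
graphs-complete ∅       = here refl
graphs-complete (S ▹ G) = ∈-cartesianProductWith⁺ _▹_ (subsets-complete S) (graphs-complete G)

subsets-unique : ∀ n → Unique (subsets n)
subsets-unique zero    = [] ∷ []
subsets-unique (suc n) = cartesianProductWith⁺ _∷_ (λ { refl → refl , refl })
  (((λ ()) ∷ []) ∷ [] ∷ []) (subsets-unique n)

graphs-unique : ∀ n → Unique (graphs n)
graphs-unique zero    = [] ∷ []
graphs-unique (suc n) = cartesianProductWith⁺ _▹_ (λ { refl → refl , refl }) (subsets-unique n) (graphs-unique n)

length-product : ∀ {A B C : Set} (f : A → B → C) xs ys →
  length (cartesianProductWith f xs ys) ≡ length xs ℕ.* length ys
length-product f []       ys = refl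
length-product f (x ∷ xs) ys = trans (List.length-++ (List.map (f x) ys))
  (cong₂ ℕ._+_ (List.length-map (f x) ys) (length-product f xs ys))

length-subsets : ∀ n → length (subsets n) ≡ 2 ℕ.^ n
length-subsets zero    = refl
length-subsets (suc n) = trans (length-product _∷_ (true ∷ false ∷ []) (subsets n)) (cong (2 ℕ.*_) (length-subsets n))

length-graphs : ∀ n → length (graphs n) ≡ 2 ℕ.^ (n C 2)
length-graphs zero    = refl
length-graphs (suc n) = begin
  length (graphs (suc n))                 ≡⟨ length-product _▹_ (subsets n) (graphs n) ⟩
  length (subsets n) ℕ.* length (graphs n)  ≡⟨ cong₂ ℕ._*_ (length-subsets n) (length-graphs n) ⟩
  2 ℕ.^ n ℕ.* 2 ℕ.^ (n C 2)               ≡⟨ ℕ.^-distribˡ-+-* 2 n (n C 2) ⟨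
  2 ℕ.^ (n ℕ.+ n C 2)                     ≡⟨ cong (λ k → 2 ℕ.^ (k ℕ.+ n C 2)) (nC1≡n n) ⟨
  2 ℕ.^ (n C 1 ℕ.+ n C 2)                 ≡⟨ cong (2 ℕ.^_) (nCk+nC[k+1]≡[n+1]C[k+1] n 1) ⟩
  2 ℕ.^ (suc n C 2) ∎
  where
  open ≡-Reasoning

-- The probability of P under G(n,1/2), the uniform distribution on the
-- 2^(n choose 2) graphs with vertex set Fin n.
ℙ : ∀ n {P : Graph n → Set} → Decidable P → ℚ
ℙ n P? = (+ length (filter P? (graphs n)) / 2 ℕ.^ (n C 2)) {{ℕ.m^n≢0 2 (n C 2)}}

open Algebra.Definitions.RawSemiring +-*-rawSemiring using (_^_)

-- The rational Taylor polynomials of exp:  expSum q N = Σ_{k<N} qᵏ/k!.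

expTerm : ℚ → ℕ → ℚ
expTerm q k = q ^ k * ((+ 1 / k !) {{k ℕ.!≢0}})

expSum : ℚ → ℕ → ℚ
expSum q zero    = 0ℚ
expSum q (suc N) = expSum q N + expTerm q N

IsCauchy : (ℕ → ℚ) → Set
IsCauchy s = ∀ (ε : ℚ) → 0ℚ < ε →
  ∃[ N ] ∀ m n → N ℕ.≤ m → N ℕ.≤ n → abs (s m - s n) ≤ ε

module CauchyLemmas where

  ι : ℕ → ℚ
  ι n = + n / 1

  ι-≃ : ∀ n → ℚ.toℚᵘ (ι n) ℚᵘ.≃ ℚᵘ.mkℚᵘ (+ n) 0
  ι-≃ n = toℚᵘ-fromℚᵘ (ℚᵘ.mkℚᵘ (+ n) 0)

  ι-+ : ∀ m n → ι (m ℕ.+ n) ≡ ι m + ι n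
  ι-+ m n = toℚᵘ-injective (begin
    ℚ.toℚᵘ (ι (m ℕ.+ n))                         ≈⟨ ι-≃ (m ℕ.+ n) ⟩
    ℚᵘ.mkℚᵘ (+ (m ℕ.+ n)) 0                      ≈⟨ ℚᵘ.*≡* (cong (ℤ._* + 1) (trans (ℤ.pos-+ m n)
                                                     (sym (cong₂ ℤ._+_ (ℤ.*-identityʳ (+ m)) (ℤ.*-identityʳ (+ n)))))) ⟩
    ℚᵘ.mkℚᵘ (+ m) 0 ℚᵘ.+ ℚᵘ.mkℚᵘ (+ n) 0         ≈⟨ ℚᵘ.+-cong (ι-≃ m) (ι-≃ n) ⟨
    ℚ.toℚᵘ (ι m) ℚᵘ.+ ℚ.toℚᵘ (ι n)               ≈⟨ toℚᵘ-homo-+ (ι m) (ι n) ⟨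
    ℚ.toℚᵘ (ι m + ι n)                           ∎)
    where
    open ℚᵘ.≃-Reasoning

  ι-* : ∀ m n → ι (m ℕ.* n) ≡ ι m * ι n
  ι-* m n = toℚᵘ-injective (begin
    ℚ.toℚᵘ (ι (m ℕ.* n))                         ≈⟨ ι-≃ (m ℕ.* n) ⟩
    ℚᵘ.mkℚᵘ (+ (m ℕ.* n)) 0                      ≈⟨ ℚᵘ.*≡* (cong (ℤ._* + 1) (ℤ.pos-* m n)) ⟩
    ℚᵘ.mkℚᵘ (+ m) 0 ℚᵘ.* ℚᵘ.mkℚᵘ (+ n) 0         ≈⟨ ℚᵘ.*-cong (ι-≃ m) (ι-≃ n) ⟨
    ℚ.toℚᵘ (ι m) ℚᵘ.* ℚ.toℚᵘ (ι n)               ≈⟨ toℚᵘ-homo-* (ι m) (ι n) ⟨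
    ℚ.toℚᵘ (ι m * ι n)                           ∎)
    where
    open ℚᵘ.≃-Reasoning

  ι-pos : ∀ n → ℚ.Positive (ι (suc n))
  ι-pos n = normalize-pos (suc n) 1

  ι-nonNeg : ∀ n → ℚ.NonNegative (ι n)
  ι-nonNeg n = normalize-nonNeg n 1

  ι-mono : ∀ {m n} → m ℕ.≤ n → ι m ≤ ι n
  ι-mono {m} {n} m≤n = subst (ι m ≤_) (trans (sym (ι-+ m (n ℕ.∸ m))) (cong ι (ℕ.m+[n∸m]≡n m≤n)))
    (≤-trans (≤-reflexive (sym (+-identityʳ (ι m)))) (+-monoʳ-≤ (ι m) (nonNegative⁻¹ _ {{ι-nonNeg (n ℕ.∸ m)}})))

  1/m*m : ∀ m .{{_ : ℕ.NonZero m}} → (+ 1 / m) * ι m ≡ 1ℚ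
  1/m*m m@(suc k) = toℚᵘ-injective (begin
    ℚ.toℚᵘ ((+ 1 / m) * ι m)                     ≈⟨ toℚᵘ-homo-* (+ 1 / m) (ι m) ⟩
    ℚ.toℚᵘ (+ 1 / m) ℚᵘ.* ℚ.toℚᵘ (ι m)           ≈⟨ ℚᵘ.*-cong (toℚᵘ-fromℚᵘ (ℚᵘ.mkℚᵘ (+ 1) k)) (ι-≃ m) ⟩
    ℚᵘ.mkℚᵘ (+ 1) k ℚᵘ.* ℚᵘ.mkℚᵘ (+ m) 0         ≈⟨ ℚᵘ.*≡* (cong +_ (trans (ℕ.*-identityʳ _) (cong (ℕ._+ 0) (sym (ℕ.*-identityʳ m))))) ⟩
    ℚᵘ.1ℚᵘ                                       ∎)
    where
    open ℚᵘ.≃-Reasoning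

  r : ℕ → ℚ
  r k = (+ 1 / k !) {{k ℕ.!≢0}}

  r-nonNeg : ∀ k → ℚ.NonNegative (r k)
  r-nonNeg k = normalize-nonNeg 1 (k !) {{k ℕ.!≢0}}

  r-step : ∀ k → r (suc k) * ι (suc k) ≡ r k
  r-step k = begin
    a * s              ≡⟨ *-identityʳ _ ⟨
    a * s * 1ℚ         ≡⟨ cong (a * s *_) (1/m*m (k !) {{k ℕ.!≢0}}) ⟨
    a * s * (b * f)    ≡⟨ solve 4 (λ a s b f → a :* s :* (b :* f) := (a :* (s :* f)) :* b) refl a s b f ⟩
    a * (s * f) * b    ≡⟨ cong (λ z → a * z * b) (ι-* (suc k) (k !)) ⟨
    a * ι (suc k !) * b  ≡⟨ cong (_* b) (1/m*m (suc k !) {{suc k ℕ.!≢0}}) ⟩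
    1ℚ * b             ≡⟨ *-identityˡ b ⟩
    b ∎
    where
    open ≡-Reasoning
    open +-*-Solver
    a = r (suc k) ; b = r k ; s = ι (suc k) ; f = ι (k !)

  term-step : ∀ q k → expTerm q (suc k) * ι (suc k) ≡ expTerm q k * q
  term-step q k = begin
    q * q ^ k * r (suc k) * ι (suc k)    ≡⟨ solve 4 (λ q p a s → q :* p :* a :* s := p :* (a :* s) :* q) refl q (q ^ k) (r (suc k)) (ι (suc k)) ⟩
    q ^ k * (r (suc k) * ι (suc k)) * q  ≡⟨ cong (λ z → q ^ k * z * q) (r-step k) ⟩
    q ^ k * r k * q ∎
    where
    open ≡-Reasoning
    open +-*-Solver

  ≤ι : ∀ q → ∃[ n ] q ≤ ι n
  ≤ι q with ℤ.∣ ℚ.↥ q ∣ in eq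
  ... | n = n , toℚᵘ-cancel-≤ (ℚᵘ.≤-trans (h q eq) (ℚᵘ.≤-reflexive (ℚᵘ.≃-sym (ι-≃ n))))
    where
    h : ∀ q {n} → ℤ.∣ ℚ.↥ q ∣ ≡ n → ℚ.toℚᵘ q ℚᵘ.≤ ℚᵘ.mkℚᵘ (+ n) 0
    h (ℚ.mkℚ (+ m) d _) refl = ℚᵘ.*≤* (subst₂ ℤ._≤_ (sym (ℤ.*-identityʳ (+ m))) (ℤ.pos-* m (suc d))
      (ℤ.+≤+ (ℕ.m≤m*n m (suc d))))
    h (ℚ.mkℚ (ℤ.-[1+ m ]) d _) refl = ℚᵘ.*≤* ℤ.-≤+

  archimedean : ∀ q δ → 0ℚ < δ → ∃[ n ] q ≤ ι n * δ
  archimedean q δ 0<δ = n , (begin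
    q               ≡⟨ *-identityʳ q ⟨
    q * 1ℚ          ≡⟨ cong (q *_) (*-inverseˡ δ) ⟨
    q * (1/ δ * δ)  ≡⟨ *-assoc q (1/ δ) δ ⟨
    q * 1/ δ * δ    ≤⟨ *-monoʳ-≤-nonNeg δ (proj₂ (≤ι (q * 1/ δ))) ⟩
    ι n * δ ∎)
    where
    open ≤-Reasoning
    instance
      δ⁺ : ℚ.Positive δ
      δ⁺ = ℚ.positive 0<δ
      δ≢0 : ℚ.NonZero δ
      δ≢0 = pos⇒nonZero δ
      δ₀ : ℚ.NonNegative δ
      δ₀ = pos⇒nonNeg δ
    n = proj₁ (≤ι (q * 1/ δ))

  *-mono-≤ : ∀ {a b c d} → 0ℚ ≤ b → 0ℚ ≤ c → a ≤ b → c ≤ d → a * c ≤ b * d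
  *-mono-≤ {a} {b} {c} {d} 0≤b 0≤c a≤b c≤d =
    ≤-trans (*-monoʳ-≤-nonNeg c {{ℚ.nonNegative 0≤c}} a≤b) (*-monoˡ-≤-nonNeg b {{ℚ.nonNegative 0≤b}} c≤d)

  0≤* : ∀ {a b} → 0ℚ ≤ a → 0ℚ ≤ b → 0ℚ ≤ a * b
  0≤* {a} {b} p q = nonNegative⁻¹ _ {{nonNeg*nonNeg⇒nonNeg a {{ℚ.nonNegative p}} b {{ℚ.nonNegative q}}}}

  0≤+ : ∀ {a b} → 0ℚ ≤ a → 0ℚ ≤ b → 0ℚ ≤ a + b
  0≤+ p q = +-mono-≤ p q

  p≤p+q : ∀ p q → 0ℚ ≤ q → p ≤ p + q
  p≤p+q p q 0≤q = subst (_≤ p + q) (+-identityʳ p) (+-monoʳ-≤ p 0≤q)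

  0<* : ∀ {a b} → 0ℚ < a → 0ℚ < b → 0ℚ < a * b
  0<* {a} {b} p q = positive⁻¹ _ {{pos*pos⇒pos a {{ℚ.positive p}} b {{ℚ.positive q}}}}

  0<½ : 0ℚ < ½
  0<½ = positive⁻¹ ½

  0≤1 : 0ℚ ≤ 1ℚ
  0≤1 = nonNegative⁻¹ 1ℚ

  abs-sym : ∀ a b → abs (a - b) ≡ abs (b - a)
  abs-sym a b = trans (sym (∣-p∣≡∣p∣ (a - b))) (cong abs (solve 2 (λ a b → :- (a :- b) := b :- a) refl a b))
    where
    open +-*-Solver

  ½+½ : ∀ ε → ε * ½ + ε * ½ ≡ ε
  ½+½ ε = trans (sym (*-distribˡ-+ ε ½ ½)) (*-identityʳ ε)

  abs-tri : ∀ a b c → abs (a - c) ≤ abs (a - b) + abs (b - c)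
  abs-tri a b c = subst (λ z → abs z ≤ abs (a - b) + abs (b - c))
    (solve 3 (λ a b c → (a :- b) :+ (b :- c) := a :- c) refl a b c) (∣p+q∣≤∣p∣+∣q∣ (a - b) (b - c))
    where
    open +-*-Solver

  shrink : ∀ D ε → 0ℚ < ε → ∃[ δ ] 0ℚ < δ × D * δ ≤ ε
  shrink D ε 0<ε with archimedean D ε 0<ε
  ... | n , D≤nε = w , positive⁻¹ w {{normalize-pos 1 (suc n)}} , (begin
      D * w              ≤⟨ *-monoʳ-≤-nonNeg w (≤-trans D≤nε (*-monoʳ-≤-nonNeg ε {{pos⇒nonNeg ε {{ℚ.positive 0<ε}}}} (ι-mono (ℕ.n≤1+n n)))) ⟩
      ι (suc n) * ε * w  ≡⟨ solve 3 (λ s e w → s :* e :* w := e :* (w :* s)) refl (ι (suc n)) ε w ⟩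
      ε * (w * ι (suc n))  ≡⟨ cong (ε *_) (1/m*m (suc n)) ⟩
      ε * 1ℚ             ≡⟨ *-identityʳ ε ⟩
      ε ∎)
    where
    open ≤-Reasoning
    open +-*-Solver
    w = + 1 / suc n
    instance
      w₀ : ℚ.NonNegative w
      w₀ = normalize-nonNeg 1 (suc n)

  bounded : ∀ {s} → IsCauchy s → ∃[ B ] 0ℚ ≤ B × ∃[ N ] ∀ n → N ℕ.≤ n → abs (s n) ≤ B
  bounded {s} cs with cs 1ℚ (positive⁻¹ 1ℚ)
  ... | N , h = 1ℚ + abs (s N) , 0≤+ 0≤1 (0≤∣p∣ (s N)) , N , λ n N≤n → begin
      abs (s n)                    ≡⟨ cong abs (solve 2 (λ a b → a := (a :- b) :+ b) refl (s n) (s N)) ⟩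
      abs (s n - s N + s N)        ≤⟨ ∣p+q∣≤∣p∣+∣q∣ (s n - s N) (s N) ⟩
      abs (s n - s N) + abs (s N)  ≤⟨ +-monoˡ-≤ (abs (s N)) (h n N N≤n ℕ.≤-refl) ⟩
      1ℚ + abs (s N) ∎
    where
    open ≤-Reasoning
    open +-*-Solver

  *-diff : ∀ a b c d → abs (a * b - c * d) ≤ abs a * abs (b - d) + abs d * abs (a - c)
  *-diff a b c d = begin
    abs (a * b - c * d)                  ≡⟨ cong abs (solve 4 (λ a b c d → a :* b :- c :* d := a :* (b :- d) :+ d :* (a :- c)) refl a b c d) ⟩
    abs (a * (b - d) + d * (a - c))      ≤⟨ ∣p+q∣≤∣p∣+∣q∣ (a * (b - d)) (d * (a - c)) ⟩
    abs (a * (b - d)) + abs (d * (a - c))  ≡⟨ cong₂ _+_ (∣p*q∣≡∣p∣*∣q∣ a (b - d)) (∣p*q∣≡∣p∣*∣q∣ d (a - c)) ⟩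
    abs a * abs (b - d) + abs d * abs (a - c) ∎
    where
    open ≤-Reasoning
    open +-*-Solver

  *-close : ∀ a b c d B δ D η ε → 0ℚ ≤ B → 0ℚ ≤ D →
            abs a ≤ B → abs (b - d) ≤ δ → abs d ≤ D → abs (a - c) ≤ η →
            B * δ ≤ ε * ½ → D * η ≤ ε * ½ → abs (a * b - c * d) ≤ ε
  *-close a b c d B δ D η ε 0≤B 0≤D ha hbd hd hac Bδ Dη = begin
    abs (a * b - c * d)                        ≤⟨ *-diff a b c d ⟩
    abs a * abs (b - d) + abs d * abs (a - c)  ≤⟨ +-mono-≤ (*-mono-≤ 0≤B (0≤∣p∣ (b - d)) ha hbd) (*-mono-≤ 0≤D (0≤∣p∣ (a - c)) hd hac) ⟩
    B * δ + D * η                              ≤⟨ +-mono-≤ Bδ Dη ⟩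
    ε * ½ + ε * ½                              ≡⟨ ½+½ ε ⟩
    ε ∎
    where
    open ≤-Reasoning

  scale-close : ∀ x y c L d → 0ℚ ≤ c → abs (x - y) ≤ L * d → abs (x * c - y * c) ≤ L * c * d
  scale-close x y c L d 0≤c h = begin
    abs (x * c - y * c)    ≡⟨ cong abs (solve 3 (λ x y c → x :* c :- y :* c := (x :- y) :* c) refl x y c) ⟩
    abs ((x - y) * c)      ≡⟨ ∣p*q∣≡∣p∣*∣q∣ (x - y) c ⟩
    abs (x - y) * abs c    ≡⟨ cong (abs (x - y) *_) (0≤p⇒∣p∣≡p 0≤c) ⟩
    abs (x - y) * c        ≤⟨ *-monoʳ-≤-nonNeg c {{ℚ.nonNegative 0≤c}} h ⟩
    L * d * c              ≡⟨ solve 3 (λ L d c → L :* d :* c := L :* c :* d) refl L d c ⟩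
    L * c * d ∎
    where
    open ≤-Reasoning
    open +-*-Solver

  add-close : ∀ x y z w L M d → abs (x - z) ≤ L * d → abs (y - w) ≤ M * d →
              abs (x + y - (z + w)) ≤ (L + M) * d
  add-close x y z w L M d h g = begin
    abs (x + y - (z + w))          ≡⟨ cong abs (solve 4 (λ x y z w → x :+ y :- (z :+ w) := (x :- z) :+ (y :- w)) refl x y z w) ⟩
    abs ((x - z) + (y - w))        ≤⟨ ∣p+q∣≤∣p∣+∣q∣ (x - z) (y - w) ⟩
    abs (x - z) + abs (y - w)      ≤⟨ +-mono-≤ h g ⟩
    L * d + M * d                  ≡⟨ *-distribʳ-+ d L M ⟨
    (L + M) * d ∎
    where
    open ≤-Reasoning
    open +-*-Solver

  const-cauchy : ∀ q → IsCauchy (λ _ → q)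
  const-cauchy q ε 0<ε = 0 , λ _ _ _ _ → subst (_≤ ε) (sym (cong abs (+-inverseʳ q))) (<⇒≤ 0<ε)

  neg-cauchy : ∀ {s} → IsCauchy s → IsCauchy (λ n → - s n)
  neg-cauchy {s} cs ε 0<ε with cs ε 0<ε
  ... | N , h = N , λ m n p q → subst (_≤ ε)
      (cong abs (solve 2 (λ a b → b :- a := :- a :- (:- b)) refl (s m) (s n)))
      (h n m q p)
    where
    open +-*-Solver

  *-cauchy : ∀ {s t} → IsCauchy s → IsCauchy t → IsCauchy (λ n → s n * t n)
  *-cauchy {s} {t} cs ct ε 0<ε =
    let B , 0≤B , N₁ , hB = bounded cs
        D , 0≤D , N₂ , hD = bounded ct
        ε/2 = ε * ½
        0<ε/2 = 0<* {ε} {½} 0<ε 0<½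
        δ , 0<δ , Bδ = shrink B ε/2 0<ε/2
        η , 0<η , Dη = shrink D ε/2 0<ε/2
        N₃ , ht = ct δ 0<δ
        N₄ , hs = cs η 0<η
        L₁₂ = N₁ ℕ.⊔ N₂
        L₃₄ = N₃ ℕ.⊔ N₄
    in L₁₂ ℕ.⊔ L₃₄ , λ m n p q →
      let p₁₂ = ℕ.m⊔n≤o⇒m≤o L₁₂ L₃₄ p ; p₃₄ = ℕ.m⊔n≤o⇒n≤o L₁₂ L₃₄ p
          q₁₂ = ℕ.m⊔n≤o⇒m≤o L₁₂ L₃₄ q ; q₃₄ = ℕ.m⊔n≤o⇒n≤o L₁₂ L₃₄ q
      in *-close (s m) (t m) (s n) (t n) B δ D η ε 0≤B 0≤D
           (hB m (ℕ.m⊔n≤o⇒m≤o N₁ N₂ p₁₂))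
           (ht m n (ℕ.m⊔n≤o⇒m≤o N₃ N₄ p₃₄) (ℕ.m⊔n≤o⇒m≤o N₃ N₄ q₃₄))
           (hD n (ℕ.m⊔n≤o⇒n≤o N₁ N₂ q₁₂))
           (hs m n (ℕ.m⊔n≤o⇒n≤o N₃ N₄ p₃₄) (ℕ.m⊔n≤o⇒n≤o N₃ N₄ q₃₄))
           Bδ Dη

  ι1 : ι 1 ≡ 1ℚ
  ι1 = refl

  decay-step : ∀ i j t u v → 0ℚ ≤ t → 0ℚ ≤ j → i ≤ j + j → t + t ≤ u → j * u ≤ v → i * t ≤ v
  decay-step i j t u v 0≤t 0≤j hi ht hu = begin
    i * t          ≤⟨ *-monoʳ-≤-nonNeg t {{ℚ.nonNegative 0≤t}} hi ⟩
    (j + j) * t    ≡⟨ solve 2 (λ s t → (s :+ s) :* t := s :* (t :+ t)) refl j t ⟩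
    j * (t + t)    ≤⟨ *-monoˡ-≤-nonNeg j {{ℚ.nonNegative 0≤j}} ht ⟩
    j * u          ≤⟨ hu ⟩
    v ∎
    where
    open ≤-Reasoning
    open +-*-Solver

  cancel : ∀ i j t v δ → ℚ.Positive i → 0ℚ < δ → i * t ≤ v → v ≤ j * δ → j ≤ i → t ≤ δ
  cancel i j t v δ i⁺ 0<δ p q j≤i = *-cancelˡ-≤-pos i {{i⁺}} (begin
    i * t   ≤⟨ p ⟩
    v       ≤⟨ q ⟩
    j * δ   ≤⟨ *-monoʳ-≤-nonNeg δ {{ℚ.nonNegative (<⇒≤ 0<δ)}} j≤i ⟩
    i * δ ∎)
    where
    open ≤-Reasoning

  module _ (B : ℚ) (0≤B : 0ℚ ≤ B) where

    T : ℕ → ℚ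
    T = expTerm B

    0≤^ : ∀ k → 0ℚ ≤ B ^ k
    0≤^ zero    = 0≤1
    0≤^ (suc k) = 0≤* 0≤B (0≤^ k)

    0≤T : ∀ k → 0ℚ ≤ T k
    0≤T k = 0≤* (0≤^ k) (nonNegative⁻¹ _ {{r-nonNeg k}})

    abs-^ : ∀ {a} → abs a ≤ B → ∀ k → abs (a ^ k) ≤ B ^ k
    abs-^ h zero = ≤-refl
    abs-^ {a} h (suc k) = subst (_≤ B * B ^ k) (sym (∣p*q∣≡∣p∣*∣q∣ a (a ^ k)))
      (*-mono-≤ 0≤B (0≤∣p∣ _) h (abs-^ h k))

    abs-*r : ∀ x k → abs (x * r k) ≡ abs x * r k
    abs-*r x k = trans (∣p*q∣≡∣p∣*∣q∣ x (r k)) (cong (abs x *_) (0≤p⇒∣p∣≡p (nonNegative⁻¹ _ {{r-nonNeg k}})))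

    abs-term : ∀ {a} → abs a ≤ B → ∀ k → abs (expTerm a k) ≤ T k
    abs-term {a} h k = subst (_≤ T k) (sym (abs-*r (a ^ k) k))
      (*-monoʳ-≤-nonNeg (r k) {{r-nonNeg k}} (abs-^ h k))

    Lipschitz : (ℚ → ℚ) → Set
    Lipschitz f = ∃[ L ] ∀ a b → abs a ≤ B → abs b ≤ B → abs (f a - f b) ≤ L * abs (a - b)

    ^-lip : ∀ k → Lipschitz (_^ k)
    ^-lip zero    = 0ℚ , λ a b _ _ → ≤-reflexive (sym (*-zeroˡ (abs (a - b))))
    ^-lip (suc k) with ^-lip k
    ... | L , h = B * L + B ^ k , λ a b ha hb → begin
      abs (a * a ^ k - b * b ^ k)                                  ≤⟨ *-diff a (a ^ k) b (b ^ k) ⟩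
      abs a * abs (a ^ k - b ^ k) + abs (b ^ k) * abs (a - b)      ≤⟨ +-mono-≤ (*-mono-≤ 0≤B (0≤∣p∣ _) ha (h a b ha hb))
                                                                       (*-monoʳ-≤-nonNeg (abs (a - b)) {{∣-∣-nonNeg (a - b)}} (abs-^ hb k)) ⟩
      B * (L * abs (a - b)) + B ^ k * abs (a - b)                  ≡⟨ solve 4 (λ B L P d → B :* (L :* d) :+ P :* d := (B :* L :+ P) :* d) refl B L (B ^ k) (abs (a - b)) ⟩
      (B * L + B ^ k) * abs (a - b) ∎
      where
      open ≤-Reasoning
      open +-*-Solver

    term-lip : ∀ k → Lipschitz (λ a → expTerm a k)
    term-lip k = proj₁ (^-lip k) * r k , λ a b ha hb →
      scale-close (a ^ k) (b ^ k) (r k) (proj₁ (^-lip k)) (abs (a - b)) (nonNegative⁻¹ (r k) {{r-nonNeg k}})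
        (proj₂ (^-lip k) a b ha hb)

    sum-lip : ∀ N → Lipschitz (λ a → expSum a N)
    sum-lip zero    = 0ℚ , λ a b _ _ → ≤-reflexive (sym (*-zeroˡ (abs (a - b))))
    sum-lip (suc N) = proj₁ (sum-lip N) + proj₁ (term-lip N) , λ a b ha hb →
      add-close (expSum a N) (expTerm a N) (expSum b N) (expTerm b N) (proj₁ (sum-lip N)) (proj₁ (term-lip N)) (abs (a - b))
        (proj₂ (sum-lip N) a b ha hb) (proj₂ (term-lip N) a b ha hb)

    module _ (K : ℕ) (hK : B + B ≤ ι K) where

      halving : ∀ k → K ℕ.≤ k → T (suc k) + T (suc k) ≤ T k
      halving k K≤k = *-cancelʳ-≤-pos (ι (suc k)) {{ι-pos k}} (begin
        (T (suc k) + T (suc k)) * ι (suc k)            ≡⟨ *-distribʳ-+ (ι (suc k)) (T (suc k)) (T (suc k)) ⟩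
        T (suc k) * ι (suc k) + T (suc k) * ι (suc k)  ≡⟨ cong (λ z → z + z) (term-step B k) ⟩
        T k * B + T k * B                              ≡⟨ *-distribˡ-+ (T k) B B ⟨
        T k * (B + B)                                  ≤⟨ *-monoˡ-≤-nonNeg (T k) {{ℚ.nonNegative (0≤T k)}} (≤-trans hK (ι-mono (ℕ.m≤n⇒m≤1+n K≤k))) ⟩
        T k * ι (suc k) ∎)
        where
        open ≤-Reasoning

      tail : ∀ {a} → abs a ≤ B → ∀ N → K ℕ.≤ N → ∀ j →
             abs (expSum a (j ℕ.+ N) - expSum a N) + (T (j ℕ.+ N) + T (j ℕ.+ N)) ≤ T N + T N
      tail {a} h N K≤N zero = ≤-reflexive (trans (cong (λ z → abs z + (T N + T N)) (+-inverseʳ (expSum a N))) (+-identityˡ (T N + T N)))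
      tail {a} h N K≤N (suc j) = begin
        abs (E + t - E₀) + (T (suc M) + T (suc M))   ≤⟨ +-monoʳ-≤ (abs (E + t - E₀)) (halving M (ℕ.≤-trans K≤N (ℕ.m≤n+m N j))) ⟩
        abs (E + t - E₀) + T M                       ≡⟨ cong (λ z → abs z + T M) (solve 3 (λ x y z → x :+ y :- z := (x :- z) :+ y) refl E t E₀) ⟩
        abs ((E - E₀) + t) + T M                     ≤⟨ +-monoˡ-≤ (T M) (≤-trans (∣p+q∣≤∣p∣+∣q∣ (E - E₀) t) (+-monoʳ-≤ (abs (E - E₀)) (abs-term h M))) ⟩
        abs (E - E₀) + T M + T M                     ≡⟨ +-assoc (abs (E - E₀)) (T M) (T M) ⟩
        abs (E - E₀) + (T M + T M)                   ≤⟨ tail h N K≤N j ⟩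
        T N + T N ∎
        where
        open ≤-Reasoning
        open +-*-Solver
        M = j ℕ.+ N ; E = expSum a M ; t = expTerm a M ; E₀ = expSum a N

      tail′ : ∀ {a} → abs a ≤ B → ∀ N → K ℕ.≤ N → ∀ m → N ℕ.≤ m →
              abs (expSum a m - expSum a N) ≤ T N + T N
      tail′ {a} h N K≤N m N≤m = subst (λ z → abs (expSum a z - expSum a N) ≤ T N + T N) (ℕ.m∸n+n≡m N≤m)
        (≤-trans (p≤p+q _ (T M + T M) (0≤+ (0≤T M) (0≤T M))) (tail h N K≤N (m ℕ.∸ N)))
        where
        M = m ℕ.∸ N ℕ.+ N

      decay : ∀ j → ι (suc j) * T (j ℕ.+ K) ≤ T K
      decay zero    = ≤-reflexive (trans (cong (_* T K) ι1) (*-identityˡ (T K)))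
      decay (suc j) = decay-step (ι (suc (suc j))) (ι (suc j)) (T (suc (j ℕ.+ K))) (T (j ℕ.+ K)) (T K)
        (0≤T (suc (j ℕ.+ K))) (nonNegative⁻¹ (ι (suc j)) {{ι-nonNeg (suc j)}})
        (≤-trans (ι-mono {suc (suc j)} {suc j ℕ.+ suc j} (ℕ.s≤s (ℕ.m≤n+m (suc j) j))) (≤-reflexive (ι-+ (suc j) (suc j))))
        (halving (j ℕ.+ K) (ℕ.m≤n+m K j)) (decay j)

      small : ∀ δ → 0ℚ < δ → ∃[ N ] K ℕ.≤ N × T N ≤ δ
      small δ 0<δ = let j , h = archimedean (T K) δ 0<δ in j ℕ.+ K , ℕ.m≤n+m K j ,
        cancel (ι (suc j)) (ι j) (T (j ℕ.+ K)) (T K) δ (ι-pos j) 0<δ (decay j) h (ι-mono {j} {suc j} (ℕ.n≤1+n j))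

  exp-close : ∀ x y z w L δ d ε → abs (x - y) ≤ ε * ½ * ½ → abs (w - z) ≤ ε * ½ * ½ →
              abs (y - z) ≤ L * d → 0ℚ ≤ d → d ≤ δ → abs L * δ ≤ ε * ½ → abs (x - w) ≤ ε
  exp-close x y z w L δ d ε hx hw hL 0≤d hd Lδ = begin
    abs (x - w)                                  ≤⟨ abs-tri x y w ⟩
    abs (x - y) + abs (y - w)                    ≤⟨ +-monoʳ-≤ (abs (x - y)) (abs-tri y z w) ⟩
    abs (x - y) + (abs (y - z) + abs (z - w))    ≡⟨ cong (λ u → abs (x - y) + (abs (y - z) + u)) (abs-sym z w) ⟩
    abs (x - y) + (abs (y - z) + abs (w - z))    ≤⟨ +-mono-≤ hx (+-mono-≤ mid hw) ⟩
    ε * ½ * ½ + (ε * ½ + ε * ½ * ½)              ≡⟨ solve 2 (λ a b → a :+ (b :+ a) := b :+ (a :+ a)) refl (ε * ½ * ½) (ε * ½) ⟩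
    ε * ½ + (ε * ½ * ½ + ε * ½ * ½)              ≡⟨ cong (λ u → ε * ½ + u) (½+½ (ε * ½)) ⟩
    ε * ½ + ε * ½                                ≡⟨ ½+½ ε ⟩
    ε ∎
    where
    open ≤-Reasoning
    open +-*-Solver
    p≤∣p∣ : ∀ p → p ≤ abs p
    p≤∣p∣ p with ≤-total 0ℚ p
    ... | inj₁ 0≤p = ≤-reflexive (sym (0≤p⇒∣p∣≡p 0≤p))
    ... | inj₂ p≤0 = ≤-trans p≤0 (0≤∣p∣ p)
    mid : abs (y - z) ≤ ε * ½
    mid = begin
      abs (y - z)   ≤⟨ hL ⟩
      L * d         ≤⟨ *-monoʳ-≤-nonNeg d {{ℚ.nonNegative 0≤d}} (p≤∣p∣ L) ⟩
      abs L * d     ≤⟨ *-monoˡ-≤-nonNeg (abs L) {{∣-∣-nonNeg L}} hd ⟩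
      abs L * δ     ≤⟨ Lδ ⟩
      ε * ½ ∎

  exp-cauchy : ∀ {s} → IsCauchy s → IsCauchy (λ n → expSum (s n) n)
  exp-cauchy {s} cs ε 0<ε =
    let B , 0≤B , N₁ , hB = bounded cs
        K , hK = ≤ι (B + B)
        0<ε/2 = 0<* {ε} {½} 0<ε 0<½
        0<ε/8 = 0<* {ε * ½ * ½} {½} (0<* {ε * ½} {½} 0<ε/2 0<½) 0<½
        N₀ , K≤N₀ , hT = small B 0≤B K hK (ε * ½ * ½ * ½) 0<ε/8
        L , hL = sum-lip B 0≤B N₀
        δ , 0<δ , Lδ = shrink (abs L) (ε * ½) 0<ε/2
        N₂ , hs = cs δ 0<δ
        N₀₂ = N₀ ℕ.⊔ N₂
        N = N₁ ℕ.⊔ N₀₂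
        N₁≤ : ∀ {k} → N ℕ.≤ k → N₁ ℕ.≤ k
        N₁≤ = ℕ.m⊔n≤o⇒m≤o N₁ N₀₂
        N₀≤ : ∀ {k} → N ℕ.≤ k → N₀ ℕ.≤ k
        N₀≤ p = ℕ.m⊔n≤o⇒m≤o N₀ N₂ (ℕ.m⊔n≤o⇒n≤o N₁ N₀₂ p)
        N₂≤ : ∀ {k} → N ℕ.≤ k → N₂ ℕ.≤ k
        N₂≤ p = ℕ.m⊔n≤o⇒n≤o N₀ N₂ (ℕ.m⊔n≤o⇒n≤o N₁ N₀₂ p)
        tl : ∀ m → N ℕ.≤ m → abs (expSum (s m) m - expSum (s m) N₀) ≤ ε * ½ * ½
        tl m p = ≤-trans (tail′ B 0≤B K hK (hB m (N₁≤ p)) N₀ K≤N₀ m (N₀≤ p))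
                   (≤-trans (+-mono-≤ hT hT) (≤-reflexive (½+½ (ε * ½ * ½))))
    in N , λ m n p q →
      exp-close (expSum (s m) m) (expSum (s m) N₀) (expSum (s n) N₀) (expSum (s n) n) L δ (abs (s m - s n)) ε
        (tl m p) (tl n q) (hL (s m) (s n) (hB m (N₁≤ p)) (hB n (N₁≤ q)))
        (0≤∣p∣ (s m - s n)) (hs m n (N₂≤ p) (N₂≤ q)) Lδ

open CauchyLemmas using (const-cauchy; neg-cauchy; *-cauchy; exp-cauchy)

-- Cauchy sequences of rationals; two of them denote the same real number when
-- each is ≤ᵣ the other.
record ℝ : Set where
  constructor mkℝ
  field
    seq    : ℕ → ℚ
    cauchy : IsCauchy seq

open ℝ public

infix  4 _<ᵣ_ _≤ᵣ_
infixl 7 _*ᵣ_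
infix  8 -ᵣ_

_<ᵣ_ : ℝ → ℝ → Set
x <ᵣ y = ∃[ ε ] 0ℚ < ε × ∃[ N ] ∀ n → N ℕ.≤ n → seq x n + ε ≤ seq y n

_≤ᵣ_ : ℝ → ℝ → Set
x ≤ᵣ y = ∀ ε → 0ℚ < ε → ∃[ N ] ∀ n → N ℕ.≤ n → seq x n ≤ seq y n + ε

fromℚ : ℚ → ℝ
fromℚ q = mkℝ (λ _ → q) (const-cauchy q)

fromℕ : ℕ → ℝ
fromℕ n = fromℚ (+ n / 1)

0ᵣ : ℝ
0ᵣ = fromℚ 0ℚ

-ᵣ_ : ℝ → ℝ
-ᵣ x = mkℝ (λ n → - seq x n) (neg-cauchy {seq x} (cauchy x))

_*ᵣ_ : ℝ → ℝ → ℝ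
x *ᵣ y = mkℝ (λ n → seq x n * seq y n) (*-cauchy {seq x} {seq y} (cauchy x) (cauchy y))

-- exp x = Σ_k xᵏ/k!, as the limit of the diagonal sequence
-- n ↦ Σ_{k<n} (xₙ)ᵏ/k!.
exp : ℝ → ℝ
exp x = mkℝ (λ n → expSum (seq x n) n) (exp-cauchy {seq x} (cauchy x))

{-# OPTIONS --safe #-}
-- Lower bound: the first vertex of an even ordering has even degree, so a
-- graph all of whose degrees are odd is not even-degenerate, and neither is
-- such a graph with one isolated vertex added.  In even order, the row of the
-- vertex 0 can be chosen such that all other degrees are odd, and then the
-- degree of 0 is odd by the handshake lemma.
--
-- Upper bound: set aside the vertices 0 and 1.  Given the rest H and the row x
-- of 1, the row of 0 corresponds to the degree parities g of the vertices of
-- H, so (H , g , x) is uniform and the vertices of H can be taken to arrive one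
-- at a time.  We look for orderings L, D, 0, R, 1 of a special form.  An
-- arriving vertex may go to the front of R if its number of neighbours in R
-- has parity x, and to the end of L if its number of neighbours in L has
-- parity g; whatever goes to the front of D carries a label, the parity that
-- remains to be corrected by later arrivals in L and D, and all labels must
-- vanish in the end.  The condition on 0 amounts to x = e(G) modulo 2 at the
-- last vertex of R.  After p + m arrivals that produce many separated states, the
-- remaining vertices arrive in pairs, each of which can be placed in more than
-- one admissible way on average.  Different states see independent bits, so by
-- a second moment computation the weighted number of states without labels is
-- concentrated, with an exponentially small probability to be 0.
module Submission where

open import Data.Nat using (ℕ; _≤_)
open import Data.Product using (_×_; ∃-syntax)
open import Relation.Nullary.Decidable using (¬?)
open import Defs

open import Data.Nat using (zero; suc)
open import Data.Product using (_,_; proj₁; proj₂; uncurry)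
import Data.Nat as ℕ
import Data.Nat.Properties as ℕ
import Data.Nat.DivMod as ℕ
import Data.Nat.Solver as ℕSolver
import Algebra.Properties.CommutativeMonoid.Sum as Sum
open import Algebra.Bundles using (CommutativeRing)
import Algebra.Definitions.RawSemiring as RawSemiring
open import Data.Bool using (Bool; T; true; false; _∧_; _∨_; _xor_; not; if_then_else_)
import Data.Bool.Properties as Bool
open import Data.Empty using (⊥-elim)
open import Data.Fin using (Fin; zero; suc; toℕ; _↑ʳ_)
open import Data.Fin.Permutation using (Permutation′; _⟨$⟩ʳ_; _⟨$⟩ˡ_; _∘ₚ_; cast-id)
import Data.Fin.Permutation as FinPerm
open import Data.Fin.Subset using (∣_∣)
import Data.Fin as Fin
import Data.Fin.Properties as Fin
open import Data.Integer using (+_)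
open import Data.List using (List; []; _∷_; length; filter)
import Data.List as List
import Data.List.Properties as List
open import Data.List.Relation.Unary.All using (All; []; _∷_)
import Data.List.Relation.Unary.All as All
import Data.List.Relation.Unary.All.Properties as All
open import Data.List.Relation.Unary.AllPairs using (AllPairs; []; _∷_)
import Data.List.Relation.Unary.AllPairs.Properties as AllPairs
open import Data.List.Relation.Binary.Permutation.Propositional using (_↭_; ↭-prep; ↭-swap; ↭-trans; ↭-refl; ↭-reflexive)
import Data.List.Relation.Binary.Permutation.Propositional as Perm
import Data.List.Relation.Binary.Permutation.Propositional.Properties as Perm
open import Data.List.Relation.Binary.Permutation.Homogeneous using (onIndices)
open import Data.List.Relation.Binary.Permutation.Setoid.Properties using (onIndices-lookup)
open import Data.Nat.Divisibility using (_∣_; ∣m+n∣m⇒∣n; ∣m∣n⇒∣m+n; ∣-refl; _∣0; ∣1⇒≡1)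
open import Data.Rational using (ℚ; 0ℚ; 1ℚ; ½; _+_; _*_; _-_; -_; _/_)
  renaming (_≤_ to _≼_; _<_ to _≺_; ∣_∣ to abs)
import Data.Rational as ℚ
import Data.Rational.Properties as ℚ
open import Data.Rational.Solver using (module +-*-Solver)
open +-*-Solver using (solve; _:=_; _:+_; _:*_; :-_; con)
import Data.Nat.Combinatorics as ℕ
import Data.Integer as ℤ
import Data.Integer.Properties as ℤ
import Data.Rational.Unnormalised as ℚᵘ
import Data.Rational.Unnormalised.Properties as ℚᵘ
open import Data.Sum using (_⊎_; inj₁; inj₂; [_,_]′)
open import Data.Unit using (⊤; tt)
open import Data.Vec using (Vec; []; _∷_; _++_; lookup; zipWith; replicate; tabulate)
import Data.Vec as Vec
import Data.Vec.Properties as Vec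
open import Function using (_∘_; case_of_)
open import Relation.Binary.PropositionalEquality
open import Relation.Nullary using (¬_; Dec; yes; no; does)
open import Relation.Nullary.Decidable using (toWitness; dec-true; ⌊_⌋)
open import Relation.Unary using (Decidable)

-- Vertices placed one at a time would have two sides to choose from, each admissible with
-- probability 1/2: a critical branching process, whose second moment does not contract. An adjacent
-- pair may enter one side in two orders; this raises the mean to 5/4 placements per pair, and the
-- diagonal of the second moment then shrinks by 5/6 per pair. A single starting state would still
-- leave a variance bound of constant order, so exponentially many separated states are needed
-- before the pairs begin. The part D provides them: in that phase no state dies, since a vertex
-- that cannot go to both sides is deferred. The price is a label vector over the field with two
-- elements of length P = p + m, which vanishes with probability 2^-P; the normalisation by 2^P puts
-- a factor 4^P in front of the error of the second moment. Pairs with a vertex on the left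
-- randomise the labels, the error decays like (7/8)^k, and k at least 11 P + K outweighs the factor
-- because (8/7)^11 exceeds 4.

-- Averages over finite uniform probability spaces.

record Linear (B : Set) : Set where
  field
    ⟦_⟧     : (B → ℚ) → ℚ
    ⟦⟧-+    : ∀ f g → ⟦_⟧ (λ b → f b + g b) ≡ ⟦_⟧ f + ⟦_⟧ g
    ⟦⟧-*    : ∀ c f → ⟦_⟧ (λ b → c * f b) ≡ c * ⟦_⟧ f
    ⟦⟧-cong : ∀ {f g} → (∀ b → f b ≡ g b) → ⟦_⟧ f ≡ ⟦_⟧ g

open Linear

-- The field `𝔼-Λ` covers two interchanges at once: with another mean it is Fubini, with a weighted
-- population it moves the average over new arrivals inside the sum over states.
record Mean (A : Set) : Set₁ where
  field
    𝔼       : (A → ℚ) → ℚ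
    𝔼-+     : ∀ f g → 𝔼 (λ a → f a + g a) ≡ 𝔼 f + 𝔼 g
    𝔼-*     : ∀ c f → 𝔼 (λ a → c * f a) ≡ c * 𝔼 f
    𝔼-const : ∀ c → 𝔼 (λ _ → c) ≡ c
    𝔼-mono  : ∀ {f g} → (∀ a → f a ≼ g a) → 𝔼 f ≼ 𝔼 g
    𝔼-Λ     : ∀ {B} (Λ : Linear B) (f : A → B → ℚ) →
              𝔼 (λ a → ⟦ Λ ⟧ (f a)) ≡ ⟦ Λ ⟧ (λ b → 𝔼 (λ a → f a b))

  𝔼-cong : ∀ {f g} → (∀ a → f a ≡ g a) → 𝔼 f ≡ 𝔼 g
  𝔼-cong h = ℚ.≤-antisym (𝔼-mono (λ a → ℚ.≤-reflexive (h a))) (𝔼-mono (λ a → ℚ.≤-reflexive (sym (h a))))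

  𝔼-*ʳ : ∀ c f → 𝔼 (λ a → f a * c) ≡ 𝔼 f * c
  𝔼-*ʳ c f = trans (𝔼-cong (λ a → ℚ.*-comm (f a) c)) (trans (𝔼-* c f) (ℚ.*-comm c (𝔼 f)))

  𝔼-≤ : ∀ {f} c → (∀ a → f a ≼ c) → 𝔼 f ≼ c
  𝔼-≤ c h = ℚ.≤-trans (𝔼-mono h) (ℚ.≤-reflexive (𝔼-const c))

  𝔼-≥ : ∀ {f} c → (∀ a → c ≼ f a) → c ≼ 𝔼 f
  𝔼-≥ c h = ℚ.≤-trans (ℚ.≤-reflexive (sym (𝔼-const c))) (𝔼-mono h)

  linear : Linear A
  linear = record { ⟦_⟧ = 𝔼 ; ⟦⟧-+ = 𝔼-+ ; ⟦⟧-* = 𝔼-* ; ⟦⟧-cong = 𝔼-cong }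

open Mean

𝔼-swap : ∀ {A B} (M : Mean A) (N : Mean B) (f : A → B → ℚ) →
         𝔼 M (λ a → 𝔼 N (f a)) ≡ 𝔼 N (λ b → 𝔼 M (λ a → f a b))
𝔼-swap M N = 𝔼-Λ M (linear N)

0≼½ : 0ℚ ≼ ½
0≼½ = ℚ.nonNegative⁻¹ ½

*-monoˡ : ∀ {c p q} → 0ℚ ≼ c → p ≼ q → c * p ≼ c * q
*-monoˡ {c} 0≤c = ℚ.*-monoˡ-≤-nonNeg c {{ℚ.nonNegative 0≤c}}

*-monoʳ : ∀ {c p q} → 0ℚ ≼ c → p ≼ q → p * c ≼ q * c
*-monoʳ {c} 0≤c = ℚ.*-monoʳ-≤-nonNeg c {{ℚ.nonNegative 0≤c}}

one : ∀ {A} → A → Mean A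
one a = record
  { 𝔼 = λ f → f a ; 𝔼-+ = λ _ _ → refl ; 𝔼-* = λ _ _ → refl ; 𝔼-const = λ _ → refl
  ; 𝔼-mono = λ h → h a ; 𝔼-Λ = λ _ _ → refl }

opaque
  coin : Mean Bool
  coin = record
    { 𝔼       = λ f → ½ * (f true + f false)
    ; 𝔼-+     = λ f g → solve 4 (λ a b c d → con ½ :* ((a :+ b) :+ (c :+ d)) := con ½ :* (a :+ c) :+ con ½ :* (b :+ d)) refl
                          (f true) (g true) (f false) (g false)
    ; 𝔼-*     = λ c f → solve 3 (λ c a b → con ½ :* (c :* a :+ c :* b) := c :* (con ½ :* (a :+ b))) refl c (f true) (f false)
    ; 𝔼-const = λ c → solve 1 (λ c → con ½ :* (c :+ c) := c) refl c
    ; 𝔼-mono  = λ h → *-monoˡ 0≼½ (ℚ.+-mono-≤ (h true) (h false))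
    ; 𝔼-Λ     = λ Λ f → sym (trans (⟦⟧-* Λ ½ (λ b → f true b + f false b)) (cong (½ *_) (⟦⟧-+ Λ (f true) (f false))))
    }

  𝔼-coin : ∀ f → 𝔼 coin f ≡ ½ * (f true + f false)
  𝔼-coin f = refl

infixr 4 _⊗_

_⊗_ : ∀ {A B} → Mean A → Mean B → Mean (A × B)
M ⊗ N = record
  { 𝔼       = λ f → 𝔼 M (λ a → 𝔼 N (λ b → f (a , b)))
  ; 𝔼-+     = λ f g → trans (𝔼-cong M (λ a → 𝔼-+ N _ _)) (𝔼-+ M _ _)
  ; 𝔼-*     = λ c f → trans (𝔼-cong M (λ a → 𝔼-* N c _)) (𝔼-* M c _)
  ; 𝔼-const = λ c → trans (𝔼-cong M (λ a → 𝔼-const N c)) (𝔼-const M c)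
  ; 𝔼-mono  = λ h → 𝔼-mono M (λ a → 𝔼-mono N (λ b → h (a , b)))
  ; 𝔼-Λ     = λ Λ f → trans (𝔼-cong M (λ a → 𝔼-Λ N Λ _)) (𝔼-Λ M Λ _)
  }

push : ∀ {A B} → (A → B) → Mean A → Mean B
push t M = record
  { 𝔼       = λ f → 𝔼 M (λ a → f (t a))
  ; 𝔼-+     = λ f g → 𝔼-+ M _ _
  ; 𝔼-*     = λ c f → 𝔼-* M c _
  ; 𝔼-const = 𝔼-const M
  ; 𝔼-mono  = λ h → 𝔼-mono M (λ a → h (t a))
  ; 𝔼-Λ     = λ Λ f → 𝔼-Λ M Λ _
  }

bits : ∀ n → Mean (Vec Bool n)
bits zero    = one []
bits (suc n) = push (uncurry _∷_) (coin ⊗ bits n)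

bits-++ : ∀ m n (F : Vec Bool (m ℕ.+ n) → ℚ) →
          𝔼 (bits (m ℕ.+ n)) F ≡ 𝔼 (bits m) (λ q → 𝔼 (bits n) (λ r → F (q ++ r)))
bits-++ zero    n F = refl
bits-++ (suc m) n F = 𝔼-cong coin (λ b → bits-++ m n (λ S → F (b ∷ S)))

-- Vectors over the field with two elements

infixl 6 _⊕_

_⊕_ : ∀ {n} → Vec Bool n → Vec Bool n → Vec Bool n
_⊕_ = zipWith _xor_

zeros : ∀ n → Vec Bool n
zeros n = replicate n false

dot : ∀ {n} → Vec Bool n → Vec Bool n → Bool
dot []      []      = false
dot (a ∷ S) (b ∷ T) = (a ∧ b) xor dot S T

xor-cancelˡ : ∀ a b → a xor (a xor b) ≡ b
xor-cancelˡ true  b = Bool.not-involutive b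
xor-cancelˡ false b = refl

xor-interchange : ∀ a b c d → (a xor b) xor (c xor d) ≡ (a xor c) xor (b xor d)
xor-interchange a b c d = begin
  (a xor b) xor (c xor d)  ≡⟨ Bool.xor-assoc a b (c xor d) ⟩
  a xor (b xor (c xor d))  ≡⟨ cong (a xor_) (Bool.xor-assoc b c d) ⟨
  a xor ((b xor c) xor d)  ≡⟨ cong (λ z → a xor (z xor d)) (Bool.xor-comm b c) ⟩
  a xor ((c xor b) xor d)  ≡⟨ cong (a xor_) (Bool.xor-assoc c b d) ⟩
  a xor (c xor (b xor d))  ≡⟨ Bool.xor-assoc a c (b xor d) ⟨
  (a xor c) xor (b xor d)  ∎
  where
  open ≡-Reasoning

dot-++ : ∀ {m n} (q s : Vec Bool m) (r t : Vec Bool n) → dot (q ++ r) (s ++ t) ≡ dot q s xor dot r t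
dot-++ []      []      r t = refl
dot-++ (a ∷ q) (b ∷ s) r t = trans (cong ((a ∧ b) xor_) (dot-++ q s r t)) (sym (Bool.xor-assoc (a ∧ b) (dot q s) (dot r t)))

coin-xor : ∀ c (F : Bool → ℚ) → 𝔼 coin (λ b → F (b xor c)) ≡ 𝔼 coin F
coin-xor true  F = trans (𝔼-coin _) (trans (cong (½ *_) (ℚ.+-comm (F false) (F true))) (sym (𝔼-coin F)))
coin-xor false F = 𝔼-cong coin (λ b → cong F (Bool.xor-identityʳ b))

bits-⊕ : ∀ {n} c (F : Vec Bool n → ℚ) → 𝔼 (bits n) (λ S → F (S ⊕ c)) ≡ 𝔼 (bits n) F
bits-⊕ []      F = refl
bits-⊕ {suc n} (b ∷ c) F = trans (𝔼-cong coin (λ a → bits-⊕ c (λ S → F ((a xor b) ∷ S)))) (coin-xor b (λ a → 𝔼 (bits n) (λ S → F (a ∷ S))))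

-- The two products add up to the product of `w` with the nonzero vector `s ⊕ t`; the bit of `w` at
-- a coordinate where `s` and `t` differ is free and makes the sum fair.
dot-uniform : ∀ {n} (s t : Vec Bool n) → s ≢ t → (F : Bool → ℚ) →
              𝔼 (bits n) (λ w → F (dot w s xor dot w t)) ≡ 𝔼 coin F
dot-uniform []          []          s≢t F = ⊥-elim (s≢t refl)
dot-uniform {suc n} (true ∷ s)  (true ∷ t)  s≢t F = trans
  (𝔼-cong coin (λ a → trans
    (𝔼-cong (bits n) (λ w → cong F (trans (xor-interchange (a ∧ true) (dot w s) (a ∧ true) (dot w t))
      (cong (_xor (dot w s xor dot w t)) (Bool.xor-same (a ∧ true))))))
    (dot-uniform s t (s≢t ∘ cong (true ∷_)) F)))
  (𝔼-const coin _)
dot-uniform {suc n} (false ∷ s) (false ∷ t) s≢t F = trans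
  (𝔼-cong coin (λ a → trans
    (𝔼-cong (bits n) (λ w → cong F (trans (xor-interchange (a ∧ false) (dot w s) (a ∧ false) (dot w t))
      (cong (_xor (dot w s xor dot w t)) (Bool.xor-same (a ∧ false))))))
    (dot-uniform s t (s≢t ∘ cong (false ∷_)) F)))
  (𝔼-const coin _)
dot-uniform {suc n} (true ∷ s)  (false ∷ t) s≢t F = trans (𝔼-swap coin (bits n) _) (trans
  (𝔼-cong (bits n) (λ w → trans
    (𝔼-cong coin (λ a → cong F (trans (xor-interchange (a ∧ true) (dot w s) (a ∧ false) (dot w t))
      (cong (_xor (dot w s xor dot w t)) (trans (cong₂ _xor_ (Bool.∧-identityʳ a) (Bool.∧-zeroʳ a)) (Bool.xor-identityʳ a))))))
    (coin-xor (dot w s xor dot w t) F)))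
  (𝔼-const (bits n) _))
dot-uniform {suc n} (false ∷ s) (true ∷ t)  s≢t F = trans (𝔼-swap coin (bits n) _) (trans
  (𝔼-cong (bits n) (λ w → trans
    (𝔼-cong coin (λ a → cong F (trans (xor-interchange (a ∧ false) (dot w s) (a ∧ true) (dot w t))
      (cong (_xor (dot w s xor dot w t)) (trans (cong₂ _xor_ (Bool.∧-zeroʳ a) (Bool.∧-identityʳ a)) refl)))))
    (coin-xor (dot w s xor dot w t) F)))
  (𝔼-const (bits n) _))

-- Arrivals and their admissibility bits

-- An arriving vertex carries its row to the older vertices and two label bits.
Arrival : ℕ → Set
Arrival n = Vec Bool n × Bool × Bool

arrival : ∀ n → Mean (Arrival n)
arrival n = bits n ⊗ coin ⊗ coin

key : ∀ {n} → Arrival n → Bool → Bool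
key (_ , g , x) true  = g
key (_ , g , x) false = x

-- The value `false` means that the vertex may join side `s` on its own: the parity of its
-- neighbours there agrees with the parity that its key bit demands.
val : ∀ {n} → Arrival n → (Bool → Vec Bool n) → Bool → Bool
val α l s = key α s xor dot (proj₁ α) (l s)

val-uniform : ∀ {n} (l : Bool → Vec Bool n) (o : Bool) s (F : Bool → ℚ) →
              𝔼 (arrival n) (λ α → F (val α l s xor o)) ≡ 𝔼 coin F
val-uniform {n} l o true F = trans
  (𝔼-cong (bits n) (λ w → trans
    (𝔼-cong coin (λ g → trans (𝔼-const coin _) (cong F (Bool.xor-assoc g (dot w (l true)) o))))
    (coin-xor (dot w (l true) xor o) F)))
  (𝔼-const (bits n) _)
val-uniform {n} l o false F = trans
  (𝔼-cong (bits n) (λ w → trans (𝔼-const coin _) (trans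
    (𝔼-cong coin (λ x → cong F (Bool.xor-assoc x (dot w (l false)) o)))
    (coin-xor (dot w (l false) xor o) F))))
  (𝔼-const (bits n) _)

-- The common key makes the first bit fair; the second differs from it by the product of the row
-- with `s ⊕ t`, which does not involve the key and is fair by `dot-uniform`.
same-side : ∀ {n} (s t : Vec Bool n) → s ≢ t → (o o′ : Bool) (F : Bool → Bool → ℚ) →
            𝔼 (bits n) (λ w → 𝔼 coin (λ k → F ((k xor dot w s) xor o) ((k xor dot w t) xor o′)))
            ≡ 𝔼 coin (λ u → 𝔼 coin (F u))
same-side {n} s t s≢t o o′ F = begin
  𝔼 (bits n) (λ w → 𝔼 coin (λ k → F ((k xor dot w s) xor o) ((k xor dot w t) xor o′)))
    ≡⟨ 𝔼-cong (bits n) (λ w → 𝔼-cong coin (λ k → cong₂ F (Bool.xor-assoc k (dot w s) o)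
         (rearrange k (dot w s) (dot w t) o o′))) ⟩
  𝔼 (bits n) (λ w → 𝔼 coin (λ k → F (k xor (dot w s xor o)) ((k xor (dot w s xor o)) xor ((dot w s xor dot w t) xor (o xor o′)))))
    ≡⟨ 𝔼-cong (bits n) (λ w → coin-xor (dot w s xor o) (λ k → F k (k xor ((dot w s xor dot w t) xor (o xor o′))))) ⟩
  𝔼 (bits n) (λ w → 𝔼 coin (λ k → F k (k xor ((dot w s xor dot w t) xor (o xor o′)))))
    ≡⟨ 𝔼-swap (bits n) coin _ ⟩
  𝔼 coin (λ k → 𝔼 (bits n) (λ w → F k (k xor ((dot w s xor dot w t) xor (o xor o′)))))
    ≡⟨ 𝔼-cong coin (λ k → trans (dot-uniform s t s≢t (λ y → F k (k xor (y xor (o xor o′)))))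
         (trans (𝔼-cong coin (λ y → cong (F k) (regroup k y (o xor o′)))) (coin-xor (k xor (o xor o′)) (F k)))) ⟩
  𝔼 coin (λ u → 𝔼 coin (F u)) ∎
  where
  open ≡-Reasoning
  rearrange : ∀ k d e o o′ → (k xor e) xor o′ ≡ (k xor (d xor o)) xor ((d xor e) xor (o xor o′))
  rearrange k d e o o′ = begin
    (k xor e) xor o′                                    ≡⟨ Bool.xor-assoc k e o′ ⟩
    k xor (e xor o′)                                    ≡⟨ cong (k xor_) (xor-cancelˡ (d xor o) (e xor o′)) ⟨
    k xor ((d xor o) xor ((d xor o) xor (e xor o′)))    ≡⟨ cong (λ z → k xor ((d xor o) xor z)) (xor-interchange d o e o′) ⟩
    k xor ((d xor o) xor ((d xor e) xor (o xor o′)))    ≡⟨ Bool.xor-assoc k (d xor o) _ ⟨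
    (k xor (d xor o)) xor ((d xor e) xor (o xor o′))    ∎
  regroup : ∀ k y c → k xor (y xor c) ≡ y xor (k xor c)
  regroup k y c = trans (sym (Bool.xor-assoc k y c)) (trans (cong (_xor c) (Bool.xor-comm k y)) (Bool.xor-assoc y k c))

-- On opposite sides the two keys are independent; on one side the difference of the two sets
-- decides. Since `s` and `s′` are arbitrary, two states have to differ in their left sets and in
-- their right sets.
val-independent : ∀ {n} (l l′ : Bool → Vec Bool n) → (∀ s → l s ≢ l′ s) → (o o′ : Bool) (s s′ : Bool) (F : Bool → Bool → ℚ) →
                  𝔼 (arrival n) (λ α → F (val α l s xor o) (val α l′ s′ xor o′)) ≡ 𝔼 coin (λ u → 𝔼 coin (F u))
val-independent {n} l l′ l≢l′ o o′ true true F =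
  trans (𝔼-cong (bits n) (λ w → 𝔼-cong coin (λ g → 𝔼-const coin _))) (same-side (l true) (l′ true) (l≢l′ true) o o′ F)
val-independent {n} l l′ l≢l′ o o′ false false F =
  trans (𝔼-cong (bits n) (λ w → 𝔼-const coin _)) (same-side (l false) (l′ false) (l≢l′ false) o o′ F)
val-independent {n} l l′ l≢l′ o o′ true false F = trans
  (𝔼-cong (bits n) (λ w → trans
    (𝔼-cong coin (λ g → trans
      (𝔼-cong coin (λ x → cong₂ F (Bool.xor-assoc g _ o) (Bool.xor-assoc x _ o′)))
      (coin-xor (dot w (l′ false) xor o′) (F (g xor (dot w (l true) xor o))))))
    (coin-xor (dot w (l true) xor o) (λ g → 𝔼 coin (F g)))))
  (𝔼-const (bits n) _)
val-independent {n} l l′ l≢l′ o o′ false true F = trans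
  (𝔼-cong (bits n) (λ w → trans (𝔼-swap coin coin (λ g x → F ((x xor dot w (l false)) xor o) ((g xor dot w (l′ true)) xor o′))) (trans
    (𝔼-cong coin (λ x → trans
      (𝔼-cong coin (λ g → cong₂ F (Bool.xor-assoc x _ o) (Bool.xor-assoc g _ o′)))
      (coin-xor (dot w (l′ true) xor o′) (F (x xor (dot w (l false) xor o))))))
    (coin-xor (dot w (l false) xor o) (λ x → 𝔼 coin (F x))))))
  (𝔼-const (bits n) _)

open RawSemiring ℚ.+-*-rawSemiring using (_^_)

0≼* : ∀ {p q} → 0ℚ ≼ p → 0ℚ ≼ q → 0ℚ ≼ p * q
0≼* = CauchyLemmas.0≤*

-- Weighted placements of a pair

Sides : Set
Sides = Bool × Bool

sides : Mean Sides
sides = coin ⊗ coin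

𝔼-sides : ∀ f → 𝔼 sides f ≡
          ½ * (½ * (f (true , true) + f (true , false)) + ½ * (f (false , true) + f (false , false)))
𝔼-sides f = trans (𝔼-coin _) (cong (½ *_) (cong₂ _+_ (𝔼-coin _) (𝔼-coin _)))

-- Two vertices q, q′ arrive together, a tells whether they are adjacent, and
-- the pair c says which of them is placed on the left.  Given the bits u of q
-- and v of q′ on these sides, weight a c u v ≠ 0 iff the placement is
-- admissible in one of the two possible orders; if q and q′ are adjacent and
-- go to the same side then the condition is u ≠ v, and this is what makes the
-- expected number of admissible placements exceed 1.  The weights are
-- normalised so as to have mean 1 over c and over the bits.
weight : Bool → Sides → Bool → Bool → ℚ
weight false c           u v = if u ∨ v then 0ℚ else + 4 / 1
weight true  (s₁ , s₂) u v =
  if s₁ xor s₂ then (if u ∨ v then 0ℚ else + 8 / 3) else (if u xor v then + 8 / 3 else 0ℚ)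

ρ : Bool → Sides → ℚ
ρ false c         = 1ℚ
ρ true  (s₁ , s₂) = if s₁ xor s₂ then + 2 / 3 else + 4 / 3

weight-max : Bool → ℚ
weight-max a = if a then + 8 / 3 else + 4 / 1

weight-mean : ∀ a c → 𝔼 coin (λ u → 𝔼 coin (weight a c u)) ≡ ρ a c
weight-mean false c               = 𝔼-sides (uncurry (weight false c))
weight-mean true  (true  , true)  = 𝔼-sides (uncurry (weight true (true , true)))
weight-mean true  (true  , false) = 𝔼-sides (uncurry (weight true (true , false)))
weight-mean true  (false , true)  = 𝔼-sides (uncurry (weight true (false , true)))
weight-mean true  (false , false) = 𝔼-sides (uncurry (weight true (false , false)))

0≼8/3 : 0ℚ ≼ + 8 / 3
0≼8/3 = ℚ.nonNegative⁻¹ _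

0≼4 : 0ℚ ≼ + 4 / 1
0≼4 = ℚ.nonNegative⁻¹ _

if-elim : ∀ (P : ℚ → Set) b {x y} → P x → P y → P (if b then x else y)
if-elim P true  px py = px
if-elim P false px py = py

0≼weight : ∀ a c u v → 0ℚ ≼ weight a c u v
0≼weight false c         u v = if-elim (0ℚ ≼_) (u ∨ v) ℚ.≤-refl 0≼4
0≼weight true  (s₁ , s₂) u v = if-elim (0ℚ ≼_) (s₁ xor s₂)
  (if-elim (0ℚ ≼_) (u ∨ v) ℚ.≤-refl 0≼8/3) (if-elim (0ℚ ≼_) (u xor v) 0≼8/3 ℚ.≤-refl)

weight≼max : ∀ a c u v → weight a c u v ≼ weight-max a
weight≼max false c         u v = if-elim (_≼ + 4 / 1) (u ∨ v) 0≼4 ℚ.≤-refl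
weight≼max true  (s₁ , s₂) u v = if-elim (_≼ + 8 / 3) (s₁ xor s₂)
  (if-elim (_≼ + 8 / 3) (u ∨ v) 0≼8/3 ℚ.≤-refl) (if-elim (_≼ + 8 / 3) (u xor v) ℚ.≤-refl 0≼8/3)

0≼ρ : ∀ a c → 0ℚ ≼ ρ a c
0≼ρ false c         = CauchyLemmas.0≤1
0≼ρ true  (s₁ , s₂) = if-elim (0ℚ ≼_) (s₁ xor s₂) (ℚ.nonNegative⁻¹ _) (ℚ.nonNegative⁻¹ _)

ρ-mean : ∀ a → 𝔼 sides (ρ a) ≡ 1ℚ
ρ-mean false = 𝔼-sides (ρ false)
ρ-mean true  = 𝔼-sides (ρ true)

-- States and the transition operators of a pair

-- A state: the shape i : Bool → Vec Bool p gives the sets of old vertices on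
-- the left (i true) and on the right (i false), σ says which of the n new
-- vertices are on the left, and l : Vec Bool p are the labels of the old ones.
Shape : ℕ → Set
Shape p = Bool → Vec Bool p

-- New vertices are never deferred, so one bit each is enough and the right set is the complement of
-- the left one. Old vertices may lie in neither set, which is why a shape has two vectors.
side : ∀ {n} → Vec Bool n → Bool → Vec Bool n
side σ true  = σ
side σ false = Vec.map not σ

full : ∀ {n p} → Shape p → Vec Bool n → Bool → Vec Bool (n ℕ.+ p)
full i σ s = side σ s ++ i s

older : ∀ n {p} → Vec Bool (n ℕ.+ p) → Vec Bool p
older zero    w       = w
older (suc n) (_ ∷ w) = older n w

older-++ : ∀ {n p} (q : Vec Bool n) (r : Vec Bool p) → older n (q ++ r) ≡ r
older-++ []      r = refl
older-++ (_ ∷ q) r = older-++ q r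

-- A vertex at the end of L precedes all of D and changes the parity still owed by its neighbours
-- there; a vertex of R comes after D and changes nothing.
relabel : ∀ {p} → Bool → Vec Bool p → Vec Bool p → Vec Bool p
relabel s r l = if s then r ⊕ l else l

extend : ∀ {n} → Sides → Vec Bool n → Vec Bool (suc (suc n))
extend (s₁ , s₂) σ = s₂ ∷ s₁ ∷ σ

relabels : ∀ {p} → Sides → Vec Bool p → Vec Bool p → Vec Bool p → Vec Bool p
relabels (s₁ , s₂) r r′ l = relabel s₂ r′ (relabel s₁ r l)

Pairing : ℕ → Set
Pairing m = Bool × Arrival m × Arrival m

pairing : ∀ m → Mean (Pairing m)
pairing m = coin ⊗ arrival m ⊗ arrival m

chance : ∀ {m} → Pairing m → (Bool → Vec Bool m) → Sides → ℚ
chance (a , α , α′) f c = weight a c (val α f (proj₁ c)) (val α′ f (proj₂ c))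

newLabels : ∀ n {p} → Pairing (n ℕ.+ p) → Sides → Vec Bool p → Vec Bool p
newLabels n (_ , α , α′) c l = relabels c (older n (proj₁ α)) (older n (proj₁ α′)) l

children : ∀ n {p} → Pairing (n ℕ.+ p) → Shape p → Vec Bool n → Vec Bool p →
           (Vec Bool (suc (suc n)) → Vec Bool p → ℚ) → ℚ
children n ω i σ l φ = 𝔼 sides (λ c → chance ω (full i σ) c * φ (extend c σ) (newLabels n ω c l))

infix 5 _⊞_

_⊞_ : ∀ {n p} → Arrival n → Vec Bool p → Arrival (n ℕ.+ p)
(q , k) ⊞ r = q ++ r , k

-- The bits `r` towards the old vertices are the only ones that move labels. With `r` held fixed,
-- the rest of the arrival can be averaged to deal with admissibility.
arrival-split : ∀ n p (F : Arrival (n ℕ.+ p) → ℚ) →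
                𝔼 (arrival (n ℕ.+ p)) F ≡ 𝔼 (bits p) (λ r → 𝔼 (arrival n) (λ β → F (β ⊞ r)))
arrival-split n p F = trans (bits-++ n p _) (𝔼-swap (bits n) (bits p) _)

key-⊞ : ∀ {n p} (β : Arrival n) (r : Vec Bool p) s → key (β ⊞ r) s ≡ key β s
key-⊞ β r true  = refl
key-⊞ β r false = refl

val-⊞ : ∀ {n p} (β : Arrival n) (r : Vec Bool p) (i : Shape p) σ s →
        val (β ⊞ r) (full i σ) s ≡ val β (side σ) s xor dot r (i s)
val-⊞ β r i σ s = trans (cong₂ _xor_ (key-⊞ β r s) (dot-++ (proj₁ β) (side σ s) r (i s)))
  (sym (Bool.xor-assoc (key β s) _ _))

pairing-split : ∀ n p (F : Pairing (n ℕ.+ p) → ℚ) →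
  𝔼 (pairing (n ℕ.+ p)) F ≡
  𝔼 (coin ⊗ bits p ⊗ bits p) (λ (a , r , r′) → 𝔼 (arrival n ⊗ arrival n) (λ (β , β′) → F (a , β ⊞ r , β′ ⊞ r′)))
pairing-split n p F = 𝔼-cong coin (λ a → trans (arrival-split n p _) (𝔼-cong (bits p) (λ r → trans
  (𝔼-cong (arrival n) (λ β → arrival-split n p _))
  (𝔼-swap (arrival n) (bits p) _))))

side-≢ : ∀ {n} {σ τ : Vec Bool n} → σ ≢ τ → ∀ s → side σ s ≢ side τ s
side-≢ σ≢τ true  e = σ≢τ e
side-≢ σ≢τ false e = σ≢τ (map-not-injective _ _ e)
  where
  map-not-injective : ∀ {n} (σ τ : Vec Bool n) → Vec.map not σ ≡ Vec.map not τ → σ ≡ τ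
  map-not-injective []      []      _ = refl
  map-not-injective (a ∷ σ) (b ∷ τ) e =
    cong₂ _∷_ (Bool.not-injective (Vec.∷-injectiveˡ e)) (map-not-injective σ τ (Vec.∷-injectiveʳ e))

weights-mean : ∀ {A A′} (M : Mean A) (M′ : Mean A′) (u w : A → Bool) (u′ w′ : A′ → Bool) →
  (∀ F → 𝔼 M (λ α → F (u α) (w α)) ≡ 𝔼 coin (λ x → 𝔼 coin (F x))) →
  (∀ F → 𝔼 M′ (λ α → F (u′ α) (w′ α)) ≡ 𝔼 coin (λ x → 𝔼 coin (F x))) →
  ∀ a c d k → 𝔼 (M ⊗ M′) (λ (α , α′) → weight a c (u α) (u′ α′) * (weight a d (w α) (w′ α′) * k)) ≡ ρ a c * (ρ a d * k)
weights-mean M M′ u w u′ w′ ind ind′ a c d k = begin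
  𝔼 (M ⊗ M′) (λ (α , α′) → weight a c (u α) (u′ α′) * (weight a d (w α) (w′ α′) * k))
    ≡⟨ 𝔼-cong M (λ α → ind′ (λ y y′ → weight a c (u α) y * (weight a d (w α) y′ * k))) ⟩
  𝔼 M (λ α → 𝔼 coin (λ y → 𝔼 coin (λ y′ → weight a c (u α) y * (weight a d (w α) y′ * k))))
    ≡⟨ ind (λ x x′ → 𝔼 coin (λ y → 𝔼 coin (λ y′ → weight a c x y * (weight a d x′ y′ * k)))) ⟩
  𝔼 coin (λ x → 𝔼 coin (λ x′ → 𝔼 coin (λ y → 𝔼 coin (λ y′ → weight a c x y * (weight a d x′ y′ * k)))))
    ≡⟨ 𝔼-cong coin (λ x → 𝔼-cong coin (λ x′ → trans
         (𝔼-cong coin (λ y → trans (𝔼-* coin (weight a c x y) _) (cong (weight a c x y *_) (𝔼-*ʳ coin k (weight a d x′)))))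
         (𝔼-*ʳ coin _ (weight a c x)))) ⟩
  𝔼 coin (λ x → 𝔼 coin (λ x′ → 𝔼 coin (weight a c x) * (𝔼 coin (weight a d x′) * k)))
    ≡⟨ 𝔼-cong coin (λ x → trans (𝔼-* coin (𝔼 coin (weight a c x)) _) (cong (𝔼 coin (weight a c x) *_) (𝔼-*ʳ coin k _))) ⟩
  𝔼 coin (λ x → 𝔼 coin (weight a c x) * (𝔼 coin (λ x′ → 𝔼 coin (weight a d x′)) * k))
    ≡⟨ 𝔼-*ʳ coin _ (λ x → 𝔼 coin (weight a c x)) ⟩
  𝔼 coin (λ x → 𝔼 coin (weight a c x)) * (𝔼 coin (λ x′ → 𝔼 coin (weight a d x′)) * k)
    ≡⟨ cong₂ (λ y z → y * (z * k)) (weight-mean a c) (weight-mean a d) ⟩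
  ρ a c * (ρ a d * k) ∎
  where
  open ≡-Reasoning

weight-mean₁ : ∀ {A A′} (M : Mean A) (M′ : Mean A′) (u : A → Bool) (u′ : A′ → Bool) →
  (∀ F → 𝔼 M (λ α → F (u α)) ≡ 𝔼 coin F) → (∀ F → 𝔼 M′ (λ α → F (u′ α)) ≡ 𝔼 coin F) →
  ∀ a c k → 𝔼 (M ⊗ M′) (λ (α , α′) → weight a c (u α) (u′ α′) * k) ≡ ρ a c * k
weight-mean₁ M M′ u u′ ind ind′ a c k = begin
  𝔼 (M ⊗ M′) (λ (α , α′) → weight a c (u α) (u′ α′) * k)
    ≡⟨ 𝔼-*ʳ (M ⊗ M′) k _ ⟩
  𝔼 (M ⊗ M′) (λ (α , α′) → weight a c (u α) (u′ α′)) * k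
    ≡⟨ cong (_* k) (𝔼-cong M (λ α → ind′ (weight a c (u α)))) ⟩
  𝔼 M (λ α → 𝔼 coin (weight a c (u α))) * k
    ≡⟨ cong (_* k) (trans (ind (λ x → 𝔼 coin (weight a c x))) (weight-mean a c)) ⟩
  ρ a c * k ∎
  where
  open ≡-Reasoning

PairFn : ℕ → ℕ → Set
PairFn n p = Shape p → Vec Bool n → Vec Bool p → Shape p → Vec Bool n → Vec Bool p → ℚ

step₂ : ∀ n {p} → PairFn (suc (suc n)) p → PairFn n p
step₂ n {p} φ i σ l j τ m = 𝔼 (pairing (n ℕ.+ p)) (λ ω →
  children n ω i σ l (λ σ′ l′ → children n ω j τ m (λ τ′ m′ → φ i σ′ l′ j τ′ m′)))

step₁ : ∀ n {p} → (Shape p → Vec Bool (suc (suc n)) → Vec Bool p → ℚ) → Shape p → Vec Bool n → Vec Bool p → ℚ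
step₁ n {p} φ i σ l = 𝔼 (pairing (n ℕ.+ p)) (λ ω → children n ω i σ l (φ i))

0≼chance : ∀ {m} (ω : Pairing m) f c → 0ℚ ≼ chance ω f c
0≼chance (a , α , α′) f c = 0≼weight a c _ _

step₂-expand : ∀ n {p} (φ : PairFn (suc (suc n)) p) i σ l j τ m →
  step₂ n φ i σ l j τ m ≡ 𝔼 (pairing (n ℕ.+ p)) (λ ω → 𝔼 (sides ⊗ sides) (λ (c , d) →
    chance ω (full i σ) c * (chance ω (full j τ) d * φ i (extend c σ) (newLabels n ω c l) j (extend d τ) (newLabels n ω d m))))
step₂-expand n φ i σ l j τ m = 𝔼-cong (pairing _) (λ ω → 𝔼-cong sides (λ c → sym (𝔼-* sides (chance ω (full i σ) c) _)))

-- For fixed `r` and `r′` the bits towards the new vertices, where `σ` and `τ` differ, and the keys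
-- already make the admissibility bits of both states fair and independent. So the weights average
-- to `ρ`, and what is left is a label change by uniform rows, decoupled from admissibility.
step₂-split : ∀ n {p} (φ : PairFn (suc (suc n)) p) i σ l j τ m → σ ≢ τ →
  step₂ n φ i σ l j τ m ≡ 𝔼 (coin ⊗ bits p ⊗ bits p) (λ (a , r , r′) → 𝔼 (sides ⊗ sides) (λ (c , d) →
    ρ a c * (ρ a d * φ i (extend c σ) (relabels c r r′ l) j (extend d τ) (relabels d r r′ m))))
step₂-split n {p} φ i σ l j τ m σ≢τ = trans (step₂-expand n φ i σ l j τ m) (trans (pairing-split n p _)
  (𝔼-cong (coin ⊗ bits p ⊗ bits p) (λ (a , r , r′) →
    trans (𝔼-swap (arrival n ⊗ arrival n) (sides ⊗ sides) _)
    (𝔼-cong (sides ⊗ sides) (λ (c , d) → trans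
      (𝔼-cong (arrival n ⊗ arrival n) (λ (β , β′) → cong₂ _*_
        (cong₂ (weight a c) (val-⊞ β r i σ (proj₁ c)) (val-⊞ β′ r′ i σ (proj₂ c)))
        (cong₂ _*_
          (cong₂ (weight a d) (val-⊞ β r j τ (proj₁ d)) (val-⊞ β′ r′ j τ (proj₂ d)))
          (cong₂ (λ x y → φ i (extend c σ) x j (extend d τ) y)
            (cong₂ (λ x y → relabels c x y l) (older-++ (proj₁ β) r) (older-++ (proj₁ β′) r′))
            (cong₂ (λ x y → relabels d x y m) (older-++ (proj₁ β) r) (older-++ (proj₁ β′) r′))))))
      (weights-mean (arrival n) (arrival n) _ _ _ _
        (val-independent (side σ) (side τ) (side-≢ σ≢τ) (dot r (i (proj₁ c))) (dot r (j (proj₁ d))) (proj₁ c) (proj₁ d))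
        (val-independent (side σ) (side τ) (side-≢ σ≢τ) (dot r′ (i (proj₂ c))) (dot r′ (j (proj₂ d))) (proj₂ c) (proj₂ d))
        a c d _))))))

step₁-split : ∀ n {p} (φ : Shape p → Vec Bool (suc (suc n)) → Vec Bool p → ℚ) i σ l →
  step₁ n φ i σ l ≡ 𝔼 (coin ⊗ bits p ⊗ bits p) (λ (a , r , r′) → 𝔼 sides (λ c →
    ρ a c * φ i (extend c σ) (relabels c r r′ l)))
step₁-split n {p} φ i σ l = trans (pairing-split n p _)
  (𝔼-cong (coin ⊗ bits p ⊗ bits p) (λ (a , r , r′) →
    trans (𝔼-swap (arrival n ⊗ arrival n) sides _)
    (𝔼-cong sides (λ c → trans
      (𝔼-cong (arrival n ⊗ arrival n) (λ (β , β′) → cong₂ _*_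
        (cong₂ (weight a c) (val-⊞ β r i σ (proj₁ c)) (val-⊞ β′ r′ i σ (proj₂ c)))
        (cong₂ (λ x y → φ i (extend c σ) (relabels c x y l)) (older-++ (proj₁ β) r) (older-++ (proj₁ β′) r′))))
      (weight-mean₁ (arrival n) (arrival n) _ _
        (val-uniform (side σ) (dot r (i (proj₁ c))) (proj₁ c))
        (val-uniform (side σ) (dot r′ (i (proj₂ c))) (proj₂ c)) a c _)))))

-- Equidistribution of labels

det : Sides → Sides → Bool
det (s₁ , s₂) (t₁ , t₂) = (s₁ ∧ t₂) xor (s₂ ∧ t₁)

⊕-comm : ∀ {n} (r l : Vec Bool n) → r ⊕ l ≡ l ⊕ r
⊕-comm = Vec.zipWith-comm Bool.xor-comm

⊕-swap : ∀ {n} (r s l : Vec Bool n) → r ⊕ (s ⊕ l) ≡ s ⊕ (r ⊕ l)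
⊕-swap r s l = trans (sym (Vec.zipWith-assoc Bool.xor-assoc r s l))
  (trans (cong (_⊕ l) (⊕-comm r s)) (Vec.zipWith-assoc Bool.xor-assoc s r l))

-- An invertible linear change of variables.
relabels-uniform : ∀ {p} c d → det c d ≡ true → ∀ (l m : Vec Bool p) (ψ : Vec Bool p → Vec Bool p → ℚ) →
  𝔼 (bits p) (λ r → 𝔼 (bits p) (λ r′ → ψ (relabels c r r′ l) (relabels d r r′ m))) ≡ 𝔼 (bits p) (λ l → 𝔼 (bits p) (ψ l))
relabels-uniform {p} (true , false) (false , true) _ l m ψ =
  trans (𝔼-cong (bits p) (λ r → bits-⊕ m (ψ (r ⊕ l)))) (bits-⊕ l (λ l → 𝔼 (bits p) (ψ l)))
relabels-uniform {p} (false , true) (true , false) _ l m ψ = trans (𝔼-swap (bits p) (bits p) _)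
  (trans (𝔼-cong (bits p) (λ r → bits-⊕ m (ψ (r ⊕ l)))) (bits-⊕ l (λ l → 𝔼 (bits p) (ψ l))))
relabels-uniform {p} (true , false) (true , true) _ l m ψ =
  trans (𝔼-cong (bits p) (λ r → bits-⊕ (r ⊕ m) (ψ (r ⊕ l)))) (bits-⊕ l (λ l → 𝔼 (bits p) (ψ l)))
relabels-uniform {p} (false , true) (true , true) _ l m ψ = trans (𝔼-swap (bits p) (bits p) _)
  (trans (𝔼-cong (bits p) (λ r′ → trans (𝔼-cong (bits p) (λ r → cong (ψ (r′ ⊕ l)) (⊕-swap r′ r m))) (bits-⊕ (r′ ⊕ m) (ψ (r′ ⊕ l)))))
    (bits-⊕ l (λ l → 𝔼 (bits p) (ψ l))))
relabels-uniform {p} (true , true) (true , false) _ l m ψ =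
  trans (𝔼-cong (bits p) (λ r → bits-⊕ (r ⊕ l) (λ l → ψ l (r ⊕ m))))
    (trans (𝔼-swap (bits p) (bits p) _) (𝔼-cong (bits p) (λ l → bits-⊕ m (ψ l))))
relabels-uniform {p} (true , true) (false , true) _ l m ψ = trans (𝔼-swap (bits p) (bits p) _)
  (trans (𝔼-cong (bits p) (λ r′ → trans (𝔼-cong (bits p) (λ r → cong (λ z → ψ z (r′ ⊕ m)) (⊕-swap r′ r l))) (bits-⊕ (r′ ⊕ l) (λ l → ψ l (r′ ⊕ m)))))
    (trans (𝔼-swap (bits p) (bits p) _) (𝔼-cong (bits p) (λ l → bits-⊕ m (ψ l)))))
relabels-uniform (true , true) (true , true) ()
relabels-uniform (true , true) (false , false) ()
relabels-uniform (true , false) (true , false) ()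
relabels-uniform (true , false) (false , false) ()
relabels-uniform (false , true) (false , true) ()
relabels-uniform (false , true) (false , false) ()
relabels-uniform (false , false) (true , true) ()
relabels-uniform (false , false) (true , false) ()
relabels-uniform (false , false) (false , true) ()
relabels-uniform (false , false) (false , false) ()

relabels-uniform₁ : ∀ {p} c → c ≢ (false , false) → ∀ (l : Vec Bool p) (ψ : Vec Bool p → ℚ) →
  𝔼 (bits p) (λ r → 𝔼 (bits p) (λ r′ → ψ (relabels c r r′ l))) ≡ 𝔼 (bits p) ψ
relabels-uniform₁ {p} (s₁ , true) _ l ψ =
  trans (𝔼-cong (bits p) (λ r → bits-⊕ (relabel s₁ r l) ψ)) (𝔼-const (bits p) _)
relabels-uniform₁ {p} (true , false) _ l ψ =
  trans (𝔼-cong (bits p) (λ r → 𝔼-const (bits p) _)) (bits-⊕ l ψ)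
relabels-uniform₁ (false , false) h = ⊥-elim (h refl)

relabels-bijective : ∀ {p} c r r′ (ψ : Vec Bool p → ℚ) → 𝔼 (bits p) (λ l → ψ (relabels c r r′ l)) ≡ 𝔼 (bits p) ψ
relabels-bijective (s₁ , s₂) r r′ ψ = trans (shift s₁ r (λ l → ψ (relabel s₂ r′ l))) (shift s₂ r′ ψ)
  where
  shift : ∀ {p} s r (ψ : Vec Bool p → ℚ) → 𝔼 (bits p) (λ l → ψ (relabel s r l)) ≡ 𝔼 (bits p) ψ
  shift true  r ψ = trans (𝔼-cong (bits _) (λ l → cong ψ (⊕-comm r l))) (bits-⊕ r ψ)
  shift false r ψ = refl

-- One rate for all contractions. It is 1 - 1/8 in `recip-step` and solves 1 + 3/4 = 2 `θ` in
-- `old′`. Elsewhere there is room: dependent placements have weight 5/8 or 13/18, the null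
-- placement 1/4 or 1/3, equal placements 1/4 or 5/18, according to whether the pair is adjacent.
θ : ℚ
θ = + 7 / 8

check≼ : ∀ p q {_ : T ⌊ p ℚ.≤? q ⌋} → p ≼ q
check≼ p q {h} = toWitness h

𝔼-sides² : (f : Sides → Sides → ℚ) → ℚ
𝔼-sides² f = avg (λ c → avg (f c))
  where
  avg : (Sides → ℚ) → ℚ
  avg f = ½ * (½ * (f (true , true) + f (true , false)) + ½ * (f (false , true) + f (false , false)))

𝔼-sides²-≡ : ∀ f → 𝔼 (sides ⊗ sides) (uncurry f) ≡ 𝔼-sides² f
𝔼-sides²-≡ f = trans (𝔼-cong sides (λ c → 𝔼-sides (f c))) (𝔼-sides _)

singular : Sides → Sides → ℚ
singular c d = if det c d then 0ℚ else 1ℚ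

equal : Sides → Sides → ℚ
equal (s₁ , s₂) (t₁ , t₂) = if s₁ xor t₁ then 0ℚ else (if s₂ xor t₂ then 0ℚ else 1ℚ)

null : Sides → ℚ
null (s₁ , s₂) = if s₁ ∨ s₂ then 0ℚ else 1ℚ

singular-mean : ∀ a → 𝔼 (sides ⊗ sides) (λ (c , d) → ρ a c * (ρ a d * singular c d)) ≼ θ
singular-mean false = ℚ.≤-trans (ℚ.≤-reflexive (𝔼-sides²-≡ (λ c d → ρ false c * (ρ false d * singular c d)))) (check≼ _ _)
singular-mean true  = ℚ.≤-trans (ℚ.≤-reflexive (𝔼-sides²-≡ (λ c d → ρ true c * (ρ true d * singular c d)))) (check≼ _ _)

equal-mean : ∀ a → 𝔼 (sides ⊗ sides) (λ (c , d) → ρ a c * (ρ a d * equal c d)) ≼ + 3 / 4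
equal-mean false = ℚ.≤-trans (ℚ.≤-reflexive (𝔼-sides²-≡ (λ c d → ρ false c * (ρ false d * equal c d)))) (check≼ _ _)
equal-mean true  = ℚ.≤-trans (ℚ.≤-reflexive (𝔼-sides²-≡ (λ c d → ρ true c * (ρ true d * equal c d)))) (check≼ _ _)

null-mean : ∀ a → 𝔼 sides (λ c → ρ a c * null c) ≼ θ
null-mean false = ℚ.≤-trans (ℚ.≤-reflexive (𝔼-sides (λ c → ρ false c * null c))) (check≼ _ _)
null-mean true  = ℚ.≤-trans (ℚ.≤-reflexive (𝔼-sides (λ c → ρ true c * null c))) (check≼ _ _)

extend-≢ : ∀ {n} {σ τ : Vec Bool n} c d → σ ≢ τ → extend c σ ≢ extend d τ
extend-≢ c d σ≢τ e = σ≢τ (Vec.∷-injectiveʳ (Vec.∷-injectiveʳ e))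

extend-≢′ : ∀ {n} (σ : Vec Bool n) {c d} → c ≢ d → extend c σ ≢ extend d σ
extend-≢′ σ c≢d e = c≢d (cong₂ _,_ (Vec.∷-injectiveˡ (Vec.∷-injectiveʳ e)) (Vec.∷-injectiveˡ e))

++-≢ʳ : ∀ {n p} (σ : Vec Bool n) {r s : Vec Bool p} → r ≢ s → σ ++ r ≢ σ ++ s
++-≢ʳ σ r≢s e = r≢s (Vec.++-injectiveʳ σ σ e)

-- Recursive bounds for the two moments

p≼p+q : ∀ {p q} → 0ℚ ≼ q → p ≼ p + q
p≼p+q {p} {q} = CauchyLemmas.p≤p+q p q

-- Upper bounds for the second moment of the weighted number of successful
-- descendants of two states, depending on where the states differ.  Here u is
-- the probability that two independent label vectors both vanish.
record Bounds {n p} (φ : PairFn n p) (u e : ℚ) : Set where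
  field
    nonneg  : ∀ i σ l j τ m → 0ℚ ≼ φ i σ l j τ m
    average : ∀ i σ j τ → σ ≢ τ → 𝔼 (bits p) (λ l → 𝔼 (bits p) (λ m → φ i σ l j τ m)) ≼ u
    new     : ∀ i σ l j τ m → σ ≢ τ → φ i σ l j τ m ≼ u + e
    old     : ∀ i j σ l m → (∀ s → i s ≢ j s) → φ i σ l j σ m ≼ u + (+ 2 / 1) * e
    same    : ∀ i σ l → φ i σ l i σ l ≼ (+ 36 / 1) * u + (+ 144 / 1) * e

ρρ-mean : ∀ a k → 𝔼 (sides ⊗ sides) (λ (c , d) → ρ a c * (ρ a d * k)) ≡ k
ρρ-mean a k = begin
  𝔼 sides (λ c → 𝔼 sides (λ d → ρ a c * (ρ a d * k)))
    ≡⟨ 𝔼-cong sides (λ c → trans (𝔼-* sides (ρ a c) _) (cong (ρ a c *_) (𝔼-*ʳ sides k (ρ a)))) ⟩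
  𝔼 sides (λ c → ρ a c * (𝔼 sides (ρ a) * k))
    ≡⟨ 𝔼-*ʳ sides _ (ρ a) ⟩
  𝔼 sides (ρ a) * (𝔼 sides (ρ a) * k)
    ≡⟨ cong₂ (λ y z → y * (z * k)) (ρ-mean a) (ρ-mean a) ⟩
  1ℚ * (1ℚ * k)
    ≡⟨ trans (ℚ.*-identityˡ (1ℚ * k)) (ℚ.*-identityˡ k) ⟩
  k ∎
  where
  open ≡-Reasoning

ρρ-mean-≼ : ∀ a k e (f : Sides → Sides → ℚ) {κ} → 0ℚ ≼ e →
  𝔼 (sides ⊗ sides) (λ (c , d) → ρ a c * (ρ a d * f c d)) ≼ κ →
  𝔼 (sides ⊗ sides) (λ (c , d) → ρ a c * (ρ a d * (k + f c d * e))) ≼ k + κ * e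
ρρ-mean-≼ a k e f {κ} 0≤e h = begin
  𝔼 (sides ⊗ sides) (λ (c , d) → ρ a c * (ρ a d * (k + f c d * e)))
    ≡⟨ 𝔼-cong (sides ⊗ sides) (λ (c , d) → solve 5 (λ r s k f e → r :* (s :* (k :+ f :* e)) := r :* (s :* k) :+ r :* (s :* f) :* e) refl (ρ a c) (ρ a d) k (f c d) e) ⟩
  𝔼 (sides ⊗ sides) (λ (c , d) → ρ a c * (ρ a d * k) + ρ a c * (ρ a d * f c d) * e)
    ≡⟨ trans (𝔼-+ (sides ⊗ sides) _ _) (cong₂ _+_ (ρρ-mean a k) (𝔼-*ʳ (sides ⊗ sides) e _)) ⟩
  k + 𝔼 (sides ⊗ sides) (λ (c , d) → ρ a c * (ρ a d * f c d)) * e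
    ≤⟨ ℚ.+-monoʳ-≤ k (*-monoʳ 0≤e h) ⟩
  k + κ * e ∎
  where
  open ℚ.≤-Reasoning

ρρ-mono : ∀ a c d {x y} → x ≼ y → ρ a c * (ρ a d * x) ≼ ρ a c * (ρ a d * y)
ρρ-mono a c d h = *-monoˡ (0≼ρ a c) (*-monoˡ (0≼ρ a d) h)

≟-sides : (c d : Sides) → (c ≡ d × equal c d ≡ 1ℚ) ⊎ (c ≢ d × equal c d ≡ 0ℚ)
≟-sides (true  , true)  (true  , true)  = inj₁ (refl , refl)
≟-sides (true  , false) (true  , false) = inj₁ (refl , refl)
≟-sides (false , true)  (false , true)  = inj₁ (refl , refl)
≟-sides (false , false) (false , false) = inj₁ (refl , refl)
≟-sides (true  , true)  (true  , false) = inj₂ ((λ ()) , refl)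
≟-sides (true  , true)  (false , t)     = inj₂ ((λ ()) , refl)
≟-sides (true  , false) (true  , true)  = inj₂ ((λ ()) , refl)
≟-sides (true  , false) (false , t)     = inj₂ ((λ ()) , refl)
≟-sides (false , true)  (true  , t)     = inj₂ ((λ ()) , refl)
≟-sides (false , true)  (false , false) = inj₂ ((λ ()) , refl)
≟-sides (false , false) (true  , t)     = inj₂ ((λ ()) , refl)
≟-sides (false , false) (false , true)  = inj₂ ((λ ()) , refl)

0≼θ : 0ℚ ≼ θ
0≼θ = ℚ.nonNegative⁻¹ _

-- The bounds are stable under one more pair, with the same `u` and with `e` multiplied by `θ`. Two
-- states that agree in too much become better separated: from `same` or `old` they pass to `new` as
-- soon as their placements of the pair differ.
module Step {n p} {φ : PairFn (suc (suc n)) p} {u e : ℚ} (0≤u : 0ℚ ≼ u) (0≤e : 0ℚ ≼ e) (b : Bounds φ u e) where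

  open Bounds b
  open ℚ.≤-Reasoning

  Rows : Mean (Bool × Vec Bool p × Vec Bool p)
  Rows = coin ⊗ bits p ⊗ bits p

  nonneg′ : ∀ i σ l j τ m → 0ℚ ≼ step₂ n φ i σ l j τ m
  nonneg′ i σ l j τ m = 𝔼-≥ (pairing (n ℕ.+ p)) 0ℚ (λ ω → 𝔼-≥ sides 0ℚ (λ c → 0≼* (0≼chance ω (full i σ) c)
    (𝔼-≥ sides 0ℚ (λ d → 0≼* (0≼chance ω (full j τ) d) (nonneg _ _ _ _ _ _)))))

  average′ : ∀ i σ j τ → σ ≢ τ → 𝔼 (bits p) (λ l → 𝔼 (bits p) (λ m → step₂ n φ i σ l j τ m)) ≼ u
  average′ i σ j τ σ≢τ = begin
    𝔼 (bits p) (λ l → 𝔼 (bits p) (λ m → step₂ n φ i σ l j τ m))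
      ≡⟨ 𝔼-cong (bits p ⊗ bits p) (λ (l , m) → step₂-split n φ i σ l j τ m σ≢τ) ⟩
    𝔼 (bits p ⊗ bits p) (λ (l , m) → 𝔼 Rows (λ (a , r , r′) → 𝔼 (sides ⊗ sides) (λ (c , d) → body l m a r r′ c d)))
      ≡⟨ 𝔼-swap (bits p ⊗ bits p) Rows _ ⟩
    𝔼 Rows (λ (a , r , r′) → 𝔼 (bits p ⊗ bits p) (λ (l , m) → 𝔼 (sides ⊗ sides) (λ (c , d) → body l m a r r′ c d)))
      ≤⟨ 𝔼-≤ Rows u (λ (a , r , r′) → begin
        𝔼 (bits p ⊗ bits p) (λ (l , m) → 𝔼 (sides ⊗ sides) (λ (c , d) → body l m a r r′ c d))
          ≡⟨ 𝔼-swap (bits p ⊗ bits p) (sides ⊗ sides) _ ⟩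
        𝔼 (sides ⊗ sides) (λ (c , d) → 𝔼 (bits p ⊗ bits p) (λ (l , m) → body l m a r r′ c d))
          ≤⟨ 𝔼-mono (sides ⊗ sides) (λ (c , d) → begin
            𝔼 (bits p ⊗ bits p) (λ (l , m) → body l m a r r′ c d)
              ≡⟨ trans (𝔼-* (bits p ⊗ bits p) (ρ a c) _) (cong (ρ a c *_) (𝔼-* (bits p ⊗ bits p) (ρ a d) _)) ⟩
            ρ a c * (ρ a d * 𝔼 (bits p ⊗ bits p) (λ (l , m) → φ i (extend c σ) (relabels c r r′ l) j (extend d τ) (relabels d r r′ m)))
              ≡⟨ cong (λ z → ρ a c * (ρ a d * z)) (trans
                   (𝔼-cong (bits p) (λ l → relabels-bijective d r r′ (φ i (extend c σ) (relabels c r r′ l) j (extend d τ))))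
                   (relabels-bijective c r r′ (λ l → 𝔼 (bits p) (φ i (extend c σ) l j (extend d τ))))) ⟩
            ρ a c * (ρ a d * 𝔼 (bits p) (λ l → 𝔼 (bits p) (φ i (extend c σ) l j (extend d τ))))
              ≤⟨ ρρ-mono a c d (average i (extend c σ) j (extend d τ) (extend-≢ c d σ≢τ)) ⟩
            ρ a c * (ρ a d * u) ∎) ⟩
        𝔼 (sides ⊗ sides) (λ (c , d) → ρ a c * (ρ a d * u))
          ≡⟨ ρρ-mean a u ⟩
        u ∎) ⟩
    u ∎
    where
    body : Vec Bool p → Vec Bool p → Bool → Vec Bool p → Vec Bool p → Sides → Sides → ℚ
    body l m a r r′ c d = ρ a c * (ρ a d * φ i (extend c σ) (relabels c r r′ l) j (extend d τ) (relabels d r r′ m))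

  -- If the placements `c` and `d` are linearly independent, the two uniform rows make the pair of
  -- label vectors uniform and `average` leaves exactly `u` as the bound. The error survives only
  -- for dependent placements.
  new′ : ∀ i σ l j τ m → σ ≢ τ → step₂ n φ i σ l j τ m ≼ u + θ * e
  new′ i σ l j τ m σ≢τ = begin
    step₂ n φ i σ l j τ m
      ≡⟨ step₂-split n φ i σ l j τ m σ≢τ ⟩
    𝔼 Rows (λ (a , r , r′) → 𝔼 (sides ⊗ sides) (λ (c , d) → ρ a c * (ρ a d * ψ c d r r′)))
      ≤⟨ 𝔼-≤ coin (u + θ * e) (λ a → begin
        𝔼 (bits p ⊗ bits p) (λ (r , r′) → 𝔼 (sides ⊗ sides) (λ (c , d) → ρ a c * (ρ a d * ψ c d r r′)))
          ≡⟨ 𝔼-swap (bits p ⊗ bits p) (sides ⊗ sides) _ ⟩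
        𝔼 (sides ⊗ sides) (λ (c , d) → 𝔼 (bits p ⊗ bits p) (λ (r , r′) → ρ a c * (ρ a d * ψ c d r r′)))
          ≤⟨ 𝔼-mono (sides ⊗ sides) (λ (c , d) → begin
            𝔼 (bits p ⊗ bits p) (λ (r , r′) → ρ a c * (ρ a d * ψ c d r r′))
              ≡⟨ trans (𝔼-* (bits p ⊗ bits p) (ρ a c) _) (cong (ρ a c *_) (𝔼-* (bits p ⊗ bits p) (ρ a d) _)) ⟩
            ρ a c * (ρ a d * 𝔼 (bits p ⊗ bits p) (λ (r , r′) → ψ c d r r′))
              ≤⟨ ρρ-mono a c d (rows c d) ⟩
            ρ a c * (ρ a d * (u + singular c d * e)) ∎) ⟩
        𝔼 (sides ⊗ sides) (λ (c , d) → ρ a c * (ρ a d * (u + singular c d * e)))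
          ≤⟨ ρρ-mean-≼ a u e singular 0≤e (singular-mean a) ⟩
        u + θ * e ∎) ⟩
    u + θ * e ∎
    where
    ψ : Sides → Sides → Vec Bool p → Vec Bool p → ℚ
    ψ c d r r′ = φ i (extend c σ) (relabels c r r′ l) j (extend d τ) (relabels d r r′ m)

    rows : ∀ c d → 𝔼 (bits p ⊗ bits p) (λ (r , r′) → ψ c d r r′) ≼ u + singular c d * e
    rows c d with det c d in eq
    ... | true  = begin
      𝔼 (bits p ⊗ bits p) (λ (r , r′) → ψ c d r r′)
        ≡⟨ relabels-uniform c d eq l m (λ l m → φ i (extend c σ) l j (extend d τ) m) ⟩
      𝔼 (bits p) (λ l → 𝔼 (bits p) (φ i (extend c σ) l j (extend d τ)))
        ≤⟨ average i (extend c σ) j (extend d τ) (extend-≢ c d σ≢τ) ⟩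
      u
        ≡⟨ solve 2 (λ u e → u := u :+ con 0ℚ :* e) refl u e ⟩
      u + 0ℚ * e ∎
    ... | false = 𝔼-≤ (bits p ⊗ bits p) (u + 1ℚ * e) (λ (r , r′) →
      subst (λ z → ψ c d r r′ ≼ u + z) (sym (ℚ.*-identityˡ e)) (new _ _ _ _ _ _ (extend-≢ c d σ≢τ)))

  -- Only the old coordinates separate the states, and their rows also move the labels, so the
  -- labels are not averaged here. The gain comes from unequal placements, which satisfy the better
  -- bound `new`; equal ones keep the coefficient 2.
  old′ : ∀ i j σ l m → (∀ s → i s ≢ j s) → step₂ n φ i σ l j σ m ≼ u + (+ 2 / 1) * (θ * e)
  old′ i j σ l m i≢j = begin
    step₂ n φ i σ l j σ m
      ≡⟨ step₂-expand n φ i σ l j σ m ⟩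
    𝔼 (pairing (n ℕ.+ p)) (λ ω → 𝔼 (sides ⊗ sides) (λ (c , d) →
      chance ω (full i σ) c * (chance ω (full j σ) d * φ i (extend c σ) (newLabels n ω c l) j (extend d σ) (newLabels n ω d m))))
      ≤⟨ 𝔼-mono (pairing (n ℕ.+ p)) (λ ω → 𝔼-mono (sides ⊗ sides) (λ (c , d) →
           *-monoˡ (0≼chance ω (full i σ) c) (*-monoˡ (0≼chance ω (full j σ) d) (bound c d _ _)))) ⟩
    𝔼 (pairing (n ℕ.+ p)) (λ ω → 𝔼 (sides ⊗ sides) (λ (c , d) →
      chance ω (full i σ) c * (chance ω (full j σ) d * (k + equal c d * e))))
      ≡⟨ 𝔼-cong coin (λ a → trans (𝔼-swap (arrival (n ℕ.+ p) ⊗ arrival (n ℕ.+ p)) (sides ⊗ sides) _)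
           (𝔼-cong (sides ⊗ sides) (λ (c , d) → weights-mean (arrival (n ℕ.+ p)) (arrival (n ℕ.+ p))
             (λ α → val α (full i σ) (proj₁ c)) (λ α → val α (full j σ) (proj₁ d)) (λ α → val α (full i σ) (proj₂ c)) (λ α → val α (full j σ) (proj₂ d))
             (independent (proj₁ c) (proj₁ d)) (independent (proj₂ c) (proj₂ d)) a c d _))) ⟩
    𝔼 coin (λ a → 𝔼 (sides ⊗ sides) (λ (c , d) → ρ a c * (ρ a d * (k + equal c d * e))))
      ≤⟨ 𝔼-≤ coin (k + (+ 3 / 4) * e) (λ a → ρρ-mean-≼ a k e equal 0≤e (equal-mean a)) ⟩
    k + (+ 3 / 4) * e
      ≡⟨ solve 2 (λ u e → u :+ e :+ con (+ 3 / 4) :* e := u :+ con (+ 2 / 1) :* (con θ :* e)) refl u e ⟩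
    u + (+ 2 / 1) * (θ * e) ∎
    where
    k : ℚ
    k = u + e

    bound : ∀ c d l m → φ i (extend c σ) l j (extend d σ) m ≼ k + equal c d * e
    bound c d l m with ≟-sides c d
    ... | inj₁ (refl , eq) rewrite eq = begin
      φ i (extend c σ) l j (extend c σ) m  ≤⟨ old i j (extend c σ) l m i≢j ⟩
      u + (+ 2 / 1) * e                    ≡⟨ solve 2 (λ u e → u :+ con (+ 2 / 1) :* e := u :+ e :+ con 1ℚ :* e) refl u e ⟩
      k + 1ℚ * e ∎
    ... | inj₂ (c≢d , eq) rewrite eq = begin
      φ i (extend c σ) l j (extend d σ) m  ≤⟨ new _ _ _ _ _ _ (extend-≢′ σ c≢d) ⟩
      u + e                                ≡⟨ solve 2 (λ k e → k := k :+ con 0ℚ :* e) refl k e ⟩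
      k + 0ℚ * e ∎

    strip : ∀ z → z xor false ≡ z
    strip = Bool.xor-identityʳ

    independent : ∀ s s′ F → 𝔼 (arrival (n ℕ.+ p)) (λ α → F (val α (full i σ) s) (val α (full j σ) s′)) ≡ 𝔼 coin (λ x → 𝔼 coin (F x))
    independent s s′ F = trans (𝔼-cong (arrival (n ℕ.+ p)) (λ α → cong₂ F (sym (strip _)) (sym (strip _))))
      (val-independent (full i σ) (full j σ) (λ s → ++-≢ʳ (side σ s) (i≢j s)) false false s s′ F)

  -- The second weight is bounded by its maximum, 8/3 or 4. Equal placements have proportion 1/4, so
  -- over the adjacency bit the diagonal is multiplied by (8/3 + 4)/8 = 5/6; unequal ones add at
  -- most 4 (u + e). The constants 36 and 144 satisfy 5x/6 + 4 ≤ x and 5y/6 + 4 ≤ 7y/8 with room to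
  -- spare.
  same′ : ∀ i σ l → step₂ n φ i σ l i σ l ≼ (+ 36 / 1) * u + (+ 144 / 1) * (θ * e)
  same′ i σ l = begin
    step₂ n φ i σ l i σ l
      ≡⟨ step₂-expand n φ i σ l i σ l ⟩
    𝔼 (pairing (n ℕ.+ p)) (λ ω → 𝔼 (sides ⊗ sides) (λ (c , d) →
      chance ω (full i σ) c * (chance ω (full i σ) d * φ i (extend c σ) (newLabels n ω c l) i (extend d σ) (newLabels n ω d l))))
      ≤⟨ 𝔼-mono (pairing (n ℕ.+ p)) (λ ω → 𝔼-mono (sides ⊗ sides) (λ (c , d) → *-monoˡ (0≼chance ω (full i σ) c) (pointwise ω c d))) ⟩
    𝔼 (pairing (n ℕ.+ p)) (λ ω → 𝔼 (sides ⊗ sides) (λ (c , d) →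
      chance ω (full i σ) c * (weight-max (proj₁ ω) * (equal c d * X) + (+ 4 / 1) * Y)))
      ≡⟨ 𝔼-cong (pairing (n ℕ.+ p)) (λ ω → 𝔼-cong sides (λ c → trans (𝔼-* sides (chance ω (full i σ) c) _)
           (cong (chance ω (full i σ) c *_) (integrate (proj₁ ω) c)))) ⟩
    𝔼 (pairing (n ℕ.+ p)) (λ (a , α , α′) → 𝔼 sides (λ c → chance (a , α , α′) (full i σ) c * K a))
      ≡⟨ 𝔼-cong coin (λ a → trans (𝔼-swap (arrival (n ℕ.+ p) ⊗ arrival (n ℕ.+ p)) sides _)
           (trans (𝔼-cong sides (λ c → weight-mean₁ (arrival (n ℕ.+ p)) (arrival (n ℕ.+ p))
             (λ α → val α (full i σ) (proj₁ c)) (λ α → val α (full i σ) (proj₂ c))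
             (uniform (proj₁ c)) (uniform (proj₂ c)) a c (K a)))
             (trans (𝔼-*ʳ sides (K a) (ρ a)) (trans (cong (_* K a) (ρ-mean a)) (ℚ.*-identityˡ (K a)))))) ⟩
    𝔼 coin K
      ≡⟨ 𝔼-coin K ⟩
    ½ * (K true + K false)
      ≡⟨ solve 2 (λ u e → con ½ :* ((con (+ 8 / 3) :* (con (+ 1 / 4) :* (con (+ 36 / 1) :* u :+ con (+ 144 / 1) :* e)) :+ con (+ 4 / 1) :* (u :+ e)) :+
                                    (con (+ 4 / 1) :* (con (+ 1 / 4) :* (con (+ 36 / 1) :* u :+ con (+ 144 / 1) :* e)) :+ con (+ 4 / 1) :* (u :+ e)))
                  := con (+ 34 / 1) :* u :+ con (+ 124 / 1) :* e) refl u e ⟩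
    (+ 34 / 1) * u + (+ 124 / 1) * e
      ≤⟨ p≼p+q (0≼* {+ 2 / 1} (ℚ.nonNegative⁻¹ _) (CauchyLemmas.0≤+ 0≤u 0≤e)) ⟩
    (+ 34 / 1) * u + (+ 124 / 1) * e + (+ 2 / 1) * (u + e)
      ≡⟨ solve 2 (λ u e → con (+ 34 / 1) :* u :+ con (+ 124 / 1) :* e :+ con (+ 2 / 1) :* (u :+ e)
                  := con (+ 36 / 1) :* u :+ con (+ 144 / 1) :* (con θ :* e)) refl u e ⟩
    (+ 36 / 1) * u + (+ 144 / 1) * (θ * e) ∎
    where
    X Y : ℚ
    X = (+ 36 / 1) * u + (+ 144 / 1) * e
    Y = u + e

    K : Bool → ℚ
    K a = weight-max a * ((+ 1 / 4) * X) + (+ 4 / 1) * Y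

    0≤X : 0ℚ ≼ X
    0≤X = CauchyLemmas.0≤+ (0≼* {+ 36 / 1} (ℚ.nonNegative⁻¹ _) 0≤u) (0≼* {+ 144 / 1} (ℚ.nonNegative⁻¹ _) 0≤e)

    0≤Y : 0ℚ ≼ Y
    0≤Y = CauchyLemmas.0≤+ 0≤u 0≤e

    max≼4 : ∀ a → weight-max a ≼ + 4 / 1
    max≼4 true  = check≼ _ _
    max≼4 false = ℚ.≤-refl

    pointwise : ∀ ω c d → chance ω (full i σ) d * φ i (extend c σ) (newLabels n ω c l) i (extend d σ) (newLabels n ω d l)
                ≼ weight-max (proj₁ ω) * (equal c d * X) + (+ 4 / 1) * Y
    pointwise ω@(a , _) c d with ≟-sides c d
    ... | inj₁ (refl , eq) rewrite eq = begin
      w * φ i (extend c σ) (newLabels n ω c l) i (extend c σ) (newLabels n ω c l)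
        ≤⟨ *-monoˡ (0≼chance ω (full i σ) c) (same i (extend c σ) _) ⟩
      w * X                             ≤⟨ *-monoʳ 0≤X (weight≼max a c _ _) ⟩
      weight-max a * X                  ≡⟨ cong (weight-max a *_) (ℚ.*-identityˡ X) ⟨
      weight-max a * (1ℚ * X)           ≤⟨ p≼p+q (0≼* 0≼4 0≤Y) ⟩
      weight-max a * (1ℚ * X) + (+ 4 / 1) * Y ∎
      where
      w = chance ω (full i σ) c
    ... | inj₂ (c≢d , eq) rewrite eq = begin
      w * φ i (extend c σ) (newLabels n ω c l) i (extend d σ) (newLabels n ω d l)
        ≤⟨ *-monoˡ (0≼chance ω (full i σ) d) (new _ _ _ _ _ _ (extend-≢′ σ c≢d)) ⟩
      w * Y                             ≤⟨ *-monoʳ 0≤Y (ℚ.≤-trans (weight≼max a d _ _) (max≼4 a)) ⟩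
      (+ 4 / 1) * Y                     ≡⟨ solve 3 (λ w X Y → con (+ 4 / 1) :* Y := w :* (con 0ℚ :* X) :+ con (+ 4 / 1) :* Y) refl (weight-max a) X Y ⟩
      weight-max a * (0ℚ * X) + (+ 4 / 1) * Y ∎
      where
      w = chance ω (full i σ) d

    equal-quarter : ∀ c → 𝔼 sides (equal c) ≡ + 1 / 4
    equal-quarter (true  , true)  = 𝔼-sides (equal (true , true))
    equal-quarter (true  , false) = 𝔼-sides (equal (true , false))
    equal-quarter (false , true)  = 𝔼-sides (equal (false , true))
    equal-quarter (false , false) = 𝔼-sides (equal (false , false))

    integrate : ∀ a c → 𝔼 sides (λ d → weight-max a * (equal c d * X) + (+ 4 / 1) * Y) ≡ K a
    integrate a c = trans (𝔼-+ sides _ _) (cong₂ _+_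
      (trans (𝔼-* sides (weight-max a) _) (cong (weight-max a *_) (trans (𝔼-*ʳ sides X (equal c)) (cong (_* X) (equal-quarter c)))))
      (𝔼-const sides _))

    uniform : ∀ s F → 𝔼 (arrival (n ℕ.+ p)) (λ α → F (val α (full i σ) s)) ≡ 𝔼 coin F
    uniform s F = trans (𝔼-cong (arrival (n ℕ.+ p)) (λ α → cong F (sym (Bool.xor-identityʳ _)))) (val-uniform (full i σ) false s F)

  step-bounds : Bounds (step₂ n φ) u (θ * e)
  step-bounds = record { nonneg = nonneg′ ; average = average′ ; new = new′ ; old = old′ ; same = same′ }

-- The mean of the weighted number of successful descendants of a single state;
-- v is the probability that a label vector vanishes.
record Bounds₁ {n p} (φ : Shape p → Vec Bool n → Vec Bool p → ℚ) (v e : ℚ) : Set where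
  field
    average : ∀ i σ → 𝔼 (bits p) (φ i σ) ≡ v
    lower   : ∀ i σ l → v ≼ φ i σ l + e * v

-- As soon as one vertex of the pair goes left, its uniform row is added to the labels and the mean
-- is exactly `v`. Only the placement of both on the right passes the deficit on.
step-bounds₁ : ∀ {n p} {φ : Shape p → Vec Bool (suc (suc n)) → Vec Bool p → ℚ} {v e} → 0ℚ ≼ v → 0ℚ ≼ e →
               Bounds₁ φ v e → Bounds₁ (step₁ n φ) v (θ * e)
step-bounds₁ {n} {p} {φ} {v} {e} 0≤v 0≤e b = record { average = average′ ; lower = lower′ }
  where
  open Bounds₁ b
  open ℚ.≤-Reasoning

  Rows : Mean (Bool × Vec Bool p × Vec Bool p)
  Rows = coin ⊗ bits p ⊗ bits p

  average′ : ∀ i σ → 𝔼 (bits p) (step₁ n φ i σ) ≡ v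
  average′ i σ = trans (𝔼-cong (bits p) (step₁-split n φ i σ)) (trans (𝔼-swap (bits p) Rows _)
    (trans (𝔼-cong Rows (λ (a , r , r′) → trans (𝔼-swap (bits p) sides _)
      (trans (𝔼-cong sides (λ c → trans (𝔼-* (bits p) (ρ a c) _) (cong (ρ a c *_)
        (trans (relabels-bijective c r r′ (φ i (extend c σ))) (average i (extend c σ))))))
        (trans (𝔼-*ʳ sides v (ρ a)) (trans (cong (_* v) (ρ-mean a)) (ℚ.*-identityˡ v))))))
      (𝔼-const Rows v)))

  lower′ : ∀ i σ l → v ≼ step₁ n φ i σ l + θ * e * v
  lower′ i σ l = begin
    v
      ≡⟨ sym (trans (𝔼-*ʳ (coin ⊗ sides) v (uncurry ρ)) (trans (cong (_* v) (trans (𝔼-cong coin ρ-mean) (𝔼-const coin 1ℚ))) (ℚ.*-identityˡ v))) ⟩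
    𝔼 (coin ⊗ sides) (λ (a , c) → ρ a c * v)
      ≤⟨ 𝔼-mono (coin ⊗ sides) (λ (a , c) → *-monoˡ (0≼ρ a c) (rows c)) ⟩
    𝔼 (coin ⊗ sides) (λ (a , c) → ρ a c * (R c + null c * (e * v)))
      ≡⟨ trans (𝔼-cong (coin ⊗ sides) (λ (a , c) → solve 4 (λ r R z ev → r :* (R :+ z :* ev) := r :* R :+ r :* z :* ev) refl (ρ a c) (R c) (null c) (e * v)))
           (trans (𝔼-+ (coin ⊗ sides) _ _) (cong (λ z → 𝔼 (coin ⊗ sides) (λ (a , c) → ρ a c * R c) + z) (𝔼-*ʳ (coin ⊗ sides) (e * v) _))) ⟩
    𝔼 (coin ⊗ sides) (λ (a , c) → ρ a c * R c) + 𝔼 (coin ⊗ sides) (λ (a , c) → ρ a c * null c) * (e * v)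
      ≤⟨ ℚ.+-mono-≤ (ℚ.≤-reflexive (sym regroup)) (*-monoʳ (0≼* 0≤e 0≤v) (𝔼-≤ coin θ null-mean)) ⟩
    step₁ n φ i σ l + θ * (e * v)
      ≡⟨ cong (λ z → step₁ n φ i σ l + z) (ℚ.*-assoc θ e v) ⟨
    step₁ n φ i σ l + θ * e * v ∎
    where
    R : Sides → ℚ
    R c = 𝔼 (bits p ⊗ bits p) (λ (r , r′) → φ i (extend c σ) (relabels c r r′ l))

    regroup : step₁ n φ i σ l ≡ 𝔼 (coin ⊗ sides) (λ (a , c) → ρ a c * R c)
    regroup = trans (step₁-split n φ i σ l) (𝔼-cong coin (λ a → trans (𝔼-swap (bits p ⊗ bits p) sides _)
      (𝔼-cong sides (λ c → 𝔼-* (bits p ⊗ bits p) (ρ a c) _))))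

    exact : ∀ c → c ≢ (false , false) → R c ≡ v
    exact c c≢0 = trans (relabels-uniform₁ c c≢0 l (φ i (extend c σ))) (average i (extend c σ))

    placed : ∀ c → R c ≡ v → null c ≡ 0ℚ → v ≼ R c + null c * (e * v)
    placed c eq eq′ rewrite eq′ = ℚ.≤-reflexive (trans (sym eq) (solve 2 (λ R z → R := R :+ con 0ℚ :* z) refl (R c) (e * v)))

    rows : ∀ c → v ≼ R c + null c * (e * v)
    rows (true  , true)  = placed _ (exact _ λ ()) refl
    rows (true  , false) = placed _ (exact _ λ ()) refl
    rows (false , true)  = placed _ (exact _ λ ()) refl
    rows (false , false) = begin
      v                       ≤⟨ 𝔼-≥ (bits p ⊗ bits p) v (λ _ → lower i (extend (false , false) σ) l) ⟩
      𝔼 (bits p ⊗ bits p) (λ _ → φ i (extend (false , false) σ) l + e * v)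
        ≡⟨ trans (𝔼-+ (bits p ⊗ bits p) _ _) (cong (λ z → R (false , false) + z) (trans (𝔼-const (bits p ⊗ bits p) (e * v)) (sym (ℚ.*-identityˡ (e * v))))) ⟩
      R (false , false) + 1ℚ * (e * v) ∎

-- Populations of weighted states and their moments

bind : ∀ {A B} → Linear A → (A → Linear B) → Linear B
bind Λ κ = record
  { ⟦_⟧     = λ f → ⟦ Λ ⟧ (λ a → ⟦ κ a ⟧ f)
  ; ⟦⟧-+    = λ f g → trans (⟦⟧-cong Λ (λ a → ⟦⟧-+ (κ a) f g)) (⟦⟧-+ Λ _ _)
  ; ⟦⟧-*    = λ c f → trans (⟦⟧-cong Λ (λ a → ⟦⟧-* (κ a) c f)) (⟦⟧-* Λ c _)
  ; ⟦⟧-cong = λ h → ⟦⟧-cong Λ (λ a → ⟦⟧-cong (κ a) h)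
  }

∑ : ∀ {A : Set} → List A → (A → ℚ) → ℚ
∑ []       f = 0ℚ
∑ (a ∷ as) f = f a + ∑ as f

summation : ∀ {A} → List A → Linear A
summation {A} as = record { ⟦_⟧ = ∑ as ; ⟦⟧-+ = plus as ; ⟦⟧-* = scale as ; ⟦⟧-cong = congruent as }
  where
  plus : ∀ (as : List A) f g → ∑ as (λ a → f a + g a) ≡ ∑ as f + ∑ as g
  plus []       f g = refl
  plus (a ∷ as) f g = trans (cong (λ z → f a + g a + z) (plus as f g))
    (solve 4 (λ a b c d → a :+ b :+ (c :+ d) := a :+ c :+ (b :+ d)) refl (f a) (g a) (∑ as f) (∑ as g))
  scale : ∀ (as : List A) c f → ∑ as (λ a → c * f a) ≡ c * ∑ as f
  scale []       c f = sym (ℚ.*-zeroʳ c)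
  scale (a ∷ as) c f = trans (cong (λ z → c * f a + z) (scale as c f)) (sym (ℚ.*-distribˡ-+ c (f a) (∑ as f)))
  congruent : ∀ (as : List A) {f g} → (∀ a → f a ≡ g a) → ∑ as f ≡ ∑ as g
  congruent []       h = refl
  congruent (a ∷ as) h = cong₂ _+_ (h a) (congruent as h)

scaled : ∀ {A} → ℚ → Linear A → Linear A
scaled k Λ = record
  { ⟦_⟧     = λ f → k * ⟦ Λ ⟧ f
  ; ⟦⟧-+    = λ f g → trans (cong (k *_) (⟦⟧-+ Λ f g)) (ℚ.*-distribˡ-+ k _ _)
  ; ⟦⟧-*    = λ c f → trans (cong (k *_) (⟦⟧-* Λ c f)) (trans (sym (ℚ.*-assoc k c _)) (trans (cong (_* ⟦ Λ ⟧ f) (ℚ.*-comm k c)) (ℚ.*-assoc c k _)))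
  ; ⟦⟧-cong = λ h → cong (k *_) (⟦⟧-cong Λ h)
  }

-- The outermost vertex is the newest one.
data Seq : ℕ → Set where
  ⟨⟩   : Seq 0
  _◃_ : ∀ {n} → Arrival n → Seq n → Seq (suc n)

infixr 5 _◃_

seqs : ∀ n → Mean (Seq n)
seqs zero    = one ⟨⟩
seqs (suc n) = push (λ (h , α) → α ◃ h) (seqs n ⊗ arrival n)

double : ℕ → ℕ
double zero    = 0
double (suc k) = suc (suc (double k))

State : ℕ → ℕ → Set
State n p = Shape p × Vec Bool n × Vec Bool p

paired : ∀ {m} → Arrival (suc m) → Arrival m → Pairing m
paired (a ∷ S , k) α = a , α , (S , k)

pairing-arrivals : ∀ m (F : Pairing m → ℚ) →
  𝔼 (arrival m) (λ α → 𝔼 (arrival (suc m)) (λ α′ → F (paired α′ α))) ≡ 𝔼 (pairing m) F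
pairing-arrivals m F = 𝔼-swap (arrival m) coin _

offspring : ∀ n {p} → Pairing (n ℕ.+ p) → State n p → Linear (State (suc (suc n)) p)
offspring n ω (i , σ , l) = record
  { ⟦_⟧     = λ f → children n ω i σ l (λ σ′ l′ → f (i , σ′ , l′))
  ; ⟦⟧-+    = λ f g → trans (𝔼-cong sides (λ c → ℚ.*-distribˡ-+ (chance ω (full i σ) c) _ _)) (𝔼-+ sides _ _)
  ; ⟦⟧-*    = λ k f → trans (𝔼-cong sides (λ c → exchange (chance ω (full i σ) c) k _)) (𝔼-* sides k _)
  ; ⟦⟧-cong = λ h → 𝔼-cong sides (λ c → cong (chance ω (full i σ) c *_) (h _))
  }
  where
  exchange : ∀ x k y → x * (k * y) ≡ k * (x * y)
  exchange = solve 3 (λ x k y → x :* (k :* y) := k :* (x :* y)) refl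

offspring-Λ : ∀ n {p B} (ω : Pairing (n ℕ.+ p)) s (Λ : Linear B) (f : State (suc (suc n)) p → B → ℚ) →
              ⟦ offspring n ω s ⟧ (λ s′ → ⟦ Λ ⟧ (f s′)) ≡ ⟦ Λ ⟧ (λ b → ⟦ offspring n ω s ⟧ (λ s′ → f s′ b))
offspring-Λ n ω (i , σ , l) Λ f = trans
  (𝔼-cong sides (λ c → sym (⟦⟧-* Λ (chance ω (full i σ) c) _)))
  (𝔼-Λ sides Λ _)

-- A population is kept only as the functional that sums a test function over its weighted states.
-- No list of states is needed, and the square of a count is the functional applied twice.
population : ∀ k {p} → (Seq p → Linear (State 0 p)) → Seq (double k ℕ.+ p) → Linear (State (double k) p)
population zero    B h            = B h
population (suc k) B (α′ ◃ α ◃ h) = bind (population k B h) (offspring (double k) (paired α′ α))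

⟪_⟫₂ : ∀ {n p} → PairFn n p → State n p → State n p → ℚ
⟪ φ ⟫₂ (i , σ , l) (j , τ , m) = φ i σ l j τ m

⟪_⟫₁ : ∀ {n p} → (Shape p → Vec Bool n → Vec Bool p → ℚ) → State n p → ℚ
⟪ φ ⟫₁ (i , σ , l) = φ i σ l

kernel₂ : ∀ k {p} → PairFn (double k) p → PairFn 0 p
kernel₂ zero    φ = φ
kernel₂ (suc k) φ = kernel₂ k (step₂ (double k) φ)

kernel₁ : ∀ k {p} → (Shape p → Vec Bool (double k) → Vec Bool p → ℚ) → Shape p → Vec Bool 0 → Vec Bool p → ℚ
kernel₁ zero    φ = φ
kernel₁ (suc k) φ = kernel₁ k (step₁ (double k) φ)

-- The newest pair is independent of the population before it. Averaging over it first replaces `φ`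
-- by `step₂ n φ` for the smaller population, so the recursion runs backwards from the last pair to
-- the base.
second-moment : ∀ k {p} (B : Seq p → Linear (State 0 p)) (φ : PairFn (double k) p) →
  𝔼 (seqs (double k ℕ.+ p)) (λ h → ⟦ population k B h ⟧ (λ s → ⟦ population k B h ⟧ (⟪ φ ⟫₂ s)))
  ≡ 𝔼 (seqs p) (λ h → ⟦ B h ⟧ (λ s → ⟦ B h ⟧ (⟪ kernel₂ k φ ⟫₂ s)))
second-moment zero        B φ = refl
second-moment (suc k) {p} B φ = trans
  (𝔼-cong (seqs (n ℕ.+ p)) (λ h → begin
    𝔼 (arrival (n ℕ.+ p)) (λ α → 𝔼 (arrival (suc (n ℕ.+ p))) (λ α′ →
      ⟦ P h ⟧ (λ s → ⟦ O (paired α′ α) s ⟧ (λ s′ → ⟦ P h ⟧ (λ t → ⟦ O (paired α′ α) t ⟧ (⟪ φ ⟫₂ s′))))))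
      ≡⟨ pairing-arrivals (n ℕ.+ p) (λ ω → ⟦ P h ⟧ (λ s → ⟦ O ω s ⟧ (λ s′ → ⟦ P h ⟧ (λ t → ⟦ O ω t ⟧ (⟪ φ ⟫₂ s′))))) ⟩
    𝔼 (pairing (n ℕ.+ p)) (λ ω → ⟦ P h ⟧ (λ s → ⟦ O ω s ⟧ (λ s′ → ⟦ P h ⟧ (λ t → ⟦ O ω t ⟧ (⟪ φ ⟫₂ s′)))))
      ≡⟨ 𝔼-cong (pairing (n ℕ.+ p)) (λ ω → ⟦⟧-cong (P h) (λ s → offspring-Λ n ω s (P h) (λ s′ t → ⟦ O ω t ⟧ (⟪ φ ⟫₂ s′)))) ⟩
    𝔼 (pairing (n ℕ.+ p)) (λ ω → ⟦ P h ⟧ (λ s → ⟦ P h ⟧ (λ t → ⟦ O ω s ⟧ (λ s′ → ⟦ O ω t ⟧ (⟪ φ ⟫₂ s′)))))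
      ≡⟨ 𝔼-Λ (pairing (n ℕ.+ p)) (P h) _ ⟩
    ⟦ P h ⟧ (λ s → 𝔼 (pairing (n ℕ.+ p)) (λ ω → ⟦ P h ⟧ (λ t → ⟦ O ω s ⟧ (λ s′ → ⟦ O ω t ⟧ (⟪ φ ⟫₂ s′)))))
      ≡⟨ ⟦⟧-cong (P h) (λ s → 𝔼-Λ (pairing (n ℕ.+ p)) (P h) _) ⟩
    ⟦ P h ⟧ (λ s → ⟦ P h ⟧ (⟪ step₂ n φ ⟫₂ s)) ∎))
  (second-moment k B (step₂ n φ))
  where
  open ≡-Reasoning
  n : ℕ
  n = double k
  P : Seq (n ℕ.+ p) → Linear (State n p)
  P = population k B
  O : Pairing (n ℕ.+ p) → State n p → Linear (State (suc (suc n)) p)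
  O = offspring n

first-moment : ∀ k {p} (B : Seq p → Linear (State 0 p)) (φ : Shape p → Vec Bool (double k) → Vec Bool p → ℚ) →
  𝔼 (seqs (double k ℕ.+ p)) (λ h → ⟦ population k B h ⟧ ⟪ φ ⟫₁) ≡ 𝔼 (seqs p) (λ h → ⟦ B h ⟧ ⟪ kernel₁ k φ ⟫₁)
first-moment zero        B φ = refl
first-moment (suc k) {p} B φ = trans
  (𝔼-cong (seqs (n ℕ.+ p)) (λ h → trans
    (pairing-arrivals (n ℕ.+ p) (λ ω → ⟦ population k B h ⟧ (λ s → ⟦ offspring n ω s ⟧ ⟪ φ ⟫₁)))
    (𝔼-Λ (pairing (n ℕ.+ p)) (population k B h) _)))
  (first-moment k B (step₁ n φ))
  where
  n : ℕ
  n = double k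

kernel₂-bounds : ∀ k {p} {φ : PairFn (double k) p} {u e} → 0ℚ ≼ u → 0ℚ ≼ e → Bounds φ u e → Bounds (kernel₂ k φ) u (θ ^ k * e)
kernel₂-bounds zero    {e = e} 0≤u 0≤e b = subst (Bounds _ _) (sym (ℚ.*-identityˡ e)) b
kernel₂-bounds (suc k) {e = e} 0≤u 0≤e b = subst (Bounds _ _)
  (trans (sym (ℚ.*-assoc (θ ^ k) θ e)) (cong (_* e) (ℚ.*-comm (θ ^ k) θ)))
  (kernel₂-bounds k 0≤u (0≼* 0≼θ 0≤e) (Step.step-bounds 0≤u 0≤e b))

kernel₁-bounds : ∀ k {p} {φ : Shape p → Vec Bool (double k) → Vec Bool p → ℚ} {v e} → 0ℚ ≼ v → 0ℚ ≼ e →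
                 Bounds₁ φ v e → Bounds₁ (kernel₁ k φ) v (θ ^ k * e)
kernel₁-bounds zero    {e = e} 0≤v 0≤e b = subst (Bounds₁ _ _) (sym (ℚ.*-identityˡ e)) b
kernel₁-bounds (suc k) {e = e} 0≤v 0≤e b = subst (Bounds₁ _ _)
  (trans (sym (ℚ.*-assoc (θ ^ k) θ e)) (cong (_* e) (ℚ.*-comm (θ ^ k) θ)))
  (kernel₁-bounds k 0≤v (0≼* 0≼θ 0≤e) (step-bounds₁ 0≤v 0≤e b))

hit : ∀ {p} → Vec Bool p → ℚ
hit []          = 1ℚ
hit (true  ∷ l) = 0ℚ
hit (false ∷ l) = hit l

0≼½^ : ∀ p → 0ℚ ≼ ½ ^ p
0≼½^ = CauchyLemmas.0≤^ ½ 0≼½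

hit-mean : ∀ p → 𝔼 (bits p) hit ≡ ½ ^ p
hit-mean zero    = refl
hit-mean (suc p) = trans (𝔼-coin _) (cong (½ *_) (trans (cong₂ _+_ (𝔼-const (bits p) 0ℚ) (hit-mean p)) (ℚ.+-identityˡ (½ ^ p))))

0≼hit : ∀ {p} (l : Vec Bool p) → 0ℚ ≼ hit l
0≼hit []          = CauchyLemmas.0≤1
0≼hit (true  ∷ l) = ℚ.≤-refl
0≼hit (false ∷ l) = 0≼hit l

hit≼1 : ∀ {p} (l : Vec Bool p) → hit l ≼ 1ℚ
hit≼1 []          = ℚ.≤-refl
hit≼1 (true  ∷ l) = CauchyLemmas.0≤1
hit≼1 (false ∷ l) = hit≼1 l

-- The recursion starts from the trivial bound 1 on the indicator, hence with error 1; the pairs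
-- reduce this error to `θ ^ k`.
hit-bounds : ∀ {n p} → Bounds {n} {p} (λ i σ l j τ m → hit l * hit m) (½ ^ p * ½ ^ p) 1ℚ
hit-bounds {n} {p} = record
  { nonneg  = λ i σ l j τ m → 0≼* (0≼hit l) (0≼hit m)
  ; average = λ i σ j τ _ → ℚ.≤-reflexive (trans (𝔼-cong (bits p) (λ l → 𝔼-* (bits p) (hit l) hit))
      (trans (𝔼-*ʳ (bits p) _ hit) (cong₂ _*_ (hit-mean p) (hit-mean p))))
  ; new     = λ i σ l j τ m _ → ℚ.≤-trans (hits≼1 l m) (1≼ 1ℚ (check≼ _ _))
  ; old     = λ i j σ l m _ → ℚ.≤-trans (hits≼1 l m) (1≼ _ (check≼ _ _))
  ; same    = λ i σ l → ℚ.≤-trans (hits≼1 l l) (ℚ.≤-trans (check≼ 1ℚ (0ℚ + (+ 144 / 1) * 1ℚ))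
      (ℚ.+-monoˡ-≤ _ (0≼* {+ 36 / 1} (ℚ.nonNegative⁻¹ _) 0≼u)))
  }
  where
  0≼u : 0ℚ ≼ ½ ^ p * ½ ^ p
  0≼u = 0≼* (0≼½^ p) (0≼½^ p)
  hits≼1 : ∀ (l m : Vec Bool p) → hit l * hit m ≼ 1ℚ
  hits≼1 l m = CauchyLemmas.*-mono-≤ {b = 1ℚ} {d = 1ℚ} CauchyLemmas.0≤1 (0≼hit m) (hit≼1 l) (hit≼1 m)
  1≼ : ∀ e → 1ℚ ≼ e → 1ℚ ≼ ½ ^ p * ½ ^ p + e
  1≼ e h = ℚ.≤-trans h (ℚ.≤-trans (ℚ.≤-reflexive (sym (ℚ.+-identityˡ e))) (ℚ.+-monoˡ-≤ e 0≼u))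

hit-bounds₁ : ∀ {n p} → Bounds₁ {n} {p} (λ i σ l → hit l) (½ ^ p) 1ℚ
hit-bounds₁ {n} {p} = record
  { average = λ i σ → hit-mean p
  ; lower   = λ i σ l → ℚ.≤-trans (ℚ.≤-reflexive (sym (trans (ℚ.+-identityˡ (1ℚ * ½ ^ p)) (ℚ.*-identityˡ (½ ^ p))))) (ℚ.+-monoˡ-≤ (1ℚ * ½ ^ p) (0≼hit l))
  }

-- The preliminary phase: deferring and splitting

Unit : ℕ → Set
Unit p = Shape p × Vec Bool p

defer : ∀ {p} → Shape p → Shape (suc p)
defer i s = false ∷ i s

place : ∀ {p} → Bool → Shape p → Shape (suc p)
place s i t = not (s xor t) ∷ i t

isFree : ∀ {p} → Arrival p → Unit p → Bool
isFree α (i , l) = not (val α i true ∨ val α i false)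

-- A unit splits only when both sides are admissible, and then both choices are kept: the two halves
-- differ in the left and in the right set, as `val-independent` demands. Otherwise the vertex is
-- deferred, labelled with its discrepancy towards L. A vertex that joins L or the front of D
-- precedes the older deferred vertices, so their labels change by `S`; joining R changes no label.
branch : ∀ {p} → Arrival p → Unit p → List (Unit (suc p))
branch α@(S , _) (i , l) =
  if val α i true ∨ val α i false
  then (defer i , val α i true ∷ (S ⊕ l)) ∷ []
  else (place true i , false ∷ (S ⊕ l)) ∷ (place false i , false ∷ l) ∷ []

found : ∀ {p} → Bool → Seq p → Bool
found β ⟨⟩                 = false
found β ((S , g , x) ◃ h) = found β h ∨ not (x xor β)

-- The first arrival with x = β starts the right part, the others are deferred.
initial : ∀ {p} → Bool → Seq p → Unit p
initial β ⟨⟩                   = (λ _ → []) , []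
initial β (α@(S , g , x) ◃ h) = let i , l = initial β h in
  if not (found β h) ∧ not (x xor β) then (place false i , false ∷ l) else (defer i , val α i true ∷ (S ⊕ l))

units : ∀ m {p} → Bool → Seq (m ℕ.+ p) → List (Unit (m ℕ.+ p))
units zero    β h       = initial β h ∷ []
units (suc m) β (α ◃ h) = List.concatMap (branch α) (units m β h)

not-found : ∀ {p} → Bool → Seq p → ℚ
not-found β h = if found β h then 0ℚ else 1ℚ

not-found-mean : ∀ p β → 𝔼 (seqs p) (not-found β) ≡ ½ ^ p
not-found-mean zero    β = refl
not-found-mean (suc p) β = trans (𝔼-cong (seqs p) step) (trans (𝔼-* (seqs p) ½ (not-found β)) (cong (½ *_) (not-found-mean p β)))
  where
  step : ∀ h → 𝔼 (arrival p) (λ α → not-found β (α ◃ h)) ≡ ½ * not-found β h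
  step h with found β h
  ... | true  = trans (𝔼-const (arrival p) 0ℚ) (sym (ℚ.*-zeroʳ ½))
  ... | false = trans (𝔼-cong (bits p ⊗ coin) (λ _ → trans (coin-xor β (λ z → if not z then 0ℚ else 1ℚ)) (𝔼-coin _))) (𝔼-const (bits p ⊗ coin) _)

Separated : ∀ {p} → Unit p → Unit p → Set
Separated (i , _) (j , _) = ∀ s → i s ≢ j s

tail-≢ : ∀ {n} {x y : Bool} {xs ys : Vec Bool n} → xs ≢ ys → x ∷ xs ≢ y ∷ ys
tail-≢ xs≢ys e = xs≢ys (Vec.∷-injectiveʳ e)

branch-separated : ∀ {p} (α : Arrival p) u v → Separated u v →
                   All (λ u′ → All (Separated u′) (branch α v)) (branch α u)
branch-separated α (i , l) (j , m) sep with val α i true ∨ val α i false | val α j true ∨ val α j false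
... | true  | true  = ((λ s → tail-≢ (sep s)) ∷ []) ∷ []
... | true  | false = ((λ s → tail-≢ (sep s)) ∷ (λ s → tail-≢ (sep s)) ∷ []) ∷ []
... | false | true  = ((λ s → tail-≢ (sep s)) ∷ []) ∷ ((λ s → tail-≢ (sep s)) ∷ []) ∷ []
... | false | false = ((λ s → tail-≢ (sep s)) ∷ (λ s → tail-≢ (sep s)) ∷ []) ∷ ((λ s → tail-≢ (sep s)) ∷ (λ s → tail-≢ (sep s)) ∷ []) ∷ []

branch-self : ∀ {p} (α : Arrival p) u → AllPairs Separated (branch α u)
branch-self α (i , l) with val α i true ∨ val α i false
... | true  = [] ∷ []
... | false = ((λ { true () ; false () }) ∷ []) ∷ [] ∷ []

concatMap-separated : ∀ {p} (α : Arrival p) {us} → AllPairs Separated us → AllPairs Separated (List.concatMap (branch α) us)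
concatMap-separated α []         = []
concatMap-separated α {u ∷ us} (px ∷ ps) = AllPairs.++⁺ (branch-self α u) (concatMap-separated α ps) (All.map (λ {u′} → flatten u′) (spread px))
  where
  spread : ∀ {vs} → All (Separated u) vs → All (λ u′ → All (λ v → All (Separated u′) (branch α v)) vs) (branch α u)
  spread []                 = All.universal (λ _ → []) _
  spread {v ∷ vs} (s ∷ ss) = All.zipWith (uncurry _∷_) (branch-separated α u v s , spread ss)
  flatten : ∀ u′ {vs} → All (λ v → All (Separated u′) (branch α v)) vs → All (Separated u′) (List.concatMap (branch α) vs)
  flatten u′ []       = []
  flatten u′ (a ∷ as) = All.++⁺ a (flatten u′ as)

units-separated : ∀ m {p} β (h : Seq (m ℕ.+ p)) → AllPairs Separated (units m β h)
units-separated zero    β h       = [] ∷ []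
units-separated (suc m) β (α ◃ h) = concatMap-separated α (units-separated m β h)

-- Growth of the number of units

ι : ℕ → ℚ
ι = CauchyLemmas.ι

0≼ι : ∀ n → 0ℚ ≼ ι n
0≼ι n = ℚ.nonNegative⁻¹ _ {{CauchyLemmas.ι-nonNeg n}}

opaque
  recip : ℕ → ℚ
  recip zero    = 1ℚ
  recip (suc n) = + 1 / suc n

  0≼recip : ∀ n → 0ℚ ≼ recip n
  0≼recip zero    = CauchyLemmas.0≤1
  0≼recip (suc n) = ℚ.nonNegative⁻¹ _ {{ℚ.normalize-nonNeg 1 (suc n)}}

  recip-ι : ∀ n → recip (suc n) * ι (suc n) ≡ 1ℚ
  recip-ι n = CauchyLemmas.1/m*m (suc n)

  recip-1 : recip 1 ≡ 1ℚ
  recip-1 = refl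

-- 1/(N+B) ≤ (1/N)(1 − B/(2N)) for B ≤ N
recip-+ : ∀ N B → B ≤ suc N →
          recip (suc N ℕ.+ B) + recip (suc N) * (recip (suc N) * (½ * ι B)) ≼ recip (suc N)
recip-+ N B B≤N = begin
  x + r * (r * (½ * b))                ≡⟨ cong (λ z → z + r * (r * (½ * b))) (ℚ.*-identityʳ x) ⟨
  x * 1ℚ + r * (r * (½ * b))           ≤⟨ ℚ.+-monoˡ-≤ _ (*-monoˡ (0≼recip (suc N ℕ.+ B)) one≼) ⟩
  x * (ι (suc N ℕ.+ B) * Q) + r * (r * (½ * b))
    ≡⟨ cong (λ z → z + r * (r * (½ * b))) (trans (sym (ℚ.*-assoc x _ Q)) (trans (cong (_* Q) (recip-ι (N ℕ.+ B))) (ℚ.*-identityˡ Q))) ⟩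
  Q + r * (r * (½ * b))                ≡⟨ solve 2 (λ r b → r :+ :- (r :* (r :* (con ½ :* b))) :+ r :* (r :* (con ½ :* b)) := r) refl r b ⟩
  r ∎
  where
  open ℚ.≤-Reasoning
  r x b n y Q : ℚ
  r = recip (suc N)
  x = recip (suc N ℕ.+ B)
  b = ι B
  n = ι (suc N)
  y = r * b
  Q = r + - (r * (r * (½ * b)))
  y≼1 : y ≼ 1ℚ
  y≼1 = ℚ.≤-trans (*-monoˡ (0≼recip (suc N)) (CauchyLemmas.ι-mono B≤N)) (ℚ.≤-reflexive (recip-ι N))
  0≼y : 0ℚ ≼ y
  0≼y = 0≼* (0≼recip (suc N)) (0≼ι B)
  -- With y = B/N in [0, 1], the product (1 + y)(1 - y/2) equals 1 + y(1 - y)/2.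
  one≼ : 1ℚ ≼ ι (suc N ℕ.+ B) * Q
  one≼ = begin
    1ℚ                              ≤⟨ p≼p+q (0≼* 0≼½ (0≼* 0≼y (ℚ.≤-trans (ℚ.≤-reflexive (sym (ℚ.+-inverseʳ y))) (ℚ.+-monoˡ-≤ (- y) y≼1)))) ⟩
    1ℚ + ½ * (y * (1ℚ + - y))       ≡⟨ solve 1 (λ y → con 1ℚ :+ con ½ :* (y :* (con 1ℚ :+ :- y)) := (con 1ℚ :+ y) :* (con 1ℚ :+ :- (con ½ :* y))) refl y ⟩
    (1ℚ + y) * (1ℚ + - (½ * y))     ≡⟨ cong (λ z → (z + y) * (1ℚ + - (½ * y))) (recip-ι N) ⟨
    (r * n + y) * (1ℚ + - (½ * y))  ≡⟨ solve 3 (λ r n b → (r :* n :+ r :* b) :* (con 1ℚ :+ :- (con ½ :* (r :* b))) := (n :+ b) :* (r :+ :- (r :* (r :* (con ½ :* b))))) refl r n b ⟩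
    (n + b) * Q                     ≡⟨ cong (_* Q) (CauchyLemmas.ι-+ (suc N) B) ⟨
    ι (suc N ℕ.+ B) * Q ∎

branchings : ∀ {p} → Arrival p → List (Unit p) → ℕ
branchings α []       = 0
branchings α (u ∷ us) = (if isFree α u then 1 else 0) ℕ.+ branchings α us

branchings-≤ : ∀ {p} (α : Arrival p) us → branchings α us ≤ length us
branchings-≤ α []       = ℕ.z≤n
branchings-≤ α (u ∷ us) with isFree α u
... | true  = ℕ.s≤s (branchings-≤ α us)
... | false = ℕ.m≤n⇒m≤1+n (branchings-≤ α us)

length-branches : ∀ {p} (α : Arrival p) us → length (List.concatMap (branch α) us) ≡ length us ℕ.+ branchings α us
length-branches α []       = refl
length-branches α (u@(i , l) ∷ us) = trans (List.length-++ (branch α u)) (trans (cong₂ ℕ._+_ (length-branch u) (length-branches α us)) (regroup (length us) (if isFree α u then 1 else 0) (branchings α us)))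
  where
  length-branch : ∀ u → length (branch α u) ≡ suc (if isFree α u then 1 else 0)
  length-branch (i , l) with val α i true ∨ val α i false
  ... | true  = refl
  ... | false = refl
  regroup : ∀ n b c → suc b ℕ.+ (n ℕ.+ c) ≡ suc n ℕ.+ (b ℕ.+ c)
  regroup n b c = cong suc (trans (sym (ℕ.+-assoc b n c)) (trans (cong (ℕ._+ c) (ℕ.+-comm b n)) (ℕ.+-assoc n b c)))

free-mean : ∀ {p} (u : Unit p) → 𝔼 (arrival p) (λ α → ι (if isFree α u then 1 else 0)) ≡ + 1 / 4
free-mean {p} (i , l) = trans
  (𝔼-cong (bits p) (λ w → trans
    (𝔼-cong coin (λ g → coin-xor (dot w (i false)) (λ x → F (g xor dot w (i true)) x)))
    (trans (coin-xor (dot w (i true)) (λ g → 𝔼 coin (F g))) (𝔼-sides (uncurry F)))))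
  (𝔼-const (bits p) _)
  where
  F : Bool → Bool → ℚ
  F f b = ι (if not (f ∨ b) then 1 else 0)

branchings-mean : ∀ {p} (us : List (Unit p)) → 𝔼 (arrival p) (λ α → ι (branchings α us)) ≡ (+ 1 / 4) * ι (length us)
branchings-mean {p} []       = 𝔼-const (arrival p) 0ℚ
branchings-mean {p} (u ∷ us) = begin
  𝔼 (arrival p) (λ α → ι ((if isFree α u then 1 else 0) ℕ.+ branchings α us))
    ≡⟨ 𝔼-cong (arrival p) (λ α → CauchyLemmas.ι-+ (if isFree α u then 1 else 0) (branchings α us)) ⟩
  𝔼 (arrival p) (λ α → ι (if isFree α u then 1 else 0) + ι (branchings α us))
    ≡⟨ trans (𝔼-+ (arrival p) _ _) (cong₂ _+_ (free-mean u) (branchings-mean us)) ⟩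
  (+ 1 / 4) + (+ 1 / 4) * ι (length us)
    ≡⟨ solve 1 (λ n → con (+ 1 / 4) :+ con (+ 1 / 4) :* n := con (+ 1 / 4) :* (con 1ℚ :+ n)) refl (ι (length us)) ⟩
  (+ 1 / 4) * (1ℚ + ι (length us))
    ≡⟨ cong ((+ 1 / 4) *_) (CauchyLemmas.ι-+ 1 (length us)) ⟨
  (+ 1 / 4) * ι (suc (length us)) ∎
  where
  open ≡-Reasoning

-- Each unit splits with probability 1/4, so by linearity N/4 units split on average, however they
-- are correlated. The bound `recip-+` is linear in the number of splits, so it turns this into 1 -
-- 1/8.
recip-step : ∀ {p} (us : List (Unit p)) n → length us ≡ suc n →
             𝔼 (arrival p) (λ α → recip (length (List.concatMap (branch α) us))) ≼ θ * recip (length us)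
recip-step {p} us n eq rewrite eq = begin
  E                      ≡⟨ solve 2 (λ E r → E := (E :+ con (+ 1 / 8) :* r) :+ :- (con (+ 1 / 8) :* r)) refl E r ⟩
  (E + (+ 1 / 8) * r) + - ((+ 1 / 8) * r)
                         ≤⟨ ℚ.+-monoˡ-≤ _ sum≼ ⟩
  r + - ((+ 1 / 8) * r)  ≡⟨ solve 1 (λ r → r :+ :- (con (+ 1 / 8) :* r) := con θ :* r) refl r ⟩
  θ * r ∎
  where
  open ℚ.≤-Reasoning
  r E : ℚ
  r = recip (suc n)
  E = 𝔼 (arrival p) (λ α → recip (length (List.concatMap (branch α) us)))
  sum≼ : E + (+ 1 / 8) * r ≼ r
  sum≼ = begin
    E + (+ 1 / 8) * r
      ≡⟨ cong (λ z → E + z) (trans (solve 1 (λ r → con (+ 1 / 8) :* r := r :* (con 1ℚ :* (con ½ :* con (+ 1 / 4)))) refl r)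
           (cong (λ z → r * (z * (½ * (+ 1 / 4)))) (sym (recip-ι n)))) ⟩
    E + r * ((r * ι (suc n)) * (½ * (+ 1 / 4)))
      ≡⟨ cong (λ z → E + z) (solve 2 (λ r n → r :* ((r :* n) :* (con ½ :* con (+ 1 / 4))) := r :* (r :* con ½) :* (con (+ 1 / 4) :* n)) refl r (ι (suc n))) ⟩
    E + r * (r * ½) * ((+ 1 / 4) * ι (suc n))
      ≡⟨ cong (λ z → E + r * (r * ½) * z) (trans (cong (λ z → (+ 1 / 4) * ι z) (sym eq)) (sym (branchings-mean us))) ⟩
    E + r * (r * ½) * 𝔼 (arrival p) (λ α → ι (branchings α us))
      ≡⟨ trans (cong (λ z → E + z) (sym (𝔼-* (arrival p) (r * (r * ½)) _))) (sym (𝔼-+ (arrival p) _ _)) ⟩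
    𝔼 (arrival p) (λ α → recip (length (List.concatMap (branch α) us)) + r * (r * ½) * ι (branchings α us))
      ≤⟨ 𝔼-≤ (arrival p) r (λ α → begin
        recip (length (List.concatMap (branch α) us)) + r * (r * ½) * ι (branchings α us)
          ≡⟨ cong₂ _+_ (cong recip (trans (length-branches α us) (cong (ℕ._+ branchings α us) eq)))
               (solve 2 (λ r b → r :* (r :* con ½) :* b := r :* (r :* (con ½ :* b))) refl r (ι (branchings α us))) ⟩
        recip (suc n ℕ.+ branchings α us) + r * (r * (½ * ι (branchings α us)))
          ≤⟨ recip-+ n (branchings α us) (subst (branchings α us ≤_) eq (branchings-≤ α us)) ⟩
        r ∎) ⟩
    r ∎

units-nonempty : ∀ m {p} β (h : Seq (m ℕ.+ p)) → ∃[ n ] length (units m β h) ≡ suc n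
units-nonempty zero    β h       = 0 , refl
units-nonempty (suc m) β (α ◃ h) with units-nonempty m β h
... | n , eq = n ℕ.+ branchings α (units m β h) , trans (length-branches α (units m β h)) (cong (ℕ._+ branchings α (units m β h)) eq)

-- The diagonal of the second moment enters with weight 1/N after normalisation, so it is the mean
-- of 1/N that has to be exponentially small.
recip-mean : ∀ m {p} β → 𝔼 (seqs (m ℕ.+ p)) (λ h → recip (length (units m β h))) ≼ θ ^ m
recip-mean zero    {p} β = 𝔼-≤ (seqs p) 1ℚ (λ _ → ℚ.≤-reflexive recip-1)
recip-mean (suc m) {p} β = ℚ.≤-trans
  (𝔼-mono (seqs (m ℕ.+ p)) (λ h → recip-step (units m β h) (proj₁ (units-nonempty m β h)) (proj₂ (units-nonempty m β h))))
  (ℚ.≤-trans (ℚ.≤-reflexive (𝔼-* (seqs (m ℕ.+ p)) θ _)) (*-monoˡ 0≼θ (recip-mean m β)))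

-- Variance of the normalised number of successes

asState : ∀ {p} → Unit p → State 0 p
asState (i , l) = i , [] , l

∑-≼ : ∀ {A : Set} {as : List A} {f : A → ℚ} {k} → All (λ a → f a ≼ k) as → ∑ as f ≼ ι (length as) * k
∑-≼ {k = k} []                 = ℚ.≤-reflexive (sym (ℚ.*-zeroˡ k))
∑-≼ {as = a ∷ as} {f} {k} (h ∷ hs) = begin
  f a + ∑ as f                ≤⟨ ℚ.+-mono-≤ h (∑-≼ hs) ⟩
  k + ι (length as) * k       ≡⟨ solve 2 (λ n k → k :+ n :* k := (con 1ℚ :+ n) :* k) refl (ι (length as)) k ⟩
  (1ℚ + ι (length as)) * k    ≡⟨ cong (_* k) (CauchyLemmas.ι-+ 1 (length as)) ⟨
  ι (suc (length as)) * k ∎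
  where
  open ℚ.≤-Reasoning

≼-∑ : ∀ {A : Set} (as : List A) {f : A → ℚ} {k} → (∀ a → k ≼ f a) → ι (length as) * k ≼ ∑ as f
≼-∑ []       {k = k} h = ℚ.≤-reflexive (ℚ.*-zeroˡ k)
≼-∑ (a ∷ as) {f} {k} h = begin
  ι (suc (length as)) * k     ≡⟨ cong (_* k) (CauchyLemmas.ι-+ 1 (length as)) ⟩
  (1ℚ + ι (length as)) * k    ≡⟨ solve 2 (λ n k → (con 1ℚ :+ n) :* k := k :+ n :* k) refl (ι (length as)) k ⟩
  k + ι (length as) * k       ≤⟨ ℚ.+-mono-≤ (h a) (≼-∑ as h) ⟩
  f a + ∑ as f ∎
  where
  open ℚ.≤-Reasoning

∑∑-≼ : ∀ {p} {us : List (Unit p)} (f : Unit p → Unit p → ℚ) {C D} → 0ℚ ≼ D → AllPairs Separated us →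
       (∀ u → f u u ≼ C) → (∀ u v → Separated u v → f u v ≼ D) →
       ∑ us (λ u → ∑ us (f u)) ≼ ι (length us) * C + ι (length us) * (ι (length us) * D)
∑∑-≼ f {C} {D} 0≤D [] diag off = ℚ.≤-reflexive (solve 2 (λ C D → con 0ℚ := con 0ℚ :* C :+ con 0ℚ :* (con 0ℚ :* D)) refl C D)
∑∑-≼ {us = u ∷ us} f {C} {D} 0≤D (px ∷ ps) diag off = begin
  f u u + ∑ us (f u) + ∑ us (λ v → f v u + ∑ us (f v))
    ≡⟨ cong (λ z → f u u + ∑ us (f u) + z) (⟦⟧-+ (summation us) (λ v → f v u) (λ v → ∑ us (f v))) ⟩
  f u u + ∑ us (f u) + (∑ us (λ v → f v u) + ∑ us (λ v → ∑ us (f v)))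
    ≤⟨ ℚ.+-mono-≤ (ℚ.+-mono-≤ (diag u) (∑-≼ (All.map (off u _) px)))
         (ℚ.+-mono-≤ (∑-≼ (All.map (λ sep → off _ u (λ s e → sep s (sym e))) px)) (∑∑-≼ f 0≤D ps diag off)) ⟩
  -- One more `D` for the diagonal entry completes the square of 1 + n.
  C + n * D + (n * D + (n * C + n * (n * D)))
    ≤⟨ p≼p+q 0≤D ⟩
  C + n * D + (n * D + (n * C + n * (n * D))) + D
    ≡⟨ solve 3 (λ n C D → C :+ n :* D :+ (n :* D :+ (n :* C :+ n :* (n :* D))) :+ D
                := (con 1ℚ :+ n) :* C :+ (con 1ℚ :+ n) :* ((con 1ℚ :+ n) :* D)) refl n C D ⟩
  (1ℚ + n) * C + (1ℚ + n) * ((1ℚ + n) * D)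
    ≡⟨ cong (λ z → z * C + z * (z * D)) (CauchyLemmas.ι-+ 1 (length us)) ⟨
  ι (suc (length us)) * C + ι (suc (length us)) * (ι (suc (length us)) * D) ∎
  where
  open ℚ.≤-Reasoning
  n : ℚ
  n = ι (length us)

-- The population of the units, normalised so that the number of successful
-- descendants has mean close to 1.
normaliser : ℕ → ℕ → ℚ
normaliser p N = recip N * (+ 2 / 1) ^ p

base : ∀ m {p} → Bool → Seq (m ℕ.+ p) → Linear (State 0 (m ℕ.+ p))
base m {p} β h = scaled (normaliser (m ℕ.+ p) (length (units m β h))) (bind (summation (units m β h)) point)
  where
  point : Unit (m ℕ.+ p) → Linear (State 0 (m ℕ.+ p))
  point u = record { ⟦_⟧ = λ f → f (asState u) ; ⟦⟧-+ = λ _ _ → refl ; ⟦⟧-* = λ _ _ → refl ; ⟦⟧-cong = λ h → h (asState u) }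

successes : ∀ k m {p} → Bool → Seq (double k ℕ.+ (m ℕ.+ p)) → ℚ
successes k m β h = ⟦ population k (base m β) h ⟧ (λ (i , σ , l) → hit l)

2^*½^ : ∀ p → (+ 2 / 1) ^ p * ½ ^ p ≡ 1ℚ
2^*½^ zero    = refl
2^*½^ (suc p) = trans (solve 2 (λ x y → con (+ 2 / 1) :* x :* (con ½ :* y) := x :* y) refl ((+ 2 / 1) ^ p) (½ ^ p)) (2^*½^ p)

0≼2^ : ∀ p → 0ℚ ≼ (+ 2 / 1) ^ p
0≼2^ = CauchyLemmas.0≤^ (+ 2 / 1) (ℚ.nonNegative⁻¹ _)

0≼θ^ : ∀ k → 0ℚ ≼ θ ^ k
0≼θ^ = CauchyLemmas.0≤^ θ 0≼θ

module Moments (k m p : ℕ) (β : Bool) where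

  open ℚ.≤-Reasoning

  P : ℕ
  P = m ℕ.+ p

  e v t w : ℚ
  e = θ ^ k
  v = ½ ^ P
  t = (+ 2 / 1) ^ P
  w = t * t

  pair : PairFn (double k) P
  pair i σ l j τ m = hit l * hit m

  bounds : Bounds (kernel₂ k pair) (v * v) e
  bounds = subst (Bounds _ _) (ℚ.*-identityʳ e) (kernel₂-bounds k (0≼* (0≼½^ P) (0≼½^ P)) CauchyLemmas.0≤1 hit-bounds)

  bounds₁ : Bounds₁ (kernel₁ k {P} (λ i σ l → hit l)) v e
  bounds₁ = subst (Bounds₁ _ _) (ℚ.*-identityʳ e) (kernel₁-bounds k (0≼½^ P) CauchyLemmas.0≤1 hit-bounds₁)

  module _ (h : Seq P) where

    us : List (Unit P)
    us = units m β h

    N r : ℚ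
    N = ι (length us)
    r = recip (length us)

    rN : r * N ≡ 1ℚ
    rN with units-nonempty m β h
    ... | n , eq = subst (λ z → recip z * ι z ≡ 1ℚ) (sym eq) (recip-ι n)

    0≼c : 0ℚ ≼ r * t
    0≼c = 0≼* (0≼recip (length us)) (0≼2^ P)

    -- By `units-separated` the N² off-diagonal pairs fall under `old` and the N diagonal ones under
    -- `same`. As `r * N` and `t * v` are both 1, the main term becomes 1 and each error carries
    -- `w`, that is 4^P: the square of the factor that compensates for the probability of vanishing
    -- labels.
    base-second : ⟦ base m β h ⟧ (λ s → ⟦ base m β h ⟧ (⟪ kernel₂ k pair ⟫₂ s))
                  ≼ (1ℚ + (+ 2 / 1) * (w * e)) + r * ((+ 36 / 1) + (+ 144 / 1) * (w * e))
    base-second = begin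
      c * ∑ us (λ u → c * ∑ us (λ u′ → f u u′))
        ≡⟨ cong (c *_) (⟦⟧-* (summation us) c (λ u → ∑ us (f u))) ⟩
      c * (c * ∑ us (λ u → ∑ us (f u)))
        ≤⟨ *-monoˡ 0≼c (*-monoˡ 0≼c (∑∑-≼ f 0≼D (units-separated m β h)
             (λ (i , l) → Bounds.same bounds i [] l) (λ (i , l) (j , l′) sep → Bounds.old bounds i j [] l l′ sep))) ⟩
      c * (c * (N * C + N * (N * D)))
        ≡⟨ solve 6 (λ r t N v e w → (r :* t) :* ((r :* t) :* (N :* (con (+ 36 / 1) :* (v :* v) :+ con (+ 144 / 1) :* e) :+ N :* (N :* (v :* v :+ con (+ 2 / 1) :* e))))
             := (r :* N) :* (r :* N) :* ((t :* v) :* (t :* v) :+ con (+ 2 / 1) :* ((t :* t) :* e))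
                :+ (r :* N) :* (r :* (con (+ 36 / 1) :* ((t :* v) :* (t :* v)) :+ con (+ 144 / 1) :* ((t :* t) :* e)))) refl r t N v e w ⟩
      (r * N) * (r * N) * ((t * v) * (t * v) + (+ 2 / 1) * (w * e)) + (r * N) * (r * ((+ 36 / 1) * ((t * v) * (t * v)) + (+ 144 / 1) * (w * e)))
        ≡⟨ cong₂ (λ x y → x * x * (y * y + (+ 2 / 1) * (w * e)) + x * (r * ((+ 36 / 1) * (y * y) + (+ 144 / 1) * (w * e)))) rN (2^*½^ P) ⟩
      1ℚ * 1ℚ * (1ℚ * 1ℚ + (+ 2 / 1) * (w * e)) + 1ℚ * (r * ((+ 36 / 1) * (1ℚ * 1ℚ) + (+ 144 / 1) * (w * e)))
        ≡⟨ solve 2 (λ r we → con 1ℚ :* con 1ℚ :* (con 1ℚ :* con 1ℚ :+ con (+ 2 / 1) :* we) :+ con 1ℚ :* (r :* (con (+ 36 / 1) :* (con 1ℚ :* con 1ℚ) :+ con (+ 144 / 1) :* we))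
             := (con 1ℚ :+ con (+ 2 / 1) :* we) :+ r :* (con (+ 36 / 1) :+ con (+ 144 / 1) :* we)) refl r (w * e) ⟩
      (1ℚ + (+ 2 / 1) * (w * e)) + r * ((+ 36 / 1) + (+ 144 / 1) * (w * e)) ∎
      where
      c C D : ℚ
      c = r * t
      C = (+ 36 / 1) * (v * v) + (+ 144 / 1) * e
      D = v * v + (+ 2 / 1) * e
      0≼D : 0ℚ ≼ D
      0≼D = CauchyLemmas.0≤+ (0≼* (0≼½^ P) (0≼½^ P)) (0≼* {+ 2 / 1} (ℚ.nonNegative⁻¹ _) (0≼θ^ k))
      f : Unit P → Unit P → ℚ
      f u u′ = ⟪ kernel₂ k pair ⟫₂ (asState u) (asState u′)

    base-first : 1ℚ ≼ ⟦ base m β h ⟧ ⟪ kernel₁ k (λ i σ l → hit l) ⟫₁ + e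
    base-first = begin
      1ℚ
        ≡⟨ cong₂ (λ x y → x * y) rN (2^*½^ P) ⟨
      (r * N) * (t * v)
        ≡⟨ solve 5 (λ r N t v e → (r :* N) :* (t :* v) := (r :* t) :* (N :* (v :+ :- (e :* v))) :+ e :* ((r :* N) :* (t :* v))) refl r N t v e ⟩
      (r * t) * (N * (v + - (e * v))) + e * ((r * N) * (t * v))
        ≤⟨ ℚ.+-mono-≤ (*-monoˡ 0≼c (≼-∑ us (λ u → lower u)))
             (ℚ.≤-reflexive (trans (cong₂ (λ x y → e * (x * y)) rN (2^*½^ P)) (ℚ.*-identityʳ e))) ⟩
      (r * t) * ∑ us (λ u → ⟪ kernel₁ k (λ i σ l → hit l) ⟫₁ (asState u)) + e ∎
      where
      lower : ∀ u → v + - (e * v) ≼ ⟪ kernel₁ k (λ i σ l → hit l) ⟫₁ (asState u)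
      lower (i , l) = ℚ.≤-trans (ℚ.+-monoˡ-≤ (- (e * v)) (Bounds₁.lower bounds₁ i [] l))
        (ℚ.≤-reflexive (solve 2 (λ x y → x :+ y :+ :- y := x) refl (kernel₁ k (λ i σ l → hit l) i [] l) (e * v)))

  Z : Seq (double k ℕ.+ P) → ℚ
  Z = successes k m β

  Z² : 𝔼 (seqs (double k ℕ.+ P)) (λ h → Z h * Z h) ≼ (1ℚ + (+ 2 / 1) * (w * e)) + θ ^ m * ((+ 36 / 1) + (+ 144 / 1) * (w * e))
  Z² = begin
    𝔼 (seqs (double k ℕ.+ P)) (λ h → Z h * Z h)
      ≡⟨ 𝔼-cong (seqs (double k ℕ.+ P)) (λ h → square (population k (base m β) h)) ⟩
    𝔼 (seqs (double k ℕ.+ P)) (λ h → ⟦ population k (base m β) h ⟧ (λ s → ⟦ population k (base m β) h ⟧ (⟪ pair ⟫₂ s)))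
      ≡⟨ second-moment k (base m β) pair ⟩
    𝔼 (seqs P) (λ h → ⟦ base m β h ⟧ (λ s → ⟦ base m β h ⟧ (⟪ kernel₂ k pair ⟫₂ s)))
      ≤⟨ 𝔼-mono (seqs P) base-second ⟩
    𝔼 (seqs P) (λ h → (1ℚ + (+ 2 / 1) * (w * e)) + r h * ((+ 36 / 1) + (+ 144 / 1) * (w * e)))
      ≡⟨ trans (𝔼-+ (seqs P) _ _) (cong₂ _+_ (𝔼-const (seqs P) (1ℚ + (+ 2 / 1) * (w * e))) (𝔼-*ʳ (seqs P) ((+ 36 / 1) + (+ 144 / 1) * (w * e)) r)) ⟩
    (1ℚ + (+ 2 / 1) * (w * e)) + 𝔼 (seqs P) r * ((+ 36 / 1) + (+ 144 / 1) * (w * e))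
      ≤⟨ ℚ.+-monoʳ-≤ (1ℚ + (+ 2 / 1) * (w * e)) (*-monoʳ (CauchyLemmas.0≤+ {+ 36 / 1} (ℚ.nonNegative⁻¹ _)
           (0≼* {+ 144 / 1} (ℚ.nonNegative⁻¹ _) (0≼* (0≼* (0≼2^ P) (0≼2^ P)) (0≼θ^ k)))) (recip-mean m β)) ⟩
    (1ℚ + (+ 2 / 1) * (w * e)) + θ ^ m * ((+ 36 / 1) + (+ 144 / 1) * (w * e)) ∎
    where
    square : ∀ (Λ : Linear (State (double k) P)) → ⟦ Λ ⟧ (λ (i , σ , l) → hit l) * ⟦ Λ ⟧ (λ (i , σ , l) → hit l)
             ≡ ⟦ Λ ⟧ (λ s → ⟦ Λ ⟧ (⟪ pair ⟫₂ s))
    square Λ = sym (trans (⟦⟧-cong Λ (λ (i , σ , l) → trans (⟦⟧-* Λ (hit l) _) (ℚ.*-comm (hit l) _))) (⟦⟧-* Λ (⟦ Λ ⟧ (λ (i , σ , l) → hit l)) _))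

  Z¹ : 1ℚ ≼ 𝔼 (seqs (double k ℕ.+ P)) Z + e
  Z¹ = begin
    1ℚ                                             ≤⟨ 𝔼-≥ (seqs P) 1ℚ base-first ⟩
    𝔼 (seqs P) (λ h → ⟦ base m β h ⟧ ⟪ kernel₁ k (λ i σ l → hit l) ⟫₁ + e)
      ≡⟨ trans (𝔼-+ (seqs P) _ _) (cong₂ _+_ (sym (first-moment k (base m β) (λ i σ l → hit l))) (𝔼-const (seqs P) e)) ⟩
    𝔼 (seqs (double k ℕ.+ P)) Z + e ∎

  variance-bound : ℚ
  variance-bound = (+ 2 / 1) * (w * e) + θ ^ m * ((+ 36 / 1) + (+ 144 / 1) * (w * e)) + (+ 2 / 1) * e

  variance : 𝔼 (seqs (double k ℕ.+ P)) (λ h → (Z h - 1ℚ) * (Z h - 1ℚ)) ≼ variance-bound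
  variance = begin
    𝔼 (seqs (double k ℕ.+ P)) (λ h → (Z h - 1ℚ) * (Z h - 1ℚ))
      ≡⟨ 𝔼-cong (seqs (double k ℕ.+ P)) (λ h → solve 1 (λ z → (z :+ :- con 1ℚ) :* (z :+ :- con 1ℚ) := z :* z :+ (con (- (+ 2 / 1)) :* z :+ con 1ℚ)) refl (Z h)) ⟩
    𝔼 (seqs (double k ℕ.+ P)) (λ h → Z h * Z h + ((- (+ 2 / 1)) * Z h + 1ℚ))
      ≡⟨ trans (𝔼-+ (seqs (double k ℕ.+ P)) _ _) (cong (λ z → 𝔼 (seqs (double k ℕ.+ P)) (λ h → Z h * Z h) + z)
           (trans (𝔼-+ (seqs (double k ℕ.+ P)) _ _) (cong₂ _+_ (𝔼-* (seqs (double k ℕ.+ P)) (- (+ 2 / 1)) Z) (𝔼-const (seqs (double k ℕ.+ P)) 1ℚ)))) ⟩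
    𝔼 (seqs (double k ℕ.+ P)) (λ h → Z h * Z h) + ((- (+ 2 / 1)) * M + 1ℚ)
      -- The mean enters negatively, so the lower bound `Z¹` suffices: 1 - (M + e) is at most 0.
      ≡⟨ cong (λ z → 𝔼 (seqs (double k ℕ.+ P)) (λ h → Z h * Z h) + z)
           (solve 2 (λ M e → con (- (+ 2 / 1)) :* M :+ con 1ℚ := con (+ 2 / 1) :* (con 1ℚ :+ :- (M :+ e)) :+ (con (+ 2 / 1) :* e :+ :- con 1ℚ)) refl M e) ⟩
    𝔼 (seqs (double k ℕ.+ P)) (λ h → Z h * Z h) + ((+ 2 / 1) * (1ℚ + - (M + e)) + ((+ 2 / 1) * e + - 1ℚ))
      ≤⟨ ℚ.+-mono-≤ Z² (ℚ.+-monoˡ-≤ ((+ 2 / 1) * e + - 1ℚ) (*-monoˡ {+ 2 / 1} (ℚ.nonNegative⁻¹ _)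
           (ℚ.≤-trans (ℚ.+-monoˡ-≤ (- (M + e)) Z¹) (ℚ.≤-reflexive (ℚ.+-inverseʳ (M + e)))))) ⟩
    (1ℚ + (+ 2 / 1) * (w * e)) + θ ^ m * ((+ 36 / 1) + (+ 144 / 1) * (w * e)) + ((+ 2 / 1) * 0ℚ + ((+ 2 / 1) * e + - 1ℚ))
      ≡⟨ solve 3 (λ a b e → (con 1ℚ :+ a) :+ b :+ (con (+ 2 / 1) :* con 0ℚ :+ (con (+ 2 / 1) :* e :+ :- con 1ℚ)) := a :+ b :+ con (+ 2 / 1) :* e) refl
           ((+ 2 / 1) * (w * e)) (θ ^ m * ((+ 36 / 1) + (+ 144 / 1) * (w * e))) e ⟩
    (+ 2 / 1) * (w * e) + θ ^ m * ((+ 36 / 1) + (+ 144 / 1) * (w * e)) + (+ 2 / 1) * e ∎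
    where
    M : ℚ
    M = 𝔼 (seqs (double k ℕ.+ P)) Z

-- From successful states to even-degenerate orderings.

graph : ∀ {n} → Seq n → Graph n
graph ⟨⟩             = ∅
graph ((S , _) ◃ h) = S ▹ graph h

gs xs : ∀ {n} → Seq n → Vec Bool n
gs ⟨⟩                 = []
gs ((_ , g , _) ◃ h) = g ∷ gs h
xs ⟨⟩                 = []
xs ((_ , _ , x) ◃ h) = x ∷ xs h

par : ∀ {V : Set} → (V → Bool) → List V → Bool
par f []       = false
par f (v ∷ vs) = f v xor par f vs

par-map : ∀ {V W : Set} (f : W → Bool) (k : V → W) vs → par f (List.map k vs) ≡ par (f ∘ k) vs
par-map f k []       = refl
par-map f k (v ∷ vs) = cong (f (k v) xor_) (par-map f k vs)

par-++ : ∀ {V : Set} (f : V → Bool) vs ws → par f (vs List.++ ws) ≡ par f vs xor par f ws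
par-++ f []       ws = refl
par-++ f (v ∷ vs) ws = trans (cong (f v xor_) (par-++ f vs ws)) (sym (Bool.xor-assoc (f v) _ _))

par-cong : ∀ {V : Set} {f g : V → Bool} → (∀ v → f v ≡ g v) → ∀ vs → par f vs ≡ par g vs
par-cong h []       = refl
par-cong h (v ∷ vs) = cong₂ _xor_ (h v) (par-cong h vs)

verts : ∀ n → List (Fin n)
verts zero    = []
verts (suc n) = zero ∷ List.map suc (verts n)

-- The left part (newest vertex first): the edges to the earlier vertices of the
-- ordering must match the total degree g v.
Back : ∀ {V : Set} → (V → V → Bool) → (V → Bool) → List V → Set
Back A g []       = ⊤
Back A g (v ∷ vs) = par (A v) vs ≡ g v × Back A g vs

-- The right part (newest vertex first); the condition x v ≡ β on the last
-- vertex only records its label.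
Forth : ∀ {V : Set} → (V → V → Bool) → (V → Bool) → Bool → List V → Set
Forth A x β []           = ⊤
Forth A x β (v ∷ [])     = x v ≡ β
Forth A x β (v ∷ w ∷ vs) = par (A v) (w ∷ vs) ≡ x v × Forth A x β (w ∷ vs)

-- The deferred vertices (newest first) with their labels; b d counts the
-- neighbours of d that come before all of them.
Deferred : ∀ {D : Set} → (D → D → Bool) → (D → Bool) → (label b : D → Bool) → List D → Set
Deferred A g label b []       = ⊤
Deferred A g label b (d ∷ ds) = label d xor b d ≡ g d × Deferred A g label (λ e → b e xor A e d) ds

Back-map : ∀ {V W : Set} (A : W → W → Bool) (g : W → Bool) (k : V → W) vs →
           Back (λ u v → A (k u) (k v)) (g ∘ k) vs → Back A g (List.map k vs)
Back-map A g k []       _       = tt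
Back-map A g k (v ∷ vs) (e , b) = trans (par-map (A (k v)) k vs) e , Back-map A g k vs b

Forth-map : ∀ {V W : Set} (A : W → W → Bool) (x : W → Bool) β (k : V → W) vs →
            Forth (λ u v → A (k u) (k v)) (x ∘ k) β vs → Forth A x β (List.map k vs)
Forth-map A x β k []           _       = tt
Forth-map A x β k (v ∷ [])     e       = e
Forth-map A x β k (v ∷ w ∷ vs) (e , f) = trans (par-map (A (k v)) k (w ∷ vs)) e , Forth-map A x β k (w ∷ vs) f

Deferred-map : ∀ {D E : Set} (A : E → E → Bool) (g label b : E → Bool) (k : D → E) ds →
               Deferred (λ d e → A (k d) (k e)) (g ∘ k) (label ∘ k) (b ∘ k) ds → Deferred A g label b (List.map k ds)
Deferred-map A g label b k []       _       = tt
Deferred-map A g label b k (d ∷ ds) (e , r) = e , Deferred-map A g label (λ e → b e xor A e (k d)) k ds r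

-- Only the sum of label and backward count is constrained. A vertex inserted before all of D raises
-- the count of its neighbours by one and flips their labels, which cancels; `insertLeft` rests on
-- this.
Deferred-cong : ∀ {D : Set} {A : D → D → Bool} {g label b label′ b′ : D → Bool} →
                (∀ d → label d xor b d ≡ label′ d xor b′ d) →
                ∀ ds → Deferred A g label b ds → Deferred A g label′ b′ ds
Deferred-cong h []       _       = tt
Deferred-cong {A = A} {label = label} {b} {label′} {b′} h (d ∷ ds) (e , r) = trans (sym (h d)) e ,
  Deferred-cong (λ e → trans (sym (Bool.xor-assoc (label e) (b e) (A e d)))
    (trans (cong (_xor A e d) (h e)) (Bool.xor-assoc (label′ e) (b′ e) (A e d)))) ds r

-- A layout of the vertices that realises a state, except possibly for the
-- vertices that have arrived but are not placed yet.
record Partial {V D : Set} (A : V → V → Bool) (g x : V → Bool) (β : Bool) (emb : D → V) (label : D → Bool)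
               (Ls Rs : List V) (Ds : List D) : Set where
  constructor partial
  field
    back     : Back A g Ls
    forth    : Forth A x β Rs
    deferred : Deferred (λ d e → A (emb d) (emb e)) (g ∘ emb) label (λ d → par (A (emb d)) Ls) Ds

insertLeft : ∀ {V D : Set} {A : V → V → Bool} {g x β} {emb : D → V} {label Ls Rs Ds} →
             Partial A g x β emb label Ls Rs Ds → ∀ v → par (A v) Ls ≡ g v →
             Partial A g x β emb (λ d → label d xor A (emb d) v) (v ∷ Ls) Rs Ds
insertLeft {A = A} {emb = emb} {label} {Ls} {Ds = Ds} (partial b f d) v e = partial (e , b) f
  (Deferred-cong (λ d → sym (trans (Bool.xor-assoc (label d) _ _) (cong (label d xor_) (xor-cancelˡ (A (emb d) v) _)))) Ds d)

insertRight : ∀ {V D : Set} {A : V → V → Bool} {g x β} {emb : D → V} {label Ls w Rs Ds} →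
              Partial A g x β emb label Ls (w ∷ Rs) Ds → ∀ v → par (A v) (w ∷ Rs) ≡ x v →
              Partial A g x β emb label Ls (v ∷ w ∷ Rs) Ds
insertRight (partial b f d) v e = partial b (e , f) d

relabelling : ∀ {V D : Set} {A : V → V → Bool} {g x β} {emb : D → V} {label label′ Ls Rs Ds} →
              (∀ d → label d ≡ label′ d) → Partial A g x β emb label Ls Rs Ds → Partial A g x β emb label′ Ls Rs Ds
relabelling h (partial b f d) = partial b f (Deferred-cong (λ d → cong (_xor _) (h d)) _ d)

module _ {n} (α : Arrival n) (h : Seq n) where

  arrive : ∀ {D : Set} {β} {emb : D → Fin n} {label Ls Rs Ds} →
           Partial (adj (graph h)) (lookup (gs h)) (lookup (xs h)) β emb label Ls Rs Ds →
           Partial (adj (graph (α ◃ h))) (lookup (gs (α ◃ h))) (lookup (xs (α ◃ h))) β (suc ∘ emb) label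
             (List.map suc Ls) (List.map suc Rs) Ds
  arrive {emb = emb} {label} {Ls} {Rs} {Ds} (partial b f d) = partial
    (Back-map (adj (graph (α ◃ h))) (lookup (gs (α ◃ h))) suc Ls b)
    (Forth-map (adj (graph (α ◃ h))) (lookup (xs (α ◃ h))) _ suc Rs f)
    (Deferred-cong (λ d → cong (label d xor_) (sym (par-map (adj (graph (α ◃ h)) (suc (emb d))) suc Ls))) Ds d)

record Layout {n p} (β : Bool) (h : Seq (n ℕ.+ p)) (s : State n p) (Ls Rs : List (Fin (n ℕ.+ p))) (Ds : List (Fin p)) : Set where
  constructor layout
  i : Shape p
  i = proj₁ s
  σ : Vec Bool n
  σ = proj₁ (proj₂ s)
  field
    complete : Ls List.++ (List.map (n ↑ʳ_) Ds List.++ Rs) ↭ verts (n ℕ.+ p)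
    left     : ∀ S → dot S (full i σ true) ≡ par (lookup S) Ls
    right    : ∀ S → dot S (full i σ false) ≡ par (lookup S) Rs
    parts    : Partial (adj (graph h)) (lookup (gs h)) (lookup (xs h)) β (n ↑ʳ_) (lookup (proj₂ (proj₂ s))) Ls Rs Ds

-- R has to be nonempty: its last vertex, the last but one of the whole ordering, is exempt from the
-- parity condition and carries β instead. Every later vertex of R is inserted in front of it.
Realised : ∀ {n p} → Bool → Seq (n ℕ.+ p) → State n p → Set
Realised β h s = ∃[ Ls ] ∃[ v ] ∃[ Rs ] ∃[ Ds ] Layout β h s Ls (v ∷ Rs) Ds

insert-↭ : ∀ {V : Set} (as bs : List V) v cs → as List.++ (bs List.++ (v ∷ cs)) ↭ v ∷ (as List.++ (bs List.++ cs))
insert-↭ as bs v cs = ↭-trans (Perm.++⁺ˡ as (Perm.shift v bs cs)) (Perm.shift v as (bs List.++ cs))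

xor-swap : ∀ a b c → a xor (b xor c) ≡ b xor (a xor c)
xor-swap a b c = trans (sym (Bool.xor-assoc a b c)) (trans (cong (_xor c) (Bool.xor-comm a b)) (Bool.xor-assoc b a c))

lookup-⊕ : ∀ {p} (r l : Vec Bool p) d → lookup (r ⊕ l) d ≡ lookup l d xor lookup r d
lookup-⊕ r l d = trans (Vec.lookup-zipWith _xor_ d r l) (Bool.xor-comm (lookup r d) (lookup l d))

xor-false : ∀ {a b} → a xor b ≡ false → b ≡ a
xor-false {true}  {true}  _ = refl
xor-false {false} {false} _ = refl

-- A single arrival after which all vertices are old.
module Single {p} (β : Bool) (α : Arrival p) (h : Seq p) {i : Shape p} {l : Vec Bool p} {Ls Rs : List (Fin p)} {Ds : List (Fin p)}
              (lay : Layout {0} β h (i , [] , l) Ls Rs Ds) where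

  open Layout lay hiding (i; σ)

  S : Vec Bool p
  S = proj₁ α

  map-id : List.map (0 ↑ʳ_) Ds ≡ Ds
  map-id = List.map-id Ds

  reindex : ∀ {label : Fin p → Bool} {label′ : Fin (suc p) → Bool} {Ls′ Rs′} → (∀ d → label d ≡ label′ (suc d)) →
    Partial (adj (graph (α ◃ h))) (lookup (gs (α ◃ h))) (lookup (xs (α ◃ h))) β suc label Ls′ Rs′ Ds →
    Partial (adj (graph (α ◃ h))) (lookup (gs (α ◃ h))) (lookup (xs (α ◃ h))) β (0 ↑ʳ_) label′ Ls′ Rs′ (List.map suc Ds)
  reindex eq (partial b f d) = partial b f (Deferred-map _ _ _ _ suc Ds (Deferred-cong (λ d → cong (_xor _) (eq d)) Ds d))

  moved : List.map suc Ls List.++ (List.map suc Ds List.++ List.map suc Rs) ↭ List.map suc (verts p)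
  moved = ↭-trans (↭-reflexive (trans (cong (List.map Fin.suc Ls List.++_) (sym (List.map-++ Fin.suc Ds Rs))) (sym (List.map-++ Fin.suc Ls (Ds List.++ Rs)))))
    (Perm.map⁺ suc (↭-trans (↭-reflexive (cong (λ z → Ls List.++ (z List.++ Rs)) (sym map-id))) complete))

  moved′ : ∀ Es → List.map suc Ls List.++ (List.map (0 ↑ʳ_) Es List.++ List.map suc Rs) ≡ List.map suc Ls List.++ (Es List.++ List.map suc Rs)
  moved′ Es = cong (λ z → List.map suc Ls List.++ (z List.++ List.map suc Rs)) (List.map-id Es)

  skip : ∀ vs {v} (S′ : Vec Bool (suc p)) (f : Vec Bool p) → (∀ S → dot S f ≡ par (lookup S) vs) →
         dot S′ (v ∷ f) ≡ (lookup S′ zero ∧ v) xor par (lookup S′) (List.map suc vs)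
  skip vs {v} (a ∷ S′) f eq = cong ((a ∧ v) xor_) (trans (eq S′) (sym (par-map (lookup (a ∷ S′)) suc vs)))

  skip-false : ∀ vs (S′ : Vec Bool (suc p)) (f : Vec Bool p) → (∀ S → dot S f ≡ par (lookup S) vs) →
               dot S′ (false ∷ f) ≡ par (lookup S′) (List.map suc vs)
  skip-false vs S′ f eq = trans (skip vs S′ f eq) (cong (_xor par (lookup S′) (List.map suc vs)) (Bool.∧-zeroʳ (lookup S′ zero)))

  skip-true : ∀ vs (S′ : Vec Bool (suc p)) (f : Vec Bool p) → (∀ S → dot S f ≡ par (lookup S) vs) →
              dot S′ (true ∷ f) ≡ par (lookup S′) (zero ∷ List.map suc vs)
  skip-true vs S′ f eq = trans (skip vs S′ f eq) (cong (_xor par (lookup S′) (List.map suc vs)) (Bool.∧-identityʳ (lookup S′ zero)))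

  edges : ∀ vs → par (adj (graph (α ◃ h)) zero) (List.map suc vs) ≡ par (lookup S) vs
  edges vs = par-map (adj (graph (α ◃ h)) zero) suc vs

  deferral : Layout {0} β (α ◃ h) (defer i , [] , val α i true ∷ (S ⊕ l)) (List.map suc Ls) (List.map suc Rs) (zero ∷ List.map suc Ds)
  deferral = layout
    (↭-trans (↭-reflexive (moved′ (zero ∷ List.map suc Ds))) (↭-trans (Perm.shift zero (List.map suc Ls) _) (↭-prep zero moved)))
    (λ S′ → skip-false Ls S′ (i true) left) (λ S′ → skip-false Rs S′ (i false) right)
    (partial back forth
      ( trans (cong (val α i true xor_) (trans (edges Ls) (sym (left S)))) (trans (Bool.xor-assoc (key α true) _ _)
          (trans (cong (key α true xor_) (Bool.xor-same (dot S (i true)))) (Bool.xor-identityʳ _)))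
      , Deferred-map _ _ _ _ suc Ds (Deferred-cong (λ d → sym (trans (cong (_xor _) (lookup-⊕ S l d))
          (trans (Bool.xor-assoc (lookup l d) (lookup S d) _) (cong (lookup l d xor_)
            (trans (cong (lookup S d xor_) (Bool.xor-comm _ (lookup S d))) (xor-cancelˡ (lookup S d) _)))))) Ds deferred)))
    where
    open Partial (arrive α h parts)

  placeLeft : val α i true ≡ false →
              Layout {0} β (α ◃ h) (place true i , [] , false ∷ (S ⊕ l)) (zero ∷ List.map suc Ls) (List.map suc Rs) (List.map suc Ds)
  placeLeft f = layout
    (↭-trans (↭-reflexive (cong (zero ∷_) (moved′ (List.map suc Ds)))) (↭-prep zero moved))
    (λ S′ → skip-true Ls S′ (i true) left) (λ S′ → skip-false Rs S′ (i false) right)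
    (reindex (λ d → sym (lookup-⊕ S l d))
      (insertLeft (arrive α h parts) zero (trans (edges Ls) (trans (sym (left S)) (xor-false {key α true} f)))))

  placeRight : ∀ {v Rs′} → Rs ≡ v ∷ Rs′ → val α i false ≡ false →
               Layout {0} β (α ◃ h) (place false i , [] , false ∷ l) (List.map suc Ls) (zero ∷ List.map suc Rs) (List.map suc Ds)
  placeRight {v} {Rs′} refl b = layout
    (↭-trans (insert-↭ (List.map suc Ls) (List.map (0 ↑ʳ_) (List.map suc Ds)) zero (List.map suc (v ∷ Rs′)))
      (↭-prep zero (↭-trans (↭-reflexive (moved′ (List.map suc Ds))) moved)))
    (λ S′ → skip-false Ls S′ (i true) left) (λ S′ → skip-true (v ∷ Rs′) S′ (i false) right)
    (reindex (λ d → refl)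
      (insertRight (arrive α h parts) zero (trans (edges (v ∷ Rs′)) (trans (sym (right S)) (xor-false {key α false} b)))))

  placeFirst : Rs ≡ [] → proj₂ (proj₂ α) ≡ β →
               Layout {0} β (α ◃ h) (place false i , [] , false ∷ l) (List.map suc Ls) (zero ∷ []) (List.map suc Ds)
  placeFirst refl x≡β = layout
    (↭-trans (insert-↭ (List.map suc Ls) (List.map (0 ↑ʳ_) (List.map suc Ds)) zero [])
      (↭-prep zero (↭-trans (↭-reflexive (moved′ (List.map suc Ds))) moved)))
    (λ S′ → skip-false Ls S′ (i true) left) (λ S′ → skip-true [] S′ (i false) right)
    (reindex (λ d → refl) (partial back x≡β deferred))
    where
    open Partial (arrive α h parts)

olderSeq : ∀ n {p} → Seq (n ℕ.+ p) → Seq p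
olderSeq zero    h       = h
olderSeq (suc n) (_ ◃ h) = olderSeq n h

initial-layout : ∀ {p} β (h : Seq p) →
  (found β h ≡ false × (∃[ Ls ] ∃[ Ds ] Layout {0} β h (asState (initial β h)) Ls [] Ds)) ⊎
  (found β h ≡ true × Realised {0} β h (asState (initial β h)))
initial-layout β ⟨⟩ = inj₁ (refl , [] , [] , layout ↭-refl (λ { [] → refl }) (λ { [] → refl }) (partial tt tt tt))
initial-layout β (α@(S , g , x) ◃ h) with initial-layout β h
initial-layout β (α@(S , g , x) ◃ h) | inj₂ (eq , Ls , v , Rs , Ds , lay) rewrite eq = inj₂ (refl , _ , _ , _ , _ , Single.deferral β α h lay)
initial-layout β (α@(S , g , x) ◃ h) | inj₁ (eq , Ls , Ds , lay) rewrite eq with x xor β in e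
... | true  = inj₁ (refl , _ , _ , Single.deferral β α h lay)
... | false = inj₂ (refl , _ , _ , _ , _ , Single.placeFirst β α h lay refl (sym (xor-false e)))

branch-realised : ∀ {p} β (α : Arrival p) (h : Seq p) u → Realised {0} β h (asState u) →
                  All (λ u → Realised {0} β (α ◃ h) (asState u)) (branch α u)
branch-realised β α h u@(i , l) (Ls , v , Rs , Ds , lay) with val α i true in f | val α i false in b
... | true  | _     = subst (λ z → Realised {0} β (α ◃ h) (defer i , [] , z ∷ (proj₁ α ⊕ l))) f (_ , _ , _ , _ , Single.deferral β α h lay) ∷ []
... | false | true  = subst (λ z → Realised {0} β (α ◃ h) (defer i , [] , z ∷ (proj₁ α ⊕ l))) f (_ , _ , _ , _ , Single.deferral β α h lay) ∷ []
... | false | false = (_ , _ , _ , _ , Single.placeLeft β α h lay f) ∷ (_ , _ , _ , _ , Single.placeRight β α h lay refl b) ∷ []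

units-realised : ∀ m {p} β (h : Seq (m ℕ.+ p)) → found β (olderSeq m h) ≡ true →
                 All (λ u → Realised {0} β h (asState u)) (units m β h)
units-realised zero    β h eq with initial-layout β h
... | inj₁ (eq′ , _) = case trans (sym eq) eq′ of λ ()
... | inj₂ (_ , r)   = r ∷ []
units-realised (suc m) β (α ◃ h) eq = All.concat⁺ (All.map⁺ (All.map (λ {u} → branch-realised β α h u) (units-realised m β h eq)))

xor-≡ : ∀ {g d a} → g xor d ≡ a → a xor d ≡ g
xor-≡ {true}  {true}  refl = refl
xor-≡ {true}  {false} refl = refl
xor-≡ {false} {true}  refl = refl
xor-≡ {false} {false} refl = refl

-- The two orders in which an adjacent pair may go to the same side.
admissible-same : ∀ a s u v → weight a (s , s) u v ≢ 0ℚ → (u ≡ false × v ≡ a) ⊎ (v ≡ false × u ≡ a)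
admissible-same false s     false false _ = inj₁ (refl , refl)
admissible-same false s     true  v     h = ⊥-elim (h refl)
admissible-same false s     false true  h = ⊥-elim (h refl)
admissible-same true  s     false true  _ = inj₁ (refl , refl)
admissible-same true  s     true  false _ = inj₂ (refl , refl)
admissible-same true  true  false false h = ⊥-elim (h refl)
admissible-same true  true  true  true  h = ⊥-elim (h refl)
admissible-same true  false false false h = ⊥-elim (h refl)
admissible-same true  false true  true  h = ⊥-elim (h refl)

admissible-distinct : ∀ a s u v → weight a (s , not s) u v ≢ 0ℚ → u ≡ false × v ≡ false
admissible-distinct a     s     false false _ = refl , refl
admissible-distinct false s     true  v     h = ⊥-elim (h refl)
admissible-distinct false s     false true  h = ⊥-elim (h refl)
admissible-distinct true  true  true  v     h = ⊥-elim (h refl)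
admissible-distinct true  true  false true  h = ⊥-elim (h refl)
admissible-distinct true  false true  v     h = ⊥-elim (h refl)
admissible-distinct true  false false true  h = ⊥-elim (h refl)

lookup-relabel : ∀ {p} s (r l : Vec Bool p) d → lookup (relabel s r l) d ≡ lookup l d xor (s ∧ lookup r d)
lookup-relabel true  r l d = lookup-⊕ r l d
lookup-relabel false r l d = sym (Bool.xor-identityʳ (lookup l d))

lookup-older : ∀ n {p} (w : Vec Bool (n ℕ.+ p)) d → lookup (older n w) d ≡ lookup w (n ↑ʳ d)
lookup-older zero    w       d = refl
lookup-older (suc n) (_ ∷ w) d = lookup-older n w d

-- Here `q` is the older vertex of the pair and `q′` the newer one. When both join one side,
-- whichever is inserted second also sees the first, so its bit must equal `a` instead of `false`.
module PairStep {n p} (β : Bool) (α : Arrival (n ℕ.+ p)) (a : Bool) (α′ : Arrival (n ℕ.+ p)) (h : Seq (n ℕ.+ p))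
                {i : Shape p} {σ : Vec Bool n} {l : Vec Bool p} {Ls v Rs Ds} (lay : Layout β h (i , σ , l) Ls (v ∷ Rs) Ds) where

  open Layout lay hiding (i; σ)

  S S′ : Vec Bool (n ℕ.+ p)
  S  = proj₁ α
  S′ = proj₁ α′

  h₂ : Seq (suc (suc (n ℕ.+ p)))
  h₂ = (a ∷ S′ , proj₂ α′) ◃ α ◃ h

  V₂ : Set
  V₂ = Fin (suc (suc (n ℕ.+ p)))

  A₂ : V₂ → V₂ → Bool
  A₂ = adj (graph h₂)

  q q′ : V₂
  q  = suc zero
  q′ = zero

  up² : List (Fin (n ℕ.+ p)) → List V₂
  up² vs = List.map suc (List.map suc vs)

  L₂ R₂ : List V₂
  L₂ = up² Ls
  R₂ = up² (v ∷ Rs)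

  emb₂ : Fin p → V₂
  emb₂ = suc (suc n) ↑ʳ_

  par-up² : ∀ (f : V₂ → Bool) vs → par f (up² vs) ≡ par (λ v → f (suc (suc v))) vs
  par-up² f vs = trans (par-map f suc (List.map suc vs)) (par-map (f ∘ suc) suc vs)

  complete₂ : L₂ List.++ (List.map emb₂ Ds List.++ R₂) ↭ up² (verts (n ℕ.+ p))
  complete₂ = ↭-trans (↭-reflexive (sym expand)) (Perm.map⁺ suc (Perm.map⁺ suc complete))
    where
    M : List (Fin (n ℕ.+ p))
    M = List.map (n ↑ʳ_) Ds
    up²-++ : ∀ us vs → up² (us List.++ vs) ≡ up² us List.++ up² vs
    up²-++ us vs = trans (cong (List.map Fin.suc) (List.map-++ Fin.suc us vs)) (List.map-++ Fin.suc (List.map Fin.suc us) (List.map Fin.suc vs))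
    expand : up² (Ls List.++ (M List.++ (v ∷ Rs))) ≡ L₂ List.++ (List.map emb₂ Ds List.++ R₂)
    expand = trans (up²-++ Ls _) (cong (L₂ List.++_) (trans (up²-++ M _)
      (cong (List._++ R₂) (trans (cong (List.map Fin.suc) (sym (List.map-∘ {g = Fin.suc} {f = n ↑ʳ_} Ds))) (sym (List.map-∘ {g = Fin.suc} Ds))))))

  left-q : ∀ {k} → k xor dot S (full i σ true) ≡ false → par (A₂ q) L₂ ≡ k
  left-q {k} e = trans (par-up² (A₂ q) Ls) (trans (sym (left S)) (xor-false e))

  left-q′ : ∀ {k} → k xor dot S′ (full i σ true) ≡ false → par (A₂ q′) L₂ ≡ k
  left-q′ {k} e = trans (par-up² (A₂ q′) Ls) (trans (sym (left S′)) (xor-false e))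

  right-q : ∀ {k} → k xor dot S (full i σ false) ≡ false → par (A₂ q) R₂ ≡ k
  right-q {k} e = trans (par-up² (A₂ q) (v ∷ Rs)) (trans (sym (right S)) (xor-false e))

  right-q′ : ∀ {k} → k xor dot S′ (full i σ false) ≡ false → par (A₂ q′) R₂ ≡ k
  right-q′ {k} e = trans (par-up² (A₂ q′) (v ∷ Rs)) (trans (sym (right S′)) (xor-false e))

  left-qq′ : ∀ {k} → k xor dot S (full i σ true) ≡ a → par (A₂ q) (q′ ∷ L₂) ≡ k
  left-qq′ {k} e = trans (cong (a xor_) (trans (par-up² (A₂ q) Ls) (sym (left S)))) (xor-≡ {k} e)

  left-q′q : ∀ {k} → k xor dot S′ (full i σ true) ≡ a → par (A₂ q′) (q ∷ L₂) ≡ k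
  left-q′q {k} e = trans (cong (a xor_) (trans (par-up² (A₂ q′) Ls) (sym (left S′)))) (xor-≡ {k} e)

  right-qq′ : ∀ {k} → k xor dot S (full i σ false) ≡ a → par (A₂ q) (q′ ∷ R₂) ≡ k
  right-qq′ {k} e = trans (cong (a xor_) (trans (par-up² (A₂ q) (v ∷ Rs)) (sym (right S)))) (xor-≡ {k} e)

  right-q′q : ∀ {k} → k xor dot S′ (full i σ false) ≡ a → par (A₂ q′) (q ∷ R₂) ≡ k
  right-q′q {k} e = trans (cong (a xor_) (trans (par-up² (A₂ q′) (v ∷ Rs)) (sym (right S′)))) (xor-≡ {k} e)

  parts₂ : Partial A₂ (lookup (gs h₂)) (lookup (xs h₂)) β emb₂ (lookup l) L₂ R₂ Ds
  parts₂ = arrive (a ∷ S′ , proj₂ α′) (α ◃ h) (arrive α h parts)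

  ω : Pairing (n ℕ.+ p)
  ω = a , α , α′

  labels : ∀ c d → lookup (newLabels n ω c l) d ≡ (lookup l d xor (proj₁ c ∧ A₂ (emb₂ d) q)) xor (proj₂ c ∧ A₂ (emb₂ d) q′)
  labels (s₁ , s₂) d = trans (lookup-relabel s₂ (older n S′) (relabel s₁ (older n S) l) d) (cong₂ _xor_
    (trans (lookup-relabel s₁ (older n S) l d) (cong (λ z → lookup l d xor (s₁ ∧ z)) (lookup-older n S d)))
    (cong (s₂ ∧_) (lookup-older n S′ d)))

  dot-up² : ∀ {f vs} → (∀ S → dot S f ≡ par (lookup S) vs) → ∀ s₁ s₂ (w : Vec Bool (suc (suc (n ℕ.+ p)))) →
            dot w (s₂ ∷ s₁ ∷ f) ≡ (lookup w q′ ∧ s₂) xor ((lookup w q ∧ s₁) xor par (lookup w) (up² vs))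
  dot-up² {f} {vs} eq s₁ s₂ (y ∷ x ∷ w) = cong (λ z → (y ∧ s₂) xor ((x ∧ s₁) xor z)) (trans (eq w) (sym (par-up² (lookup (y ∷ x ∷ w)) vs)))

  on : ∀ x y → (x ∧ true) xor y ≡ x xor y
  on x y = cong (_xor y) (Bool.∧-identityʳ x)

  off : ∀ x y → (x ∧ false) xor y ≡ y
  off x y = cong (_xor y) (Bool.∧-zeroʳ x)

  Result : Sides → Set
  Result c = Realised {suc (suc n)} β h₂ (i , extend c σ , newLabels n ω c l)

  realise : ∀ c {Ls′ w Rs′} →
    Ls′ List.++ (List.map emb₂ Ds List.++ (w ∷ Rs′)) ↭ q′ ∷ q ∷ up² (verts (n ℕ.+ p)) →
    (∀ S → (lookup S q′ ∧ proj₂ c) xor ((lookup S q ∧ proj₁ c) xor par (lookup S) L₂) ≡ par (lookup S) Ls′) →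
    (∀ S → (lookup S q′ ∧ not (proj₂ c)) xor ((lookup S q ∧ not (proj₁ c)) xor par (lookup S) R₂) ≡ par (lookup S) (w ∷ Rs′)) →
    Partial A₂ (lookup (gs h₂)) (lookup (xs h₂)) β emb₂
      (λ d → (lookup l d xor (proj₁ c ∧ A₂ (emb₂ d) q)) xor (proj₂ c ∧ A₂ (emb₂ d) q′)) Ls′ (w ∷ Rs′) Ds →
    Result c
  realise c@(s₁ , s₂) perm left′ right′ part = _ , _ , _ , _ , layout perm
    (λ S → trans (dot-up² {vs = Ls} left s₁ s₂ S) (left′ S))
    (λ S → trans (dot-up² {vs = v ∷ Rs} right (not s₁) (not s₂) S) (right′ S))
    (relabelling (λ d → sym (labels c d)) part)

  xor-false² : ∀ x → (x xor false) xor false ≡ x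
  xor-false² x = trans (Bool.xor-identityʳ _) (Bool.xor-identityʳ x)

  step : ∀ c → chance ω (full i σ) c ≢ 0ℚ → Result c
  step (true , true) nz with admissible-same a true _ _ nz
  ... | inj₁ (u , w) = realise (true , true)
    (↭-prep q′ (↭-prep q complete₂))
    (λ S → trans (on (lookup S q′) _) (cong (lookup S q′ xor_) (on (lookup S q) _)))
    (λ S → trans (off (lookup S q′) _) (off (lookup S q) _))
    (insertLeft (insertLeft parts₂ q (left-q u)) q′ (left-q′q w))
  ... | inj₂ (w , u) = realise (true , true)
    (↭-trans (↭-prep q (↭-prep q′ complete₂)) (↭-swap q q′ ↭-refl))
    (λ S → trans (on (lookup S q′) _) (trans (cong (lookup S q′ xor_) (on (lookup S q) _)) (xor-swap (lookup S q′) (lookup S q) _)))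
    (λ S → trans (off (lookup S q′) _) (off (lookup S q) _))
    (relabelling (λ d → trans (Bool.xor-assoc (lookup l d) _ _) (trans (cong (lookup l d xor_) (Bool.xor-comm (A₂ (emb₂ d) q′) _)) (sym (Bool.xor-assoc (lookup l d) _ _))))
      (insertLeft (insertLeft parts₂ q′ (left-q′ w)) q (left-qq′ u)))
  step (false , false) nz with admissible-same a false _ _ nz
  ... | inj₁ (u , w) = realise (false , false)
    (↭-trans (insert-↭ L₂ (List.map emb₂ Ds) q′ (q ∷ R₂)) (↭-prep q′ (↭-trans (insert-↭ L₂ (List.map emb₂ Ds) q R₂) (↭-prep q complete₂))))
    (λ S → trans (off (lookup S q′) _) (off (lookup S q) _))
    (λ S → trans (on (lookup S q′) _) (cong (lookup S q′ xor_) (on (lookup S q) _)))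
    (relabelling (λ d → sym (xor-false² (lookup l d)))
      (insertRight (insertRight parts₂ q (right-q u)) q′ (right-q′q w)))
  ... | inj₂ (w , u) = realise (false , false)
    (↭-trans (insert-↭ L₂ (List.map emb₂ Ds) q (q′ ∷ R₂)) (↭-trans (↭-prep q (↭-trans (insert-↭ L₂ (List.map emb₂ Ds) q′ R₂) (↭-prep q′ complete₂))) (↭-swap q q′ ↭-refl)))
    (λ S → trans (off (lookup S q′) _) (off (lookup S q) _))
    (λ S → trans (on (lookup S q′) _) (trans (cong (lookup S q′ xor_) (on (lookup S q) _)) (xor-swap (lookup S q′) (lookup S q) _)))
    (relabelling (λ d → sym (xor-false² (lookup l d)))
      (insertRight (insertRight parts₂ q′ (right-q′ w)) q (right-qq′ u)))
  step (true , false) nz with admissible-distinct a true _ _ nz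
  ... | u , w = realise (true , false)
    (↭-trans (↭-prep q (insert-↭ L₂ (List.map emb₂ Ds) q′ R₂)) (↭-trans (↭-swap q q′ ↭-refl) (↭-prep q′ (↭-prep q complete₂))))
    (λ S → trans (off (lookup S q′) _) (on (lookup S q) _))
    (λ S → trans (on (lookup S q′) _) (cong (lookup S q′ xor_) (off (lookup S q) _)))
    (relabelling (λ d → sym (Bool.xor-identityʳ _)) (insertRight (insertLeft parts₂ q (left-q u)) q′ (right-q′ w)))
  step (false , true) nz with admissible-distinct a false _ _ nz
  ... | u , w = realise (false , true)
    (↭-prep q′ (↭-trans (insert-↭ L₂ (List.map emb₂ Ds) q R₂) (↭-prep q complete₂)))
    (λ S → trans (on (lookup S q′) _) (cong (lookup S q′ xor_) (off (lookup S q) _)))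
    (λ S → trans (off (lookup S q′) _) (on (lookup S q) _))
    (relabelling (λ d → cong (_xor A₂ (emb₂ d) q′) (sym (Bool.xor-identityʳ (lookup l d)))) (insertRight (insertLeft parts₂ q′ (left-q′ w)) q (right-q u)))

∑-zero : ∀ {A : Set} {as : List A} {f : A → ℚ} → All (λ a → f a ≡ 0ℚ) as → ∑ as f ≡ 0ℚ
∑-zero []       = refl
∑-zero (h ∷ hs) = cong₂ _+_ h (∑-zero hs)

-- Children of weight 0 contribute nothing, and all others are realised by `PairStep.step`; so a
-- test function that vanishes on the realised states is summed to 0.
population-zero : ∀ k m {p} β (h : Seq (double k ℕ.+ (m ℕ.+ p))) (f : State (double k) (m ℕ.+ p) → ℚ) →
  found β (olderSeq m (olderSeq (double k) h)) ≡ true → (∀ s → Realised β h s → f s ≡ 0ℚ) → ⟦ population k (base m β) h ⟧ f ≡ 0ℚ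
population-zero zero m {p} β h f eq hyp = trans
  (cong (normaliser (m ℕ.+ p) (length (units m β h)) *_) (∑-zero (All.map (λ {u} → hyp (asState u)) (units-realised m β h eq))))
  (ℚ.*-zeroʳ (normaliser (m ℕ.+ p) (length (units m β h))))
population-zero (suc k) m {p} β ((a ∷ S′ , k′) ◃ α ◃ h) f eq hyp = population-zero k m β h _ eq
  (λ (i , σ , l) (Ls , v , Rs , Ds , lay) → trans
    (𝔼-cong sides (λ c → case chance (a , α , (S′ , k′)) (full i σ) c ℚ.≟ 0ℚ of λ where
      (yes z)  → trans (cong (_* f (i , extend c σ , newLabels (double k) (a , α , (S′ , k′)) c l)) z)
        (ℚ.*-zeroˡ (f (i , extend c σ , newLabels (double k) (a , α , (S′ , k′)) c l)))
      (no nz) → trans (cong (chance (a , α , (S′ , k′)) (full i σ) c *_) (hyp _ (PairStep.step β α a (S′ , k′) h lay c nz)))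
        (ℚ.*-zeroʳ (chance (a , α , (S′ , k′)) (full i σ) c))))
    (𝔼-const sides 0ℚ))

-- Edge parity and the assembled ordering

par-↭ : ∀ {V : Set} (f : V → Bool) {us vs} → us ↭ vs → par f us ≡ par f vs
par-↭ f Perm.refl         = refl
par-↭ f (Perm.prep v r)   = cong (f v xor_) (par-↭ f r)
par-↭ f (Perm.swap u v r) = trans (xor-swap (f u) (f v) _) (cong (λ z → f v xor (f u xor z)) (par-↭ f r))
par-↭ f (Perm.trans r s)  = trans (par-↭ f r) (par-↭ f s)

edgeParity : ∀ {V : Set} → (V → V → Bool) → List V → Bool
edgeParity A []       = false
edgeParity A (v ∷ vs) = par (A v) vs xor edgeParity A vs

edgeParity-↭ : ∀ {V : Set} (A : V → V → Bool) → (∀ u v → A u v ≡ A v u) → ∀ {us vs} → us ↭ vs → edgeParity A us ≡ edgeParity A vs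
edgeParity-↭ A sm Perm.refl = refl
edgeParity-↭ A sm (Perm.prep v r) = cong₂ _xor_ (par-↭ (A v) r) (edgeParity-↭ A sm r)
edgeParity-↭ A sm (Perm.swap {xs = us} {vs} u v r) = trans
  (cong₂ (λ x y → (x xor par (A u) us) xor (par (A v) us xor y)) (sm u v) (edgeParity-↭ A sm r))
  (trans (regroup (A v u) (par (A u) us) (par (A v) us) (edgeParity A vs))
    (cong₂ (λ x y → (A v u xor x) xor (y xor edgeParity A vs)) (par-↭ (A v) r) (par-↭ (A u) r)))
  where
  regroup : ∀ a b c d → (a xor b) xor (c xor d) ≡ (a xor c) xor (b xor d)
  regroup = xor-interchange
edgeParity-↭ A sm (Perm.trans r s) = trans (edgeParity-↭ A sm r) (edgeParity-↭ A sm s)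

EvenOrder : ∀ {V : Set} → (V → V → Bool) → List V → Set
EvenOrder A []               = ⊤
EvenOrder A (v ∷ [])         = ⊤
EvenOrder A (v ∷ w ∷ [])     = ⊤
EvenOrder A (v ∷ w ∷ u ∷ vs) = par (A v) (w ∷ u ∷ vs) ≡ false × EvenOrder A (w ∷ u ∷ vs)

EvenPrefix : ∀ {V : Set} → (V → V → Bool) → List V → List V → Set
EvenPrefix A []       rest = ⊤
EvenPrefix A (u ∷ us) rest = par (A u) (us List.++ rest) ≡ false × EvenPrefix A us rest

prefix-order : ∀ {V : Set} (A : V → V → Bool) us r s rest → EvenPrefix A us (r ∷ s ∷ rest) → EvenOrder A (r ∷ s ∷ rest) →
               EvenOrder A (us List.++ (r ∷ s ∷ rest))
prefix-order A []            r s rest _             o = o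
prefix-order A (u ∷ [])      r s rest (e , _)       o = e , o
prefix-order A (u ∷ w ∷ [])  r s rest (e , e′ , _)  o = e , e′ , o
prefix-order A (u ∷ w ∷ x ∷ us) r s rest (e , es)   o = e , prefix-order A (w ∷ x ∷ us) r s rest es o

prefix-parity : ∀ {V : Set} (A : V → V → Bool) us rest → EvenPrefix A us rest → edgeParity A (us List.++ rest) ≡ edgeParity A rest
prefix-parity A []       rest _        = refl
prefix-parity A (u ∷ us) rest (e , es) = trans (cong (_xor edgeParity A (us List.++ rest)) e) (prefix-parity A us rest es)

-- The forward parity of a vertex is its total parity minus its backward parity, and with labels 0
-- the deferred condition says that these two agree. The vertex itself does not count, as `A v v` is
-- `false`.
complement : ∀ {V : Set} (A : V → V → Bool) (total b : V → Bool) → (∀ v → A v v ≡ false) → ∀ us rest →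
             (∀ v → total v ≡ b v xor par (A v) (us List.++ rest)) → Deferred A total (λ _ → false) b us → EvenPrefix A us rest
complement A total b ir []       rest eq _       = tt
complement A total b ir (u ∷ us) rest eq (e , d) =
  trans (sym (xor-cancelˡ (b u) _)) (trans (cong (b u xor_) (trans (cong (λ z → b u xor (z xor par (A u) (us List.++ rest))) (sym (ir u))) (trans (sym (eq u)) (sym e)))) (Bool.xor-same (b u))) ,
  complement A total (λ v → b v xor A v u) ir us rest (λ v → trans (eq v) (sym (Bool.xor-assoc (b v) (A v u) _))) d

revAppend : ∀ {V : Set} → List V → List V → List V
revAppend []       ds = ds
revAppend (v ∷ vs) ds = revAppend vs (v ∷ ds)

revAppend-↭ : ∀ {V : Set} (vs ds : List V) → revAppend vs ds ↭ vs List.++ ds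
revAppend-↭ []       ds = ↭-refl
revAppend-↭ (v ∷ vs) ds = ↭-trans (revAppend-↭ vs (v ∷ ds)) (Perm.shift v vs ds)

-- L is stored newest first but stands oldest first in the ordering. After reversal its condition
-- has the form of the deferred one with labels 0, so L and D merge into one prefix.
back-deferred : ∀ {V : Set} (A : V → V → Bool) (g : V → Bool) vs ds → Back A g vs →
                Deferred A g (λ _ → false) (λ v → par (A v) vs) ds → Deferred A g (λ _ → false) (λ _ → false) (revAppend vs ds)
back-deferred A g []       ds _       d = d
back-deferred A g (v ∷ vs) ds (e , b) d = back-deferred A g vs (v ∷ ds) b (e , Deferred-cong (λ u → Bool.xor-comm (A u v) _) ds d)

vpar : ∀ {n} → Vec Bool n → Bool
vpar []      = false
vpar (b ∷ S) = b xor vpar S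

vpar-even : ∀ {n} (S : Vec Bool n) → if vpar S then 2 ∣ suc (∣ S ∣) else 2 ∣ (∣ S ∣)
vpar-even []          = 2 ∣0
vpar-even (true ∷ S)  with vpar S | vpar-even S
... | true  | h = h
... | false | h = ∣m∣n⇒∣m+n {2} {2} ∣-refl h
vpar-even (false ∷ S) = vpar-even S

vpar-false : ∀ {n} (S : Vec Bool n) → vpar S ≡ false → 2 ∣ (∣ S ∣)
vpar-false S e = subst (λ b → if b then 2 ∣ suc (∣ S ∣) else 2 ∣ (∣ S ∣)) e (vpar-even S)

vpar-true : ∀ {n} (S : Vec Bool n) → vpar S ≡ true → ¬ 2 ∣ (∣ S ∣)
vpar-true S e h = case ∣1⇒≡1 (∣m+n∣m⇒∣n (subst (2 ∣_) (ℕ.+-comm 1 ∣ S ∣) odd) h) of λ ()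
  where
  odd : 2 ∣ suc (∣ S ∣)
  odd = subst (λ b → if b then 2 ∣ suc (∣ S ∣) else 2 ∣ (∣ S ∣)) e (vpar-even S)

vpar-tabulate : ∀ {n} {V : Set} (f : V → Bool) (v : Fin n → V) → vpar (tabulate (f ∘ v)) ≡ par f (List.tabulate v)
vpar-tabulate {zero}  f v = refl
vpar-tabulate {suc n} f v = cong (f (v zero) xor_) (vpar-tabulate f (v ∘ suc))

later : ∀ {n} {V : Set} → (V → V → Bool) → (Fin n → V) → Fin n → Vec Bool n
later A v i = tabulate λ j → does (i Fin.<? j) ∧ A (v i) (v j)

vpar-later : ∀ {n} {V : Set} (A : V → V → Bool) (v : Fin n → V) → EvenOrder A (List.tabulate v) →
             ∀ i → suc (toℕ i) ≤ n ℕ.∸ 2 → vpar (later A v i) ≡ false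
vpar-later {suc (suc (suc n))} A v (e , o) zero    _             = trans (vpar-tabulate (A (v zero)) (v ∘ suc)) e
vpar-later {suc (suc (suc (suc n)))} A v (e , o) (suc i) (ℕ.s≤s p) = vpar-later A (v ∘ suc) o i p
vpar-later {suc (suc (suc zero))} A v (e , o) (suc i) (ℕ.s≤s ())

verts-allFin : ∀ n → verts n ≡ List.tabulate {n = n} (λ i → i)
verts-allFin zero    = refl
verts-allFin (suc n) = cong (zero ∷_) (trans (cong (List.map suc) (verts-allFin n)) (List.map-tabulate (λ i → i) suc))

tabulate-cast : ∀ {V : Set} (us : List V) {n} (e : n ≡ length us) → List.tabulate (λ i → List.lookup us (Fin.cast e i)) ≡ us
tabulate-cast us refl = trans (List.tabulate-cong (λ i → cong (List.lookup us) (Fin.cast-is-id refl i))) (List.tabulate-lookup us)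

lookup-tabulate-cast : ∀ {n} {V : Set} (f : Fin n → V) i (e : length (List.tabulate f) ≡ n) → List.lookup (List.tabulate f) i ≡ f (Fin.cast e i)
lookup-tabulate-cast {suc n} f zero    e = refl
lookup-tabulate-cast {suc n} f (suc i) e = lookup-tabulate-cast (f ∘ suc) i (ℕ.suc-injective e)

evenOrder⇒evenDegenerate : ∀ {n} (G : Graph n) (ord : List (Fin n)) → ord ↭ verts n → EvenOrder (adj G) ord → EvenDegenerate G
evenOrder⇒evenDegenerate {n} G ord perm o = π , λ i p → vpar-false (later (adj G) (π ⟨$⟩ʳ_) i) (subst (λ S → vpar S ≡ false)
  (Vec.tabulate-cong (λ j → cong₂ (λ u w → does (i Fin.<? j) ∧ adj G u w) (sym (π-lookup i)) (sym (π-lookup j))))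
  (vpar-later (adj G) v (subst (EvenOrder (adj G)) (sym (tabulate-cast ord len)) o) i p))
  where
  perm′ : ord ↭ List.tabulate {n = n} (λ i → i)
  perm′ = subst (ord ↭_) (verts-allFin n) perm
  len′ : length (List.tabulate {n = n} (λ i → i)) ≡ n
  len′ = List.length-tabulate (λ i → i)
  len : n ≡ length ord
  len = sym (trans (Perm.↭-length perm′) len′)
  v : Fin n → Fin n
  v i = List.lookup ord (Fin.cast len i)
  π : Permutation′ n
  π = cast-id len ∘ₚ (onIndices (Perm.↭⇒↭ₛ perm′) ∘ₚ cast-id len′)
  π-lookup : ∀ i → π ⟨$⟩ʳ i ≡ v i
  π-lookup i = sym (trans (onIndices-lookup (setoid (Fin n)) (Perm.↭⇒↭ₛ perm′) (Fin.cast len i)) (lookup-tabulate-cast (λ i → i) _ len′))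

degrees : ∀ {n} → Graph n → Vec Bool n
degrees {n} H = tabulate (λ v → par (adj H v) (verts n))

-- The graph that consists of the arrivals, of the vertex 1 whose row is xs,
-- and of the vertex 0 whose row is chosen such that the degrees of the
-- arrivals have the parities gs; t tells whether 0 and 1 are adjacent.
whole : ∀ {n} → Bool → Seq n → Graph (suc (suc n))
whole t h = (t ∷ (gs h ⊕ (xs h ⊕ degrees (graph h)))) ▹ (xs h ▹ graph h)

hit≢0 : ∀ {p} (l : Vec Bool p) → hit l ≢ 0ℚ → ∀ d → lookup l d ≡ false
hit≢0 (true ∷ l)  h d       = ⊥-elim (h refl)
hit≢0 (false ∷ l) h zero    = refl
hit≢0 (false ∷ l) h (suc d) = hit≢0 l h d

module Success {n p} (t β : Bool) (h : Seq (n ℕ.+ p)) {i : Shape p} {σ : Vec Bool n} {l : Vec Bool p} {Ls v Rs Ds}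
               (lay : Layout β h (i , σ , l) Ls (v ∷ Rs) Ds) (zero-labels : ∀ d → lookup l d ≡ false)
               (parity : edgeParity (adj (whole t h)) (verts (suc (suc (n ℕ.+ p)))) ≡ β) where

  open Layout lay hiding (i; σ)
  open Partial parts

  N : ℕ
  N = n ℕ.+ p

  H : Graph N
  H = graph h

  G : Graph (suc (suc N))
  G = whole t h

  A : Fin (suc (suc N)) → Fin (suc (suc N)) → Bool
  A = adj G

  ss : Fin N → Fin (suc (suc N))
  ss v = suc (suc v)

  total : Fin (suc (suc N)) → Bool
  total u = par (A u) (verts (suc (suc N)))

  par-ss : ∀ (f : Fin (suc (suc N)) → Bool) vs → par f (List.map ss vs) ≡ par (f ∘ ss) vs
  par-ss f vs = par-map f ss vs

  verts-ss : verts (suc (suc N)) ≡ zero ∷ suc zero ∷ List.map ss (verts N)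
  verts-ss = cong (λ z → zero ∷ suc zero ∷ z) (sym (List.map-∘ {g = Fin.suc} {f = Fin.suc} (verts N)))

  total-g : ∀ u → total (ss u) ≡ lookup (gs h) u
  total-g u = begin
    total (ss u)
      ≡⟨ cong (par (A (ss u))) verts-ss ⟩
    lookup (gs h ⊕ (xs h ⊕ degrees H)) u xor (lookup (xs h) u xor par (A (ss u)) (List.map ss (verts N)))
      ≡⟨ cong₂ (λ y z → y xor (lookup (xs h) u xor z))
           (trans (Vec.lookup-zipWith _xor_ u (gs h) _) (cong (lookup (gs h) u xor_) (trans (Vec.lookup-zipWith _xor_ u (xs h) _)
             (cong (lookup (xs h) u xor_) (Vec.lookup∘tabulate _ u)))))
           (par-ss (A (ss u)) (verts N)) ⟩
    (lookup (gs h) u xor D) xor D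
      ≡⟨ trans (Bool.xor-assoc (lookup (gs h) u) D D) (trans (cong (lookup (gs h) u xor_) (Bool.xor-same D)) (Bool.xor-identityʳ _)) ⟩
    lookup (gs h) u ∎
    where
    open ≡-Reasoning
    D : Bool
    D = lookup (xs h) u xor par (adj H u) (verts N)

  front : List (Fin N)
  front = revAppend Ls (List.map (n ↑ʳ_) Ds)

  rest : List (Fin (suc (suc N)))
  rest = List.map ss (v ∷ Rs) List.++ (suc zero ∷ [])

  order : List (Fin (suc (suc N)))
  order = List.map ss front List.++ (zero ∷ rest)

  order-↭ : order ↭ verts (suc (suc N))
  order-↭ = ↭-trans (Perm.shift zero (List.map ss front) rest) (↭-trans (↭-prep zero
    (↭-trans (↭-reflexive (sym (List.++-assoc (List.map ss front) (List.map ss (v ∷ Rs)) (suc zero ∷ []))))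
      (↭-trans (Perm.++-comm _ (suc zero ∷ []))
        (↭-prep (suc zero) (↭-trans (↭-reflexive (sym (List.map-++ ss front (v ∷ Rs))))
          (Perm.map⁺ ss (↭-trans (Perm.++⁺ʳ (v ∷ Rs) (revAppend-↭ Ls _))
            (↭-trans (↭-reflexive (List.++-assoc Ls _ (v ∷ Rs))) complete))))))))
    (↭-reflexive (sym verts-ss)))

  front-deferred : Deferred (adj H) (lookup (gs h)) (λ _ → false) (λ _ → false) front
  front-deferred = back-deferred (adj H) (lookup (gs h)) Ls (List.map (n ↑ʳ_) Ds) back
    (Deferred-map (adj H) (lookup (gs h)) (λ _ → false) (λ v → par (adj H v) Ls) (n ↑ʳ_) Ds
      (Deferred-cong (λ d → cong (_xor par (adj H (n ↑ʳ d)) Ls) (zero-labels d)) Ds deferred))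

  retotal : ∀ ds {b} → Deferred (adj H) (lookup (gs h)) (λ _ → false) b ds → Deferred (adj H) (total ∘ ss) (λ _ → false) b ds
  retotal []       _       = tt
  retotal (d ∷ ds) (e , r) = trans e (sym (total-g d)) , retotal ds r

  even-front : EvenPrefix A (List.map ss front) (zero ∷ rest)
  even-front = complement A total (λ _ → false) (adj-irrefl G) (List.map ss front) (zero ∷ rest)
    (λ v → sym (par-↭ (A v) order-↭))
    (Deferred-map A total (λ _ → false) (λ _ → false) ss front (retotal front front-deferred))

  -- A vertex of R before the last has forward neighbours of parity `x` in R and the bit `x` towards
  -- the vertex 1, which cancel. Only the last vertex of R contributes, by its bit towards the
  -- vertex 1.
  back-parity : ∀ u us → Forth (adj H) (lookup (xs h)) β (u ∷ us) →
                edgeParity A (List.map ss (u ∷ us) List.++ (suc zero ∷ [])) ≡ β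
  even-back : ∀ u us → Forth (adj H) (lookup (xs h)) β (u ∷ us) → EvenOrder A (List.map ss (u ∷ us) List.++ (suc zero ∷ []))

  par-rest : ∀ u us → par (adj H u) us ≡ lookup (xs h) u → par (A (ss u)) (List.map ss us List.++ (suc zero ∷ [])) ≡ false
  par-rest u us e = trans (par-++ (A (ss u)) (List.map ss us) (suc zero ∷ [])) (trans
    (cong₂ _xor_ (trans (par-ss (A (ss u)) us) e) (Bool.xor-identityʳ (lookup (xs h) u))) (Bool.xor-same (lookup (xs h) u)))

  back-parity u []       e       = trans (Bool.xor-identityʳ _) (trans (Bool.xor-identityʳ _) e)
  back-parity u (w ∷ us) (e , f) = cong₂ _xor_ (par-rest u (w ∷ us) e) (back-parity w us f)

  even-back u []            e       = tt
  even-back u (w ∷ [])      (e , f) = par-rest u (w ∷ []) e , tt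
  even-back u (w ∷ x ∷ us)  (e , f) = par-rest u (w ∷ x ∷ us) e , even-back w (x ∷ us) f

  -- The forward degrees of an ordering add up to the number of edges. They are even before the
  -- vertex 0 and sum to β after it, while the number of edges has parity β; so the vertex 0 gets an
  -- even one.
  even-centre : par (A zero) rest ≡ false
  even-centre = trans (sym (xor-cancelˡ β _)) (trans (cong (β xor_) (trans (Bool.xor-comm β _)
    (trans (cong (par (A zero) rest xor_) (sym (back-parity v Rs forth)))
      (trans (sym (prefix-parity A (List.map ss front) (zero ∷ rest) even-front))
        (trans (edgeParity-↭ A (adj-sym G) order-↭) parity))))) (Bool.xor-same β))

  evenDegenerate : EvenDegenerate G
  evenDegenerate = evenOrder⇒evenDegenerate G order order-↭ (close Rs (even-back v Rs forth) even-front even-centre)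
    where
    close : ∀ Rs → EvenOrder A (List.map ss (v ∷ Rs) List.++ (suc zero ∷ [])) →
            EvenPrefix A (List.map ss front) (zero ∷ List.map ss (v ∷ Rs) List.++ (suc zero ∷ [])) →
            par (A zero) (List.map ss (v ∷ Rs) List.++ (suc zero ∷ [])) ≡ false →
            EvenOrder A (List.map ss front List.++ (zero ∷ List.map ss (v ∷ Rs) List.++ (suc zero ∷ [])))
    close []       o f c = prefix-order A (List.map ss front) zero (ss v) _ f (c , o)
    close (w ∷ ws) o f c = prefix-order A (List.map ss front) zero (ss v) _ f (c , o)

-- The failure event

indicator : ∀ {A : Set} → Dec A → ℚ
indicator d = if does d then 1ℚ else 0ℚ

square-nonneg : ∀ z → 0ℚ ≼ z * z
square-nonneg z with ℚ.≤-total 0ℚ z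
... | inj₁ 0≤z = 0≼* 0≤z 0≤z
... | inj₂ z≤0 = subst (0ℚ ≼_) (solve 1 (λ z → (:- z) :* (:- z) := z :* z) refl z) (0≼* (ℚ.neg-antimono-≤ z≤0) (ℚ.neg-antimono-≤ z≤0))

-- Chebyshev's inequality in pointwise form: if the weighted number of successes is 0, the squared
-- deviation from 1 equals 1. The other summand covers the case that no vertex could start R.
failure : ∀ k m {p} → Bool → Seq (double k ℕ.+ (m ℕ.+ p)) → ℚ
failure k m β h = not-found β (olderSeq m (olderSeq (double k) h)) + (successes k m β h - 1ℚ) * (successes k m β h - 1ℚ)

0≼failure : ∀ k m {p} β (h : Seq (double k ℕ.+ (m ℕ.+ p))) → 0ℚ ≼ failure k m β h
0≼failure k m β h = CauchyLemmas.0≤+ (if-elim (0ℚ ≼_) (found β (olderSeq m (olderSeq (double k) h))) ℚ.≤-refl CauchyLemmas.0≤1)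
  (square-nonneg (successes k m β h - 1ℚ))

indicator-≼ : ∀ {A : Set} {k} (d : Dec A) → (A → 1ℚ ≼ k) → 0ℚ ≼ k → indicator d ≼ k
indicator-≼ (yes a) h _   = h a
indicator-≼ (no _)  _ 0≤k = 0≤k

failure-one : ∀ k m {p} t β (h : Seq (double k ℕ.+ (m ℕ.+ p))) → ¬ EvenDegenerate (whole t h) →
              edgeParity (adj (whole t h)) (verts _) ≡ β → 1ℚ ≼ failure k m β h
failure-one k m {p} t β h ¬ed eq = choose (found β (olderSeq m (olderSeq (double k) h))) refl
  where
  Y : ℚ
  Y = (successes k m β h - 1ℚ) * (successes k m β h - 1ℚ)
  choose : ∀ b → found β (olderSeq m (olderSeq (double k) h)) ≡ b → 1ℚ ≼ (if found β (olderSeq m (olderSeq (double k) h)) then 0ℚ else 1ℚ) + Y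
  choose false fd = subst (λ b → 1ℚ ≼ (if b then 0ℚ else 1ℚ) + Y) (sym fd) (p≼p+q (square-nonneg (successes k m β h - 1ℚ)))
  choose true  fd = subst (λ b → 1ℚ ≼ (if b then 0ℚ else 1ℚ) + Y) (sym fd)
    (ℚ.≤-reflexive (sym (trans (ℚ.+-identityˡ Y) (cong (λ z → (z - 1ℚ) * (z - 1ℚ)) none))))
    where
    none : successes k m β h ≡ 0ℚ
    none = population-zero k m β h (λ (i , σ , l) → hit l) fd λ (i , σ , l) (Ls , v , Rs , Ds , lay) → case hit l ℚ.≟ 0ℚ of λ where
      (yes z) → z
      (no nz) → ⊥-elim (¬ed (Success.evenDegenerate t β h lay (hit≢0 l nz) eq))

-- The value β must be fixed before the units are formed, whereas the parity of the edges is known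
-- only from the whole graph. Both values are therefore prepared, at the cost of a factor 2.
failure-bound : ∀ k m {p} t (h : Seq (double k ℕ.+ (m ℕ.+ p))) →
  indicator (¬? (evenDegenerate? (whole t h))) ≼ failure k m true h + failure k m false h
failure-bound k m {p} t h = indicator-≼ (¬? (evenDegenerate? (whole t h)))
  (λ ¬ed → choose ¬ed (edgeParity (adj (whole t h)) (verts _)) refl)
  (CauchyLemmas.0≤+ (0≼failure k m true h) (0≼failure k m false h))
  where
  choose : ¬ EvenDegenerate (whole t h) → ∀ β → edgeParity (adj (whole t h)) (verts _) ≡ β → 1ℚ ≼ failure k m true h + failure k m false h
  choose ¬ed true  eq = ℚ.≤-trans (failure-one k m t true h ¬ed eq) (p≼p+q (0≼failure k m false h))
  choose ¬ed false eq = ℚ.≤-trans (failure-one k m t false h ¬ed eq)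
    (ℚ.≤-trans (p≼p+q (0≼failure k m true h)) (ℚ.≤-reflexive (ℚ.+-comm (failure k m false h) (failure k m true h))))

-- The uniform random graph.

randomGraph : ∀ n → Mean (Graph n)
randomGraph zero    = one ∅
randomGraph (suc n) = push (uncurry _▹_) (bits n ⊗ randomGraph n)

seqs-graph : ∀ n (F : Vec Bool n → Vec Bool n → Graph n → ℚ) →
  𝔼 (seqs n) (λ h → F (gs h) (xs h) (graph h)) ≡ 𝔼 (bits n) (λ g → 𝔼 (bits n) (λ x → 𝔼 (randomGraph n) (F g x)))
seqs-graph zero    F = refl
seqs-graph (suc n) F = begin
  𝔼 (seqs n) (λ h → 𝔼 (arrival n) (λ (S , a , b) → F (a ∷ gs h) (b ∷ xs h) (S ▹ graph h)))
    ≡⟨ seqs-graph n (λ g x H → 𝔼 (arrival n) (λ (S , a , b) → F (a ∷ g) (b ∷ x) (S ▹ H))) ⟩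
  𝔼 (bits n ⊗ bits n ⊗ randomGraph n) (λ (g , x , H) → 𝔼 (arrival n) (λ (S , a , b) → F (a ∷ g) (b ∷ x) (S ▹ H)))
    ≡⟨ 𝔼-swap (bits n ⊗ bits n ⊗ randomGraph n) (arrival n) _ ⟩
  𝔼 (bits n) (λ S → 𝔼 (coin ⊗ coin) (λ (a , b) → 𝔼 (bits n ⊗ bits n) (λ (g , x) → 𝔼 (randomGraph n) (λ H → F (a ∷ g) (b ∷ x) (S ▹ H)))))
    ≡⟨ 𝔼-swap (bits n) (coin ⊗ coin) _ ⟩
  𝔼 (coin ⊗ coin) (λ (a , b) → 𝔼 (bits n) (λ S → 𝔼 (bits n ⊗ bits n) (λ (g , x) → 𝔼 (randomGraph n) (λ H → F (a ∷ g) (b ∷ x) (S ▹ H)))))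
    ≡⟨ 𝔼-cong (coin ⊗ coin) (λ (a , b) → 𝔼-swap (bits n) (bits n ⊗ bits n) _) ⟩
  𝔼 coin (λ a → 𝔼 coin (λ b → 𝔼 (bits n) (λ g → 𝔼 (bits n) (λ x → 𝔼 (bits n) (λ S → 𝔼 (randomGraph n) (λ H → F (a ∷ g) (b ∷ x) (S ▹ H)))))))
    ≡⟨ 𝔼-cong coin (λ a → 𝔼-swap coin (bits n) _) ⟩
  𝔼 coin (λ a → 𝔼 (bits n) (λ g → 𝔼 coin (λ b → 𝔼 (bits n) (λ x → 𝔼 (bits n) (λ S → 𝔼 (randomGraph n) (λ H → F (a ∷ g) (b ∷ x) (S ▹ H))))))) ∎
  where
  open ≡-Reasoning

-- For a fixed row `x` and fixed rest `H`, the row of the vertex 0 is a translate of `g`, hence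
-- uniform.
whole-mean : ∀ n (F : Graph (suc (suc n)) → ℚ) → 𝔼 (randomGraph (suc (suc n))) F ≡ 𝔼 coin (λ t → 𝔼 (seqs n) (λ h → F (whole t h)))
whole-mean n F = 𝔼-cong coin (λ t → sym (begin
  𝔼 (seqs n) (λ h → F (whole t h))
    ≡⟨ seqs-graph n (λ g x H → F ((t ∷ (g ⊕ (x ⊕ degrees H))) ▹ (x ▹ H))) ⟩
  𝔼 (bits n) (λ g → 𝔼 (bits n ⊗ randomGraph n) (λ (x , H) → F ((t ∷ (g ⊕ (x ⊕ degrees H))) ▹ (x ▹ H))))
    ≡⟨ 𝔼-swap (bits n) (bits n ⊗ randomGraph n) _ ⟩
  𝔼 (bits n ⊗ randomGraph n) (λ (x , H) → 𝔼 (bits n) (λ g → F ((t ∷ (g ⊕ (x ⊕ degrees H))) ▹ (x ▹ H))))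
    ≡⟨ 𝔼-cong (bits n ⊗ randomGraph n) (λ (x , H) → bits-⊕ (x ⊕ degrees H) (λ g → F ((t ∷ g) ▹ (x ▹ H)))) ⟩
  𝔼 (bits n ⊗ randomGraph n) (λ (x , H) → 𝔼 (bits n) (λ g → F ((t ∷ g) ▹ (x ▹ H))))
    ≡⟨ 𝔼-swap (bits n ⊗ randomGraph n) (bits n) _ ⟩
  𝔼 (bits n) (λ g → 𝔼 (bits n ⊗ randomGraph n) (λ (x , H) → F ((t ∷ g) ▹ (x ▹ H)))) ∎))
  where
  open ≡-Reasoning

∑-++ : ∀ {A : Set} (as bs : List A) (f : A → ℚ) → ∑ (as List.++ bs) f ≡ ∑ as f + ∑ bs f
∑-++ []       bs f = sym (ℚ.+-identityˡ _)
∑-++ (a ∷ as) bs f = trans (cong (λ z → f a + z) (∑-++ as bs f)) (sym (ℚ.+-assoc (f a) _ _))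

∑-map : ∀ {A B : Set} (k : A → B) as (f : B → ℚ) → ∑ (List.map k as) f ≡ ∑ as (f ∘ k)
∑-map k []       f = refl
∑-map k (a ∷ as) f = cong (λ z → f (k a) + z) (∑-map k as f)

∑-product : ∀ {A B C : Set} (k : A → B → C) as bs (f : C → ℚ) →
            ∑ (List.cartesianProductWith k as bs) f ≡ ∑ as (λ a → ∑ bs (λ b → f (k a b)))
∑-product k []       bs f = refl
∑-product k (a ∷ as) bs f = trans (∑-++ (List.map (k a) bs) _ f) (cong₂ _+_ (∑-map (k a) bs f) (∑-product k as bs f))

∑-product-mean : ∀ {A B C : Set} (k : A → B → C) as bs (M : Mean A) (N : Mean B) (f : C → ℚ) →
  (∀ f → ∑ as f ≡ ι (length as) * 𝔼 M f) → (∀ f → ∑ bs f ≡ ι (length bs) * 𝔼 N f) →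
  ∑ (List.cartesianProductWith k as bs) f ≡ ι (length (List.cartesianProductWith k as bs)) * 𝔼 (push (uncurry k) (M ⊗ N)) f
∑-product-mean k as bs M N f hM hN = begin
  ∑ (List.cartesianProductWith k as bs) f
    ≡⟨ ∑-product k as bs f ⟩
  ∑ as (λ a → ∑ bs (λ b → f (k a b)))
    ≡⟨ trans (⟦⟧-cong (summation as) (λ a → hN (λ b → f (k a b)))) (⟦⟧-* (summation as) (ι (length bs)) (λ a → 𝔼 N (λ b → f (k a b)))) ⟩
  ι (length bs) * ∑ as (λ a → 𝔼 N (λ b → f (k a b)))
    ≡⟨ cong (ι (length bs) *_) (hM (λ a → 𝔼 N (λ b → f (k a b)))) ⟩
  ι (length bs) * (ι (length as) * 𝔼 M (λ a → 𝔼 N (λ b → f (k a b))))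
    ≡⟨ solve 3 (λ x y z → y :* (x :* z) := x :* y :* z) refl (ι (length as)) (ι (length bs)) (𝔼 M (λ a → 𝔼 N (λ b → f (k a b)))) ⟩
  ι (length as) * ι (length bs) * 𝔼 M (λ a → 𝔼 N (λ b → f (k a b)))
    ≡⟨ cong (_* 𝔼 M (λ a → 𝔼 N (λ b → f (k a b)))) (trans (sym (CauchyLemmas.ι-* (length as) (length bs))) (cong ι (sym (length-product k as bs)))) ⟩
  ι (length (List.cartesianProductWith k as bs)) * 𝔼 M (λ a → 𝔼 N (λ b → f (k a b))) ∎
  where
  open ≡-Reasoning

∑-subsets : ∀ n f → ∑ (subsets n) f ≡ ι (length (subsets n)) * 𝔼 (bits n) f
∑-subsets zero    f = trans (ℚ.+-identityʳ (f [])) (sym (ℚ.*-identityˡ (f [])))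
∑-subsets (suc n) f = ∑-product-mean _∷_ (true ∷ false ∷ []) (subsets n) coin (bits n) f
  (λ f → trans (solve 2 (λ x y → x :+ (y :+ con 0ℚ) := con (+ 2 / 1) :* (con ½ :* (x :+ y))) refl (f true) (f false)) (cong (ι 2 *_) (sym (𝔼-coin f))))
  (∑-subsets n)

∑-graphs : ∀ n f → ∑ (graphs n) f ≡ ι (length (graphs n)) * 𝔼 (randomGraph n) f
∑-graphs zero    f = trans (ℚ.+-identityʳ (f ∅)) (sym (ℚ.*-identityˡ (f ∅)))
∑-graphs (suc n) f = ∑-product-mean _▹_ (subsets n) (graphs n) (bits n) (randomGraph n) f (∑-subsets n) (∑-graphs n)

∑-indicator : ∀ {A : Set} {P : A → Set} (P? : Decidable P) as → ∑ as (λ a → indicator (P? a)) ≡ ι (length (filter P? as))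
∑-indicator P? []       = refl
∑-indicator P? (a ∷ as) with does (P? a)
... | true  = trans (cong (λ z → 1ℚ + z) (∑-indicator P? as)) (sym (CauchyLemmas.ι-+ 1 (length (filter P? as))))
... | false = trans (ℚ.+-identityˡ (∑ as (λ a → indicator (P? a)))) (∑-indicator P? as)

fraction : ∀ a N .{{_ : ℕ.NonZero N}} → (+ a / N) * ι N ≡ ι a
fraction a N@(suc k) = ℚ.toℚᵘ-injective (begin
  ℚ.toℚᵘ ((+ a / N) * ι N)                     ≈⟨ ℚ.toℚᵘ-homo-* (+ a / N) (ι N) ⟩
  ℚ.toℚᵘ (+ a / N) ℚᵘ.* ℚ.toℚᵘ (ι N)           ≈⟨ ℚᵘ.*-cong (ℚ.toℚᵘ-fromℚᵘ (ℚᵘ.mkℚᵘ (+ a) k)) (CauchyLemmas.ι-≃ N) ⟩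
  ℚᵘ.mkℚᵘ (+ a) k ℚᵘ.* ℚᵘ.mkℚᵘ (+ N) 0         ≈⟨ ℚᵘ.*≡* (trans (ℤ.*-identityʳ _) (cong (λ z → + a ℤ.* + z) (sym (ℕ.*-identityʳ N)))) ⟩
  ℚᵘ.mkℚᵘ (+ a) 0                              ≈⟨ CauchyLemmas.ι-≃ a ⟨
  ℚ.toℚᵘ (ι a)                                 ∎)
  where
  open ℚᵘ.≃-Reasoning

ℙ-mean : ∀ n {P : Graph n → Set} (P? : Decidable P) → ℙ n P? ≡ 𝔼 (randomGraph n) (λ G → indicator (P? G))
ℙ-mean n P? = cancel N (begin
  ℙ n P? * ι N                                                ≡⟨ fraction (length (filter P? (graphs n))) N {{ℕ.m^n≢0 2 (n ℕ.C 2)}} ⟩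
  ι (length (filter P? (graphs n)))                           ≡⟨ ∑-indicator P? (graphs n) ⟨
  ∑ (graphs n) (λ G → indicator (P? G))                       ≡⟨ ∑-graphs n _ ⟩
  ι (length (graphs n)) * 𝔼 (randomGraph n) (λ G → indicator (P? G))
    ≡⟨ trans (cong (λ z → ι z * 𝔼 (randomGraph n) (λ G → indicator (P? G))) (length-graphs n)) (ℚ.*-comm (ι N) _) ⟩
  𝔼 (randomGraph n) (λ G → indicator (P? G)) * ι N ∎) {{ℕ.m^n≢0 2 (n ℕ.C 2)}}
  where
  open ≡-Reasoning
  N : ℕ
  N = 2 ℕ.^ (n ℕ.C 2)
  cancel : ∀ N {p q} → p * ι N ≡ q * ι N → .{{_ : ℕ.NonZero N}} → p ≡ q
  cancel (suc k) {p} {q} e = ℚ.≤-antisym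
    (ℚ.*-cancelʳ-≤-pos (ι (suc k)) {{CauchyLemmas.ι-pos k}} (ℚ.≤-reflexive e))
    (ℚ.*-cancelʳ-≤-pos (ι (suc k)) {{CauchyLemmas.ι-pos k}} (ℚ.≤-reflexive (sym e)))

-- Sizes of the error terms

older-mean : ∀ n {p} (F : Seq p → ℚ) → 𝔼 (seqs (n ℕ.+ p)) (λ h → F (olderSeq n h)) ≡ 𝔼 (seqs p) F
older-mean zero    F = refl
older-mean (suc n) F = trans (𝔼-cong (seqs (n ℕ.+ _)) (λ h → 𝔼-const (arrival (n ℕ.+ _)) (F (olderSeq n h)))) (older-mean n F)

^-mono : ∀ {p q} → 0ℚ ≼ p → p ≼ q → ∀ k → p ^ k ≼ q ^ k
^-mono         0≤p p≤q zero    = ℚ.≤-refl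
^-mono {p} {q} 0≤p p≤q (suc k) = CauchyLemmas.*-mono-≤ (ℚ.≤-trans 0≤p p≤q) (CauchyLemmas.0≤^ p 0≤p k) p≤q (^-mono 0≤p p≤q k)

^-≼1 : ∀ {p} → 0ℚ ≼ p → p ≼ 1ℚ → ∀ k → p ^ k ≼ 1ℚ
^-≼1 0≤p p≤1 zero    = ℚ.≤-refl
^-≼1 {p} 0≤p p≤1 (suc k) = CauchyLemmas.*-mono-≤ {b = 1ℚ} {d = 1ℚ} CauchyLemmas.0≤1 (CauchyLemmas.0≤^ p 0≤p k) p≤1 (^-≼1 0≤p p≤1 k)

^-+ : ∀ p m n → p ^ (m ℕ.+ n) ≡ p ^ m * p ^ n
^-+ p zero    n = sym (ℚ.*-identityˡ (p ^ n))
^-+ p (suc m) n = trans (cong (p *_) (^-+ p m n)) (sym (ℚ.*-assoc p (p ^ m) (p ^ n)))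

^-anti : ∀ {p} → 0ℚ ≼ p → p ≼ 1ℚ → ∀ {m n} → m ≤ n → p ^ n ≼ p ^ m
^-anti {p} 0≤p p≤1 {m} {n} m≤n = ℚ.≤-trans (ℚ.≤-reflexive (trans (cong (p ^_) (sym (ℕ.m+[n∸m]≡n m≤n))) (^-+ p m (n ℕ.∸ m))))
  (ℚ.≤-trans (*-monoˡ (CauchyLemmas.0≤^ p 0≤p m) (^-≼1 0≤p p≤1 (n ℕ.∸ m))) (ℚ.≤-reflexive (ℚ.*-identityʳ (p ^ m))))

*-^ : ∀ p q k → (p * q) ^ k ≡ p ^ k * q ^ k
*-^ p q zero    = refl
*-^ p q (suc k) = trans (cong (p * q *_) (*-^ p q k)) (solve 4 (λ p q x y → p :* q :* (x :* y) := p :* x :* (q :* y)) refl p q (p ^ k) (q ^ k))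

θ≼1 : θ ≼ 1ℚ
θ≼1 = check≼ _ _

-- 4 ≤ (8/7)^11
4^-θ^ : ∀ P → (+ 2 / 1) ^ P * (+ 2 / 1) ^ P * θ ^ (P ℕ.* 11) ≼ 1ℚ
4^-θ^ zero    = ℚ.≤-refl
4^-θ^ (suc P) = begin
  (2ℚ * t) * (2ℚ * t) * θ ^ (11 ℕ.+ P ℕ.* 11)
    ≡⟨ cong (λ z → (2ℚ * t) * (2ℚ * t) * z) (^-+ θ 11 (P ℕ.* 11)) ⟩
  (2ℚ * t) * (2ℚ * t) * (θ ^ 11 * e)
    ≡⟨ solve 4 (λ two t x e → (two :* t) :* (two :* t) :* (x :* e) := (two :* two :* x) :* (t :* t :* e)) refl 2ℚ t (θ ^ 11) e ⟩
  (2ℚ * 2ℚ * θ ^ 11) * (t * t * e)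
    ≤⟨ *-monoʳ (0≼* (0≼* (0≼2^ P) (0≼2^ P)) (0≼θ^ (P ℕ.* 11))) (check≼ (2ℚ * 2ℚ * θ ^ 11) 1ℚ) ⟩
  1ℚ * (t * t * e)
    ≡⟨ ℚ.*-identityˡ (t * t * e) ⟩
  t * t * e
    ≤⟨ 4^-θ^ P ⟩
  1ℚ ∎
  where
  open ℚ.≤-Reasoning
  2ℚ t e : ℚ
  2ℚ = + 2 / 1
  t = 2ℚ ^ P
  e = θ ^ (P ℕ.* 11)

failure-mean : ∀ k m {p} β → 𝔼 (seqs (double k ℕ.+ (m ℕ.+ p))) (failure k m β) ≼
  ½ ^ p + (Moments.variance-bound k m p β)
failure-mean k m {p} β = ℚ.≤-trans
  (ℚ.≤-reflexive (𝔼-+ (seqs (double k ℕ.+ (m ℕ.+ p))) (λ h → not-found β (olderSeq m (olderSeq (double k) h)))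
    (λ h → (successes k m β h - 1ℚ) * (successes k m β h - 1ℚ))))
  (ℚ.+-mono-≤
  (ℚ.≤-reflexive (trans (older-mean (double k) (λ h → not-found β (olderSeq m h))) (trans (older-mean m (not-found β)) (not-found-mean p β))))
  (Moments.variance k m p β))

-- p initial arrivals, m further ones, and k pairs
failure-small : ∀ k m p K β → K ≤ p → K ≤ m → (m ℕ.+ p) ℕ.* 11 ℕ.+ K ≤ k →
  𝔼 (seqs (double k ℕ.+ (m ℕ.+ p))) (failure k m β) ≼ (+ 185 / 1) * θ ^ K
failure-small k m p K β K≤p K≤m le = begin
  𝔼 (seqs (double k ℕ.+ (m ℕ.+ p))) (failure k m β)
    ≤⟨ failure-mean k m β ⟩
  ½ ^ p + (2ℚ * (w * e) + θ ^ m * ((+ 36 / 1) + (+ 144 / 1) * (w * e)) + 2ℚ * e)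
    ≤⟨ ℚ.+-mono-≤ (ℚ.≤-trans (^-mono 0≼½ (check≼ _ _) p) (^-anti 0≼θ θ≼1 K≤p))
         (ℚ.+-mono-≤ (ℚ.+-mono-≤ (*-monoˡ {2ℚ} (ℚ.nonNegative⁻¹ _) we≼)
           (CauchyLemmas.*-mono-≤ (0≼θ^ K) 0≼tail (^-anti 0≼θ θ≼1 K≤m) (ℚ.+-monoʳ-≤ (+ 36 / 1) (*-monoˡ {+ 144 / 1} (ℚ.nonNegative⁻¹ _) (ℚ.≤-trans we≼ (^-≼1 0≼θ θ≼1 K))))))
           (*-monoˡ {2ℚ} (ℚ.nonNegative⁻¹ _) (^-anti 0≼θ θ≼1 (ℕ.≤-trans (ℕ.m≤n+m K ((m ℕ.+ p) ℕ.* 11)) le)))) ⟩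
  -- Every term is now a multiple of `θ ^ K`, and 1 + 2 + (36 + 144) + 2 = 185.
  x + (2ℚ * x + x * ((+ 36 / 1) + (+ 144 / 1) * 1ℚ) + 2ℚ * x)
    ≡⟨ solve 1 (λ x → x :+ (con 2ℚ :* x :+ x :* (con (+ 36 / 1) :+ con (+ 144 / 1) :* con 1ℚ) :+ con 2ℚ :* x) := con (+ 185 / 1) :* x) refl x ⟩
  (+ 185 / 1) * x ∎
  where
  open ℚ.≤-Reasoning
  2ℚ x e t w : ℚ
  2ℚ = + 2 / 1
  x = θ ^ K
  e = θ ^ k
  t = 2ℚ ^ (m ℕ.+ p)
  w = t * t
  0≼w : 0ℚ ≼ w
  0≼w = 0≼* (0≼2^ (m ℕ.+ p)) (0≼2^ (m ℕ.+ p))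
  0≼tail : 0ℚ ≼ (+ 36 / 1) + (+ 144 / 1) * (w * e)
  0≼tail = CauchyLemmas.0≤+ {+ 36 / 1} (ℚ.nonNegative⁻¹ _) (0≼* {+ 144 / 1} (ℚ.nonNegative⁻¹ _) (0≼* 0≼w (0≼θ^ k)))
  we≼ : w * e ≼ x
  we≼ = begin
    w * e                                        ≤⟨ *-monoˡ 0≼w (^-anti 0≼θ θ≼1 le) ⟩
    w * θ ^ ((m ℕ.+ p) ℕ.* 11 ℕ.+ K)             ≡⟨ cong (w *_) (^-+ θ ((m ℕ.+ p) ℕ.* 11) K) ⟩
    w * (θ ^ ((m ℕ.+ p) ℕ.* 11) * x)             ≡⟨ ℚ.*-assoc w _ x ⟨
    w * θ ^ ((m ℕ.+ p) ℕ.* 11) * x               ≤⟨ *-monoʳ (0≼θ^ K) (4^-θ^ (m ℕ.+ p)) ⟩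
    1ℚ * x                                       ≡⟨ ℚ.*-identityˡ x ⟩
    x ∎

bad : ℕ → ℚ
bad n = ℙ n (λ G → ¬? (evenDegenerate? G))

opaque
  isBad : ∀ {n} → Graph n → ℚ
  isBad G = indicator (¬? (evenDegenerate? G))

  bad-mean : ∀ n → bad n ≡ 𝔼 (randomGraph n) isBad
  bad-mean n = ℙ-mean n (λ G → ¬? (evenDegenerate? G))

  isBad-bound : ∀ k m {p} t (h : Seq (double k ℕ.+ (m ℕ.+ p))) → isBad (whole t h) ≼ failure k m true h + failure k m false h
  isBad-bound = failure-bound

  0≼isBad : ∀ {n} (G : Graph n) → 0ℚ ≼ isBad G
  0≼isBad G = if-elim (0ℚ ≼_) (does (¬? (evenDegenerate? G))) CauchyLemmas.0≤1 ℚ.≤-refl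

  isBad-one : ∀ {n} (G : Graph n) → ¬ EvenDegenerate G → isBad G ≡ 1ℚ
  isBad-one G ¬ed = cong (λ b → if b then 1ℚ else 0ℚ) (dec-true (¬? (evenDegenerate? G)) ¬ed)

bad-small : ∀ k m p K → K ≤ p → K ≤ m → (m ℕ.+ p) ℕ.* 11 ℕ.+ K ≤ k → bad (suc (suc (double k ℕ.+ (m ℕ.+ p)))) ≼ (+ 370 / 1) * θ ^ K
bad-small k m p K K≤p K≤m le = begin
  bad (suc (suc N))
    ≡⟨ trans (bad-mean (suc (suc N))) (whole-mean N isBad) ⟩
  𝔼 coin (λ t → 𝔼 (seqs N) (λ h → isBad (whole t h)))
    ≤⟨ 𝔼-≤ coin (𝔼 (seqs N) (λ h → failure k m true h + failure k m false h)) (λ t → 𝔼-mono (seqs N) (isBad-bound k m t)) ⟩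
  𝔼 (seqs N) (λ h → failure k m true h + failure k m false h)
    ≡⟨ 𝔼-+ (seqs N) (failure k m true) (failure k m false) ⟩
  𝔼 (seqs N) (failure k m true) + 𝔼 (seqs N) (failure k m false)
    ≤⟨ ℚ.+-mono-≤ (failure-small k m p K true K≤p K≤m le) (failure-small k m p K false K≤p K≤m le) ⟩
  (+ 185 / 1) * θ ^ K + (+ 185 / 1) * θ ^ K
    ≡⟨ solve 1 (λ x → con (+ 185 / 1) :* x :+ con (+ 185 / 1) :* x := con (+ 370 / 1) :* x) refl (θ ^ K) ⟩
  (+ 370 / 1) * θ ^ K ∎
  where
  open ℚ.≤-Reasoning
  N : ℕ
  N = double k ℕ.+ (m ℕ.+ p)

halve : ∀ r → ∃[ T ] (r ≡ double T ⊎ r ≡ suc (double T))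
halve zero    = 0 , inj₁ refl
halve (suc r) with halve r
... | T , inj₁ e = T , inj₂ (cong suc e)
... | T , inj₂ e = suc T , inj₁ (cong suc e)

double-+ : ∀ T → double T ≡ T ℕ.+ T
double-+ zero    = refl
double-+ (suc T) = cong suc (trans (cong suc (double-+ T)) (sym (ℕ.+-suc T T)))

double-cancel : ∀ {a b} → double a ≤ suc (double b) → a ≤ b
double-cancel {zero}          _                     = ℕ.z≤n
double-cancel {suc a} {suc b} (ℕ.s≤s (ℕ.s≤s h))     = ℕ.s≤s (double-cancel h)
double-cancel {suc a} {zero}  (ℕ.s≤s ())

-- The exponential function.

abs-nonneg : ∀ p → 0ℚ ≼ abs p
abs-nonneg p = ℚ.nonNegative⁻¹ _ {{ℚ.∣-∣-nonNeg p}}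

conv : (ℕ → ℚ) → (ℕ → ℚ) → ℕ → ℚ
conv f g zero    = f 0 * g 0
conv f g (suc k) = f 0 * g (suc k) + conv (f ∘ suc) g k

conv-cong : ∀ {f f′ g g′ : ℕ → ℚ} → (∀ a → f a ≡ f′ a) → (∀ a → g a ≡ g′ a) → ∀ k → conv f g k ≡ conv f′ g′ k
conv-cong hf hg zero    = cong₂ _*_ (hf 0) (hg 0)
conv-cong hf hg (suc k) = cong₂ _+_ (cong₂ _*_ (hf 0) (hg (suc k))) (conv-cong (λ a → hf (suc a)) hg k)

conv-+ : ∀ f f′ g k → conv (λ a → f a + f′ a) g k ≡ conv f g k + conv f′ g k
conv-+ f f′ g zero    = ℚ.*-distribʳ-+ (g 0) (f 0) (f′ 0)
conv-+ f f′ g (suc k) = trans (cong₂ _+_ (ℚ.*-distribʳ-+ (g (suc k)) (f 0) (f′ 0)) (conv-+ (f ∘ suc) (f′ ∘ suc) g k))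
  (solve 4 (λ a b c d → a :+ b :+ (c :+ d) := a :+ c :+ (b :+ d)) refl (f 0 * g (suc k)) (f′ 0 * g (suc k)) _ _)

conv-*ˡ : ∀ x f g k → conv (λ a → x * f a) g k ≡ x * conv f g k
conv-*ˡ x f g zero    = ℚ.*-assoc x (f 0) (g 0)
conv-*ˡ x f g (suc k) = trans (cong₂ _+_ (ℚ.*-assoc x (f 0) (g (suc k))) (conv-*ˡ x (f ∘ suc) g k)) (sym (ℚ.*-distribˡ-+ x _ _))

conv-*ʳ : ∀ y f g k → conv f (λ b → y * g b) k ≡ y * conv f g k
conv-*ʳ y f g zero    = solve 3 (λ y a b → a :* (y :* b) := y :* (a :* b)) refl y (f 0) (g 0)
conv-*ʳ y f g (suc k) = trans (cong₂ _+_ (solve 3 (λ y a b → a :* (y :* b) := y :* (a :* b)) refl y (f 0) (g (suc k))) (conv-*ʳ y (f ∘ suc) g k)) (sym (ℚ.*-distribˡ-+ y _ _))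

derivative : (ℕ → ℚ) → ℕ → ℚ
derivative f a = ι (suc a) * f (suc a)

-- In the coefficient of degree k + 1 each product f a * g b has a + b = k + 1, and this factor is
-- distributed over `f` and `g`: the product rule for formal power series.
leibniz : ∀ f g k → ι (suc k) * conv f g (suc k) ≡ conv (derivative f) g k + conv f (derivative g) k
leibniz f g zero    = solve 5 (λ i f₀ g₁ f₁ g₀ → i :* (f₀ :* g₁ :+ f₁ :* g₀) := i :* f₁ :* g₀ :+ f₀ :* (i :* g₁)) refl (ι 1) (f 0) (g 1) (f 1) (g 0)
leibniz f g (suc k) = begin
  ι (suc (suc k)) * (f 0 * g₂ + c)
    ≡⟨ cong (_* (f 0 * g₂ + c)) (CauchyLemmas.ι-+ 1 (suc k)) ⟩
  (1ℚ + i) * (f 0 * g₂ + c)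
    ≡⟨ solve 4 (λ i f₀ g₂ c → (con 1ℚ :+ i) :* (f₀ :* g₂ :+ c) := c :+ i :* c :+ (con 1ℚ :+ i) :* (f₀ :* g₂)) refl i (f 0) g₂ c ⟩
  c + i * c + (1ℚ + i) * (f 0 * g₂)
    ≡⟨ cong₂ (λ y z → c + y + z * (f 0 * g₂)) (leibniz h g k) (sym (CauchyLemmas.ι-+ 1 (suc k))) ⟩
  h 0 * g (suc k) + conv (h ∘ suc) g k + (conv (derivative h) g k + conv h (derivative g) k) + ι (suc (suc k)) * (f 0 * g₂)
    ≡⟨ solve 7 (λ h₀ g₁ c₁ c₂ c₃ j fg → h₀ :* g₁ :+ c₁ :+ (c₂ :+ c₃) :+ j :* fg := con 1ℚ :* h₀ :* g₁ :+ (c₂ :+ c₁) :+ (j :* fg :+ c₃)) refl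
         (h 0) (g (suc k)) (conv (h ∘ suc) g k) (conv (derivative h) g k) (conv h (derivative g) k) (ι (suc (suc k))) (f 0 * g₂) ⟩
  1ℚ * h 0 * g (suc k) + (conv (derivative h) g k + conv (h ∘ suc) g k) + (ι (suc (suc k)) * (f 0 * g₂) + conv h (derivative g) k)
    ≡⟨ cong₂ (λ y z → 1ℚ * h 0 * g (suc k) + y + (z + conv h (derivative g) k))
         (trans (sym (conv-+ (derivative h) (h ∘ suc) g k)) (conv-cong shifted (λ _ → refl) k))
         (solve 3 (λ j f₀ g₂ → j :* (f₀ :* g₂) := f₀ :* (j :* g₂)) refl (ι (suc (suc k))) (f 0) g₂) ⟩
  conv (derivative f) g (suc k) + conv f (derivative g) (suc k) ∎
  where
  open ≡-Reasoning
  h : ℕ → ℚ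
  h = f ∘ suc
  i g₂ c : ℚ
  i = ι (suc k)
  g₂ = g (suc (suc k))
  c = conv h g (suc k)
  shifted : ∀ a → derivative h a + h (suc a) ≡ derivative f (suc a)
  shifted a = trans (solve 2 (λ i y → i :* y :+ y := (con 1ℚ :+ i) :* y) refl (ι (suc a)) (f (suc (suc a)))) (cong (_* f (suc (suc a))) (sym (CauchyLemmas.ι-+ 1 (suc a))))

derivative-term : ∀ q a → derivative (expTerm q) a ≡ q * expTerm q a
derivative-term q a = trans (ℚ.*-comm (ι (suc a)) _) (trans (CauchyLemmas.term-step q a) (ℚ.*-comm _ q))

-- The binomial theorem without binomial coefficients: by the product rule both sides satisfy the
-- recursion (k + 1) c (k + 1) = (x + y) c k and agree at 0.
term-+ : ∀ x y k → conv (expTerm x) (expTerm y) k ≡ expTerm (x + y) k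
term-+ x y zero    = refl
term-+ x y (suc k) = cancel (begin
  conv (expTerm x) (expTerm y) (suc k) * ι (suc k)
    ≡⟨ trans (ℚ.*-comm _ (ι (suc k))) (leibniz (expTerm x) (expTerm y) k) ⟩
  conv (derivative (expTerm x)) (expTerm y) k + conv (expTerm x) (derivative (expTerm y)) k
    ≡⟨ cong₂ _+_ (trans (conv-cong (derivative-term x) (λ _ → refl) k) (conv-*ˡ x (expTerm x) (expTerm y) k))
                 (trans (conv-cong (λ _ → refl) (derivative-term y) k) (conv-*ʳ y (expTerm x) (expTerm y) k)) ⟩
  x * conv (expTerm x) (expTerm y) k + y * conv (expTerm x) (expTerm y) k
    ≡⟨ solve 3 (λ x y c → x :* c :+ y :* c := c :* (x :+ y)) refl x y _ ⟩
  conv (expTerm x) (expTerm y) k * (x + y)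
    ≡⟨ cong (_* (x + y)) (term-+ x y k) ⟩
  expTerm (x + y) k * (x + y)
    ≡⟨ CauchyLemmas.term-step (x + y) k ⟨
  expTerm (x + y) (suc k) * ι (suc k) ∎)
  where
  open ≡-Reasoning
  cancel : ∀ {p q} → p * ι (suc k) ≡ q * ι (suc k) → p ≡ q
  cancel e = ℚ.≤-antisym
    (ℚ.*-cancelʳ-≤-pos (ι (suc k)) {{CauchyLemmas.ι-pos k}} (ℚ.≤-reflexive e))
    (ℚ.*-cancelʳ-≤-pos (ι (suc k)) {{CauchyLemmas.ι-pos k}} (ℚ.≤-reflexive (sym e)))

partialSum : (ℕ → ℚ) → ℕ → ℚ
partialSum g zero    = 0ℚ
partialSum g (suc n) = partialSum g n + g n

-- The sum of f a * g b over a + b < n.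
triangle : (ℕ → ℚ) → (ℕ → ℚ) → ℕ → ℚ
triangle f g zero    = 0ℚ
triangle f g (suc n) = f 0 * partialSum g (suc n) + triangle (f ∘ suc) g n

partialSum-front : ∀ f n → partialSum f (suc n) ≡ f 0 + partialSum (f ∘ suc) n
partialSum-front f zero    = ℚ.+-comm 0ℚ (f 0)
partialSum-front f (suc n) = trans (cong (λ z → z + f (suc n)) (partialSum-front f n)) (ℚ.+-assoc (f 0) _ _)

partialSum-exp : ∀ q n → partialSum (expTerm q) n ≡ expSum q n
partialSum-exp q zero    = refl
partialSum-exp q (suc n) = cong (λ z → z + expTerm q n) (partialSum-exp q n)

triangle-step : ∀ f g n → triangle f g (suc n) ≡ triangle f g n + conv f g n
triangle-step f g zero    = solve 2 (λ a b → a :* (con 0ℚ :+ b) :+ con 0ℚ := con 0ℚ :+ a :* b) refl (f 0) (g 0)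
triangle-step f g (suc n) = trans (cong (λ z → f 0 * partialSum g (suc (suc n)) + z) (triangle-step (f ∘ suc) g n))
  (solve 5 (λ a s b t c → a :* (s :+ b) :+ (t :+ c) := a :* s :+ t :+ (a :* b :+ c)) refl (f 0) (partialSum g (suc n)) (g (suc n)) (triangle (f ∘ suc) g n) (conv (f ∘ suc) g n))

triangle-exp : ∀ x y n → triangle (expTerm x) (expTerm y) n ≡ expSum (x + y) n
triangle-exp x y zero    = refl
triangle-exp x y (suc n) = trans (triangle-step (expTerm x) (expTerm y) n) (cong₂ _+_ (triangle-exp x y n) (term-+ x y n))

partialSum-mono : ∀ g → (∀ b → 0ℚ ≼ g b) → ∀ m n → partialSum g n ≼ partialSum g (m ℕ.+ n)
partialSum-mono g 0≤g zero    n = ℚ.≤-refl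
partialSum-mono g 0≤g (suc m) n = ℚ.≤-trans (partialSum-mono g 0≤g m n) (p≼p+q (0≤g (m ℕ.+ n)))

0≼partialSum : ∀ g → (∀ b → 0ℚ ≼ g b) → ∀ n → 0ℚ ≼ partialSum g n
0≼partialSum g 0≤g zero    = ℚ.≤-refl
0≼partialSum g 0≤g (suc n) = CauchyLemmas.0≤+ (0≼partialSum g 0≤g n) (0≤g n)

rectangle≼triangle : ∀ f g → (∀ a → 0ℚ ≼ f a) → (∀ b → 0ℚ ≼ g b) → ∀ m n → partialSum f m * partialSum g n ≼ triangle f g (m ℕ.+ n)
rectangle≼triangle f g 0≤f 0≤g zero    n = ℚ.≤-trans (ℚ.≤-reflexive (ℚ.*-zeroˡ (partialSum g n))) (0≼triangle f 0≤f n)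
  where
  0≼triangle : ∀ f → (∀ a → 0ℚ ≼ f a) → ∀ n → 0ℚ ≼ triangle f g n
  0≼triangle f 0≤f zero    = ℚ.≤-refl
  0≼triangle f 0≤f (suc n) = CauchyLemmas.0≤+ (0≼* (0≤f 0) (0≼partialSum g 0≤g (suc n))) (0≼triangle (f ∘ suc) (λ a → 0≤f (suc a)) n)
rectangle≼triangle f g 0≤f 0≤g (suc m) n = ℚ.≤-trans
  (ℚ.≤-reflexive (trans (cong (_* partialSum g n) (partialSum-front f m)) (ℚ.*-distribʳ-+ (partialSum g n) (f 0) (partialSum (f ∘ suc) m))))
  (ℚ.+-mono-≤ (*-monoˡ (0≤f 0) (partialSum-mono g 0≤g (suc m) n)) (rectangle≼triangle (f ∘ suc) g (λ a → 0≤f (suc a)) 0≤g m n))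

tail-abs : ∀ g m n → abs (partialSum g (m ℕ.+ n) - partialSum g n) ≼ partialSum (abs ∘ g) (m ℕ.+ n) - partialSum (abs ∘ g) n
tail-abs g zero    n = ℚ.≤-reflexive (trans (cong abs (ℚ.+-inverseʳ (partialSum g n))) (sym (ℚ.+-inverseʳ (partialSum (abs ∘ g) n))))
tail-abs g (suc m) n = begin
  abs (partialSum g (m ℕ.+ n) + g (m ℕ.+ n) - partialSum g n)
    ≡⟨ cong abs (solve 3 (λ a b c → a :+ b :+ :- c := (a :+ :- c) :+ b) refl (partialSum g (m ℕ.+ n)) (g (m ℕ.+ n)) (partialSum g n)) ⟩
  abs (partialSum g (m ℕ.+ n) - partialSum g n + g (m ℕ.+ n))
    ≤⟨ ℚ.∣p+q∣≤∣p∣+∣q∣ (partialSum g (m ℕ.+ n) - partialSum g n) (g (m ℕ.+ n)) ⟩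
  abs (partialSum g (m ℕ.+ n) - partialSum g n) + abs (g (m ℕ.+ n))
    ≤⟨ ℚ.+-monoˡ-≤ _ (tail-abs g m n) ⟩
  partialSum (abs ∘ g) (m ℕ.+ n) - partialSum (abs ∘ g) n + abs (g (m ℕ.+ n))
    ≡⟨ solve 3 (λ a b c → (a :+ :- c) :+ b := a :+ b :+ :- c) refl (partialSum (abs ∘ g) (m ℕ.+ n)) (abs (g (m ℕ.+ n))) (partialSum (abs ∘ g) n) ⟩
  partialSum (abs ∘ g) (m ℕ.+ n) + abs (g (m ℕ.+ n)) - partialSum (abs ∘ g) n ∎
  where
  open ℚ.≤-Reasoning

-- The left side sums f a * g b over the indices of a rectangle outside the triangle, so the
-- triangle inequality applies row by row. Removing a row shortens the triangle but not the
-- rectangle, whence the offset `m`.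
corner : ∀ f g m n → abs (partialSum f n * partialSum g (m ℕ.+ n) - triangle f g n)
         ≼ partialSum (abs ∘ f) n * partialSum (abs ∘ g) (m ℕ.+ n) - triangle (abs ∘ f) (abs ∘ g) n
corner f g m zero    = ℚ.≤-reflexive (trans (cong abs (zero-corner (partialSum g (m ℕ.+ 0)))) (sym (zero-corner (partialSum (abs ∘ g) (m ℕ.+ 0)))))
  where
  zero-corner : ∀ z → 0ℚ * z - 0ℚ ≡ 0ℚ
  zero-corner = solve 1 (λ z → con 0ℚ :* z :+ :- con 0ℚ := con 0ℚ) refl
corner f g m (suc n) = begin
  abs (partialSum f (suc n) * s N - triangle f g (suc n))
    ≡⟨ cong abs (split (f 0) (partialSum (f ∘ suc) n) (s N) (s (suc n)) (triangle (f ∘ suc) g n) (partialSum-front f n)) ⟩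
  abs (f 0 * (s N - s (suc n)) + (partialSum (f ∘ suc) n * s N - triangle (f ∘ suc) g n))
    ≤⟨ ℚ.∣p+q∣≤∣p∣+∣q∣ (f 0 * (s N - s (suc n))) (partialSum (f ∘ suc) n * s N - triangle (f ∘ suc) g n) ⟩
  abs (f 0 * (s N - s (suc n))) + abs (partialSum (f ∘ suc) n * s N - triangle (f ∘ suc) g n)
    ≤⟨ ℚ.+-mono-≤ (ℚ.≤-trans (ℚ.≤-reflexive (ℚ.∣p*q∣≡∣p∣*∣q∣ (f 0) _)) (*-monoˡ (abs-nonneg (f 0)) (tail-abs g m (suc n))))
         (subst (λ M → abs (partialSum (f ∘ suc) n * s M - triangle (f ∘ suc) g n) ≼ partialSum (abs ∘ f ∘ suc) n * S M - triangle (abs ∘ f ∘ suc) (abs ∘ g) n)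
           (sym (ℕ.+-suc m n)) (corner (f ∘ suc) g (suc m) n)) ⟩
  abs (f 0) * (S N - S (suc n)) + (partialSum (abs ∘ f ∘ suc) n * S N - triangle (abs ∘ f ∘ suc) (abs ∘ g) n)
    ≡⟨ split (abs (f 0)) (partialSum (abs ∘ f ∘ suc) n) (S N) (S (suc n)) (triangle (abs ∘ f ∘ suc) (abs ∘ g) n) (partialSum-front (abs ∘ f) n) ⟨
  partialSum (abs ∘ f) (suc n) * S N - triangle (abs ∘ f) (abs ∘ g) (suc n) ∎
  where
  open ℚ.≤-Reasoning
  N : ℕ
  N = m ℕ.+ suc n
  s S : ℕ → ℚ
  s = partialSum g
  S = partialSum (abs ∘ g)
  split : ∀ {F} a b c d t → F ≡ a + b → F * c - (a * d + t) ≡ a * (c - d) + (b * c - t)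
  split a b c d t refl = solve 5 (λ a b c d t → (a :+ b) :* c :+ :- (a :* d :+ t) := a :* (c :+ :- d) :+ (b :* c :+ :- t)) refl a b c d t

abs-term : ∀ q k → abs (expTerm q k) ≡ expTerm (abs q) k
abs-term q k = trans (CauchyLemmas.abs-*r (abs q) (abs-nonneg q) (q ^ k) k) (cong (_* CauchyLemmas.r k) (abs-^ k))
  where
  abs-^ : ∀ k → abs (q ^ k) ≡ abs q ^ k
  abs-^ zero    = refl
  abs-^ (suc k) = trans (ℚ.∣p*q∣≡∣p∣*∣q∣ q (q ^ k)) (cong (abs q *_) (abs-^ k))

partialSum-cong : ∀ {f g : ℕ → ℚ} → (∀ a → f a ≡ g a) → ∀ n → partialSum f n ≡ partialSum g n
partialSum-cong h zero    = refl
partialSum-cong h (suc n) = cong₂ _+_ (partialSum-cong h n) (h n)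

triangle-cong : ∀ {f f′ g g′ : ℕ → ℚ} → (∀ a → f a ≡ f′ a) → (∀ b → g b ≡ g′ b) → ∀ n → triangle f g n ≡ triangle f′ g′ n
triangle-cong hf hg zero    = refl
triangle-cong hf hg (suc n) = cong₂ _+_ (cong₂ _*_ (hf 0) (partialSum-cong hg (suc n))) (triangle-cong (λ a → hf (suc a)) hg n)

-- After passing to absolute values, the square of side j lies inside the triangle of size 2j. The
-- excess over the triangle of size j is thus at most a tail of the series at |x| + |y|.
expSum-* : ∀ x y j → abs (expSum x j * expSum y j - expSum (x + y) j) ≼ abs (expSum (abs x + abs y) (j ℕ.+ j) - expSum (abs x + abs y) j)
expSum-* x y j = begin
  abs (expSum x j * expSum y j - expSum (x + y) j)
    ≡⟨ cong abs (cong₂ _-_ (cong₂ _*_ (partialSum-exp x j) (partialSum-exp y j)) (triangle-exp x y j)) ⟨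
  abs (partialSum (expTerm x) j * partialSum (expTerm y) j - triangle (expTerm x) (expTerm y) j)
    ≤⟨ corner (expTerm x) (expTerm y) 0 j ⟩
  partialSum (abs ∘ expTerm x) j * partialSum (abs ∘ expTerm y) j - triangle (abs ∘ expTerm x) (abs ∘ expTerm y) j
    ≡⟨ cong₂ _-_ (cong₂ _*_ (partialSum-cong (abs-term x) j) (partialSum-cong (abs-term y) j)) (trans (triangle-cong (abs-term x) (abs-term y) j) (triangle-exp X Y j)) ⟩
  partialSum (expTerm X) j * partialSum (expTerm Y) j - expSum (X + Y) j
    ≤⟨ ℚ.+-monoˡ-≤ (- expSum (X + Y) j) (ℚ.≤-trans
         (rectangle≼triangle (expTerm X) (expTerm Y) (CauchyLemmas.0≤T X (abs-nonneg x)) (CauchyLemmas.0≤T Y (abs-nonneg y)) j j)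
         (ℚ.≤-reflexive (triangle-exp X Y (j ℕ.+ j)))) ⟩
  expSum (X + Y) (j ℕ.+ j) - expSum (X + Y) j
    ≤⟨ p≼abs _ ⟩
  abs (expSum (X + Y) (j ℕ.+ j) - expSum (X + Y) j) ∎
  where
  open ℚ.≤-Reasoning
  X Y : ℚ
  X = abs x
  Y = abs y
  p≼abs : ∀ p → p ≼ abs p
  p≼abs p with ℚ.≤-total 0ℚ p
  ... | inj₁ 0≤p = ℚ.≤-reflexive (sym (ℚ.0≤p⇒∣p∣≡p 0≤p))
  ... | inj₂ p≤0 = ℚ.≤-trans p≤0 (abs-nonneg p)

Eventually : (ℕ → Set) → Set
Eventually P = ∃[ N ] ∀ j → N ≤ j → P j

eventually-× : ∀ {P Q : ℕ → Set} → Eventually P → Eventually Q → Eventually (λ j → P j × Q j)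
eventually-× (M , p) (N , q) = M ℕ.⊔ N , λ j h → p j (ℕ.m⊔n≤o⇒m≤o M N h) , q j (ℕ.m⊔n≤o⇒n≤o M N h)

eventually-map : ∀ {P Q : ℕ → Set} → (∀ j → P j → Q j) → Eventually P → Eventually Q
eventually-map k (N , p) = N , λ j h → k j (p j h)

expSum-0 : ∀ j → expSum 0ℚ (suc j) ≡ 1ℚ
expSum-0 zero    = refl
expSum-0 (suc j) = trans (cong₂ _+_ (expSum-0 j) (trans (ℚ.*-assoc 0ℚ (0ℚ ^ j) _) (ℚ.*-zeroˡ (0ℚ ^ j * CauchyLemmas.r (suc j))))) (ℚ.+-identityʳ 1ℚ)

opaque
  expSum-cauchy : ∀ q → IsCauchy (expSum q)
  expSum-cauchy q = CauchyLemmas.exp-cauchy {λ _ → q} (CauchyLemmas.const-cauchy q)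

  expSum-bounded : ∀ q → ∃[ B ] 0ℚ ≼ B × Eventually (λ j → abs (expSum q j) ≼ B)
  expSum-bounded q = CauchyLemmas.bounded (expSum-cauchy q)

  shrink : ∀ B ε → 0ℚ ≺ ε → ∃[ δ ] 0ℚ ≺ δ × B * δ ≼ ε
  shrink = CauchyLemmas.shrink

-- Both sides are truncated at the same index, so the functional equation holds only up to an error
-- that tends to 0. Each new factor adds such an error and multiplies the old one by a bound for the
-- sums.
expSum-power : ∀ x n ε → 0ℚ ≺ ε → Eventually (λ j → abs (expSum (ι n * x) j - expSum x j ^ n) ≼ ε)
-- The truncation at index 0 is the empty sum 0 and not 1, so the threshold is 1.
expSum-power x zero    ε 0<ε = 1 , λ where
  (suc j) _ → ℚ.≤-trans (ℚ.≤-reflexive (trans (cong (λ z → abs (expSum z (suc j) - 1ℚ)) (ℚ.*-zeroˡ x))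
    (trans (cong (λ z → abs (z - 1ℚ)) (expSum-0 j)) (cong abs (ℚ.+-inverseʳ 1ℚ))))) (ℚ.<⇒≤ 0<ε)
expSum-power x (suc n) ε 0<ε = eventually-map combine
  (eventually-× bnd (eventually-× tails (expSum-power x n δ 0<δ)))
  where
  X : ℚ
  X = abs x + abs (ι n * x)
  0<ε/2 : 0ℚ ≺ ε * ½
  0<ε/2 = CauchyLemmas.0<* 0<ε CauchyLemmas.0<½
  bounded : ∃[ B ] 0ℚ ≼ B × Eventually (λ j → abs (expSum x j) ≼ B)
  bounded = expSum-bounded x
  B : ℚ
  B = proj₁ bounded
  bnd : Eventually (λ j → abs (expSum x j) ≼ B)
  bnd = proj₂ (proj₂ bounded)
  shrunk : ∃[ δ ] 0ℚ ≺ δ × B * δ ≼ ε * ½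
  shrunk = shrink B (ε * ½) 0<ε/2
  δ : ℚ
  δ = proj₁ shrunk
  0<δ : 0ℚ ≺ δ
  0<δ = proj₁ (proj₂ shrunk)
  tails : Eventually (λ j → abs (expSum X (j ℕ.+ j) - expSum X j) ≼ ε * ½)
  tails = let N , h = expSum-cauchy X (ε * ½) 0<ε/2 in N , λ j N≤j → h (j ℕ.+ j) j (ℕ.≤-trans N≤j (ℕ.m≤m+n j j)) N≤j
  combine : ∀ j → abs (expSum x j) ≼ B × (abs (expSum X (j ℕ.+ j) - expSum X j) ≼ ε * ½ × abs (expSum (ι n * x) j - expSum x j ^ n) ≼ δ) →
            abs (expSum (ι (suc n) * x) j - expSum x j ^ suc n) ≼ ε
  combine j (hB , ht , hn) = begin
    abs (expSum (ι (suc n) * x) j - E * P)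
      ≡⟨ cong (λ z → abs (expSum z j - E * P)) (trans (cong (_* x) (CauchyLemmas.ι-+ 1 n)) (solve 2 (λ i x → (con 1ℚ :+ i) :* x := x :+ i :* x) refl (ι n) x)) ⟩
    abs (expSum (x + ι n * x) j - E * P)
      ≤⟨ CauchyLemmas.abs-tri (expSum (x + ι n * x) j) (E * F) (E * P) ⟩
    abs (expSum (x + ι n * x) j - E * F) + abs (E * F - E * P)
      ≤⟨ ℚ.+-mono-≤ first second ⟩
    ε * ½ + ε * ½
      ≡⟨ CauchyLemmas.½+½ ε ⟩
    ε ∎
    where
    open ℚ.≤-Reasoning
    E F P : ℚ
    E = expSum x j
    F = expSum (ι n * x) j
    P = expSum x j ^ n
    first : abs (expSum (x + ι n * x) j - E * F) ≼ ε * ½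
    first = ℚ.≤-trans (ℚ.≤-reflexive (CauchyLemmas.abs-sym (expSum (x + ι n * x) j) (E * F))) (ℚ.≤-trans (expSum-* x (ι n * x) j) ht)
    second : abs (E * F - E * P) ≼ ε * ½
    second = begin
      abs (E * F - E * P)       ≡⟨ cong abs (solve 3 (λ e f p → e :* f :+ :- (e :* p) := e :* (f :+ :- p)) refl E F P) ⟩
      abs (E * (F - P))         ≡⟨ ℚ.∣p*q∣≡∣p∣*∣q∣ E (F - P) ⟩
      abs E * abs (F - P)       ≤⟨ CauchyLemmas.*-mono-≤ (proj₁ (proj₂ bounded)) (abs-nonneg (F - P)) hB hn ⟩
      B * δ                     ≤⟨ proj₂ (proj₂ shrunk) ⟩
      ε * ½ ∎

abs-bounds : ∀ {p q ε} → abs (p - q) ≼ ε → q ≼ p + ε × p ≼ q + ε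
abs-bounds {p} {q} {ε} h =
  shift q p (ℚ.≤-trans (ℚ.≤-reflexive (CauchyLemmas.abs-sym q p)) h) , shift p q h
  where
  p≼abs : ∀ p → p ≼ abs p
  p≼abs p with ℚ.≤-total 0ℚ p
  ... | inj₁ 0≤p = ℚ.≤-reflexive (sym (ℚ.0≤p⇒∣p∣≡p 0≤p))
  ... | inj₂ p≤0 = ℚ.≤-trans p≤0 (abs-nonneg p)
  shift : ∀ a b → abs (a - b) ≼ ε → a ≼ b + ε
  shift a b h = ℚ.≤-trans (ℚ.≤-reflexive (solve 2 (λ a b → a := b :+ (a :+ :- b)) refl a b)) (ℚ.+-monoʳ-≤ b (ℚ.≤-trans (p≼abs (a - b)) h))

power-below : ∀ x {τ} → 0ℚ ≼ τ → Eventually (λ j → τ ≼ expSum x j) → ∀ n ε → 0ℚ ≺ ε → Eventually (λ j → τ ^ n ≼ expSum (ι n * x) j + ε)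
power-below x 0≤τ h n ε 0<ε = eventually-map
  (λ j (p , q) → ℚ.≤-trans (^-mono 0≤τ p n) (proj₁ (abs-bounds {expSum (ι n * x) j} {expSum x j ^ n} q))) (eventually-× h (expSum-power x n ε 0<ε))

power-above : ∀ x {τ} → Eventually (λ j → 0ℚ ≼ expSum x j × expSum x j ≼ τ) → ∀ n ε → 0ℚ ≺ ε → Eventually (λ j → expSum (ι n * x) j ≼ τ ^ n + ε)
power-above x h n ε 0<ε = eventually-map
  (λ j ((p , p′) , q) → ℚ.≤-trans (proj₂ (abs-bounds {expSum (ι n * x) j} {expSum x j ^ n} q)) (ℚ.+-monoˡ-≤ ε (^-mono p p′ n))) (eventually-× h (expSum-power x n ε 0<ε))

expSum-tail : ∀ a B K N → 0ℚ ≼ B → B + B ≼ ι K → abs a ≼ B → K ≤ N → ∀ j → N ≤ j →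
              expSum a N - (expTerm B N + expTerm B N) ≼ expSum a j × expSum a j ≼ expSum a N + (expTerm B N + expTerm B N)
expSum-tail a B K N 0≤B hK ha K≤N j N≤j = let lo , hi = abs-bounds (CauchyLemmas.tail′ B 0≤B K hK ha N K≤N j N≤j) in
  ℚ.≤-trans (ℚ.+-monoˡ-≤ (- t) lo) (ℚ.≤-reflexive (solve 2 (λ e s → e :+ s :+ :- s := e) refl (expSum a j) t)) , hi
  where
  t : ℚ
  t = expTerm B N + expTerm B N

-- Explicit constants and choice of parameters

c₀ C₀ τ₀ : ℚ
c₀ = + 1 / 2048
C₀ = + 2 / 1
τ₀ = + 1023 / 1024

-- Here `τ₀` is 1 - 2 `c₀`, so the partial sum 1 - `c₀` leaves a margin of `c₀` for a tail of size
-- at most the square of `c₀`.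
exp-c : Eventually (λ j → τ₀ ≼ expSum (- c₀) j)
exp-c = 2 , λ j 2≤j → ℚ.≤-trans (check≼ τ₀ (expSum (- c₀) 2 - (expTerm c₀ 2 + expTerm c₀ 2)))
  (proj₁ (expSum-tail (- c₀) c₀ 1 2 (check≼ 0ℚ c₀) (check≼ (c₀ + c₀) (ι 1)) (check≼ (abs (- c₀)) c₀) (ℕ.m≤m+n 1 1) j 2≤j))

-- The terms at 2 halve at least from index 4 on, as 2 + 2 ≤ 4. Eight terms already place exp(-2)
-- between 0 and 1/4, the base of the lower bound; the sign is needed to take powers.
exp-C : Eventually (λ j → 0ℚ ≼ expSum (- C₀) j × expSum (- C₀) j ≼ + 1 / 4)
exp-C = 8 , λ j 8≤j →
  let lo , hi = expSum-tail (- C₀) C₀ 4 8 (check≼ 0ℚ C₀) (check≼ (C₀ + C₀) (ι 4)) (check≼ (abs (- C₀)) C₀) (ℕ.m≤m+n 4 4) j 8≤j in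
  ℚ.≤-trans (check≼ 0ℚ (expSum (- C₀) 8 - (expTerm C₀ 8 + expTerm C₀ 8))) lo ,
  ℚ.≤-trans hi (check≼ (expSum (- C₀) 8 + (expTerm C₀ 8 + expTerm C₀ 8)) (+ 1 / 4))

^-* : ∀ p m n → p ^ (m ℕ.* n) ≡ (p ^ n) ^ m
^-* p zero    n = refl
^-* p (suc m) n = trans (^-+ p n (m ℕ.* n)) (cong (p ^ n *_) (^-* p m n))

bernoulli : ∀ k → 1ℚ - ι k * (+ 1 / 1024) ≼ τ₀ ^ k
bernoulli zero    = check≼ _ _
bernoulli (suc k) = begin
  1ℚ - ι (suc k) * a
    ≡⟨ cong (λ z → 1ℚ - z * a) (CauchyLemmas.ι-+ 1 k) ⟩
  1ℚ - (1ℚ + ι k) * a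
    ≤⟨ p≼p+q (0≼* (0≼ι k) (check≼ 0ℚ (a * a))) ⟩
  1ℚ - (1ℚ + ι k) * a + ι k * (a * a)
    ≡⟨ solve 1 (λ k → con 1ℚ :+ :- ((con 1ℚ :+ k) :* con a) :+ k :* (con a :* con a) := con τ₀ :* (con 1ℚ :+ :- (k :* con a))) refl (ι k) ⟩
  τ₀ * (1ℚ - ι k * a)
    ≤⟨ *-monoˡ (check≼ 0ℚ τ₀) (bernoulli k) ⟩
  τ₀ * τ₀ ^ k ∎
  where
  open ℚ.≤-Reasoning
  a : ℚ
  a = + 1 / 1024

power-scale : ∀ {p q} s → 0ℚ ≼ p → p ≼ q ^ s → ∀ k → p ^ k ≼ q ^ (k ℕ.* s)
power-scale {p} {q} s 0≤p h k = ℚ.≤-trans (^-mono 0≤p h k) (ℚ.≤-reflexive (sym (^-* q k s)))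

-- Of the two factors of the rate, `u` pays for the constant `c` once K is large, and even for one
-- more factor `v`; the power of `v` remains as the bound.
absorb : ∀ {c u v ε} r s → 0ℚ ≼ c → 0ℚ ≼ u → u ≼ 1ℚ → 0ℚ ≼ v → u ^ r ≼ ε → 0ℚ ≼ ε → c * ε ^ s ≼ v →
         ∀ K → s ℕ.* r ≤ K → c * (u * v) ^ K ≼ v ^ suc K
absorb {c} {u} {v} {ε} r s 0≤c 0≤u u≤1 0≤v small 0≤ε h K sr≤K = begin
  c * (u * v) ^ K      ≡⟨ cong (c *_) (*-^ u v K) ⟩
  c * (u ^ K * v ^ K)  ≡⟨ ℚ.*-assoc c (u ^ K) (v ^ K) ⟨
  c * u ^ K * v ^ K    ≤⟨ *-monoʳ (CauchyLemmas.0≤^ v 0≤v K) (ℚ.≤-trans (*-monoˡ 0≤c uᴷ) h) ⟩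
  v * v ^ K            ∎
  where
  open ℚ.≤-Reasoning
  uᴷ : u ^ K ≼ ε ^ s
  uᴷ = begin
    u ^ K          ≤⟨ ^-anti 0≤u u≤1 sr≤K ⟩
    u ^ (s ℕ.* r)  ≡⟨ ^-* u s r ⟩
    (u ^ r) ^ s    ≤⟨ ^-mono (CauchyLemmas.0≤^ u 0≤u r) small s ⟩
    ε ^ s          ∎

15/16≼τ₀^64 : + 15 / 16 ≼ τ₀ ^ 64
15/16≼τ₀^64 = ℚ.≤-trans (check≼ (+ 15 / 16) (1ℚ - ι 64 * (+ 1 / 1024))) (bernoulli 64)

-- θ = (14/15)(15/16), where (14/15)^11 ≤ 1/2.
θ-τ₀ : ∀ K n → 99 ≤ K → n ≤ suc K ℕ.* 64 → (+ 370 / 1) * θ ^ K ≼ τ₀ ^ n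
θ-τ₀ K n 99≤K n≤ = ℚ.≤-trans
  (absorb {+ 370 / 1} {+ 14 / 15} {+ 15 / 16} {½} 11 9 (check≼ _ _) (check≼ _ _) (check≼ _ _) (check≼ _ _)
    (check≼ ((+ 14 / 15) ^ 11) ½) (check≼ _ _) (check≼ ((+ 370 / 1) * ½ ^ 9) (+ 15 / 16)) K 99≤K)
  (ℚ.≤-trans (power-scale {+ 15 / 16} {τ₀} 64 (check≼ _ _) 15/16≼τ₀^64 (suc K)) (^-anti (check≼ 0ℚ τ₀) (check≼ τ₀ 1ℚ) n≤))

-- Take p = K and m = K or K + 1 according to the parity of n, and let all other vertices form
-- pairs. The requirement on k needs at most 48 K + 24 vertices in all, which is at most 64 K from K
-- = 2 on.
parameters : ∀ n K → 2 ≤ K → K ℕ.* 64 ≤ n →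
  ∃[ k ] ∃[ m ] ∃[ p ] n ≡ suc (suc (double k ℕ.+ (m ℕ.+ p))) × K ≤ p × K ≤ m × (m ℕ.+ p) ℕ.* 11 ℕ.+ K ≤ k
parameters n K 2≤K 64K≤n with halve (n ℕ.∸ (2 ℕ.+ (K ℕ.+ K)))
... | T , even-or-odd = split even-or-odd
  where
  open ℕSolver.+-*-Solver using () renaming (solve to ℕ-solve; _:=_ to _≔_; _:+_ to _⊹_; _:*_ to _⊛_; con to κ)
  y r : ℕ
  y = (suc K ℕ.+ K) ℕ.* 11 ℕ.+ K
  r = n ℕ.∸ (2 ℕ.+ (K ℕ.+ K))
  room : (2 ℕ.+ (K ℕ.+ K)) ℕ.+ double y ≤ n
  room = ℕ.≤-trans (ℕ.≤-reflexive (trans (cong ((2 ℕ.+ (K ℕ.+ K)) ℕ.+_) (double-+ y))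
      (ℕ-solve 1 (λ K → (κ 2 ⊹ (K ⊹ K)) ⊹ (((κ 1 ⊹ K ⊹ K) ⊛ κ 11 ⊹ K) ⊹ ((κ 1 ⊹ K ⊹ K) ⊛ κ 11 ⊹ K)) ≔ κ 24 ⊹ K ⊛ κ 48) refl K)))
    (ℕ.≤-trans (ℕ.+-monoˡ-≤ (K ℕ.* 48) (ℕ.≤-trans (ℕ.m≤m+n 24 8) (ℕ.*-monoˡ-≤ 16 2≤K)))
      (ℕ.≤-trans (ℕ.≤-reflexive (ℕ-solve 1 (λ K → K ⊛ κ 16 ⊹ K ⊛ κ 48 ≔ K ⊛ κ 64) refl K)) 64K≤n))
  y≤r : double y ≤ r
  y≤r = ℕ.≤-trans (ℕ.≤-reflexive (sym (ℕ.m+n∸m≡n (2 ℕ.+ (K ℕ.+ K)) (double y)))) (ℕ.∸-monoˡ-≤ (2 ℕ.+ (K ℕ.+ K)) room)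
  total : (2 ℕ.+ (K ℕ.+ K)) ℕ.+ r ≡ n
  total = ℕ.m+[n∸m]≡n {2 ℕ.+ (K ℕ.+ K)} (ℕ.≤-trans (ℕ.m≤m+n (2 ℕ.+ (K ℕ.+ K)) (double y)) room)
  split : r ≡ double T ⊎ r ≡ suc (double T) →
    ∃[ k ] ∃[ m ] ∃[ p ] n ≡ suc (suc (double k ℕ.+ (m ℕ.+ p))) × K ≤ p × K ≤ m × (m ℕ.+ p) ℕ.* 11 ℕ.+ K ≤ k
  split (inj₁ e) = T , K , K , trans (sym total) (trans (cong ((2 ℕ.+ (K ℕ.+ K)) ℕ.+_) e) (cong (λ z → suc (suc z)) (ℕ.+-comm (K ℕ.+ K) (double T))))
    , ℕ.≤-refl , ℕ.≤-refl
    , ℕ.≤-trans (ℕ.+-monoˡ-≤ K (ℕ.*-monoˡ-≤ 11 (ℕ.n≤1+n (K ℕ.+ K)))) (double-cancel (ℕ.m≤n⇒m≤1+n (subst (double y ≤_) e y≤r)))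
  split (inj₂ e) = T , suc K , K , trans (sym total) (trans (cong ((2 ℕ.+ (K ℕ.+ K)) ℕ.+_) e)
      (cong (λ z → suc (suc z)) (trans (ℕ.+-suc (K ℕ.+ K) (double T)) (ℕ.+-comm (suc K ℕ.+ K) (double T)))))
    , ℕ.≤-refl , ℕ.n≤1+n K , double-cancel (subst (double y ≤_) e y≤r)

bad-upper : ∀ n → 6400 ≤ n → bad n ≼ τ₀ ^ n
bad-upper n 6400≤n =
  let k , m , p , eq , K≤p , K≤m , le = parameters n K (ℕ.≤-trans (ℕ.m≤m+n 2 98) 100≤K) (ℕ.m/n*n≤m n 64) in
  ℚ.≤-trans (ℚ.≤-reflexive (cong bad eq)) (ℚ.≤-trans (bad-small k m p K K≤p K≤m le) (θ-τ₀ K n (ℕ.≤-trans (ℕ.m≤m+n 99 1) 100≤K) n≤))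
  where
  -- The bound n ≥ 6400 gives K ≥ 100, while `θ-τ₀` asks for 99 = 9 · 11: eleven factors 14/15 per
  -- halving, nine halvings to absorb 370.
  K : ℕ
  K = n ℕ./ 64
  100≤K : 100 ≤ K
  100≤K = ℕ./-monoˡ-≤ 64 6400≤n
  n≤ : n ≤ suc K ℕ.* 64
  n≤ = ℕ.≤-trans (ℕ.≤-reflexive (ℕ.m≡m%n+[m/n]*n n 64)) (ℕ.+-monoˡ-≤ (K ℕ.* 64) (ℕ.<⇒≤ (ℕ.m%n<n n 64)))

-- Odd graphs

module Xor = Sum (CommutativeRing.+-commutativeMonoid Bool.xor-∧-commutativeRing)

sum-verts : ∀ {n} (f : Fin n → Bool) → Xor.sum f ≡ par f (verts n)
sum-verts {zero}  f = refl
sum-verts {suc n} f = cong (f zero xor_) (trans (sum-verts (f ∘ suc)) (sym (par-map f suc (verts n))))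

sum-tabulate : ∀ {n} {V : Set} (f : V → Bool) (v : Fin n → V) → Xor.sum (f ∘ v) ≡ par f (List.tabulate v)
sum-tabulate {zero}  f v = refl
sum-tabulate {suc n} f v = cong (f (v zero) xor_) (sum-tabulate f (v ∘ suc))

par-permute : ∀ {n} (f : Fin n → Bool) (π : Permutation′ n) → par f (List.tabulate (π ⟨$⟩ʳ_)) ≡ par f (verts n)
par-permute f π = trans (sym (sum-tabulate f (π ⟨$⟩ʳ_))) (trans (sym (Xor.sum-permute f π)) (sum-verts f))

degree : ∀ {n} → Graph n → Fin n → Bool
degree {n} G v = par (adj G v) (verts n)

degree-permute : ∀ {n} (G : Graph n) (π : Permutation′ n) v → degree G v ≡ par (adj G v) (List.tabulate (π ⟨$⟩ʳ_))
degree-permute G π v = sym (par-permute (adj G v) π)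

vpar-even⁻¹ : ∀ {n} (S : Vec Bool n) → 2 ∣ (∣ S ∣) → vpar S ≡ false
vpar-even⁻¹ S h = Bool.¬-not (λ e → vpar-true S e h)

first-even : ∀ {n} (G : Graph (suc (suc (suc n)))) ((π , _) : EvenDegenerate G) → degree G (π ⟨$⟩ʳ zero) ≡ false
first-even {n} G (π , h) = begin
  degree G (v zero)
    ≡⟨ degree-permute G π (v zero) ⟩
  adj G (v zero) (v zero) xor par (adj G (v zero)) (List.tabulate w)
    ≡⟨ cong₂ _xor_ (adj-irrefl G (v zero)) (sym (vpar-tabulate (adj G (v zero)) w)) ⟩
  vpar (later (adj G) v zero)
    ≡⟨ vpar-even⁻¹ (laterNeighbours G v zero) (h zero (ℕ.s≤s ℕ.z≤n)) ⟩
  false ∎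
  where
  open ≡-Reasoning
  v : Fin (suc (suc (suc n))) → Fin (suc (suc (suc n)))
  v = π ⟨$⟩ʳ_
  w : Fin (suc (suc n)) → Fin (suc (suc (suc n)))
  w i = v (suc i)

second-even : ∀ {n} (G : Graph (suc (suc (suc (suc n))))) ((π , _) : EvenDegenerate G) →
              (∀ u → adj G u (π ⟨$⟩ʳ zero) ≡ false) → degree G (π ⟨$⟩ʳ suc zero) ≡ false
second-even {n} G (π , h) isolated = begin
  degree G v₁
    ≡⟨ degree-permute G π v₁ ⟩
  adj G v₁ (v zero) xor (adj G v₁ v₁ xor par (adj G v₁) (List.tabulate w))
    ≡⟨ cong₂ _xor_ (isolated v₁) (cong₂ _xor_ (adj-irrefl G v₁) (sym (vpar-tabulate (adj G v₁) w))) ⟩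
  vpar (later (adj G) v (suc zero))
    ≡⟨ vpar-even⁻¹ (laterNeighbours G v (suc zero)) (h (suc zero) (ℕ.s≤s (ℕ.s≤s ℕ.z≤n))) ⟩
  false ∎
  where
  open ≡-Reasoning
  v : Fin (suc (suc (suc (suc n)))) → Fin (suc (suc (suc (suc n))))
  v = π ⟨$⟩ʳ_
  v₁ : Fin (suc (suc (suc (suc n))))
  v₁ = v (suc zero)
  w : Fin (suc (suc n)) → Fin (suc (suc (suc (suc n))))
  w i = v (suc (suc i))

Odd : ∀ {n} → Graph n → Set
Odd G = ∀ v → degree G v ≡ true

true≢false : ∀ {b} → b ≡ true → b ≡ false → ∀ {A : Set} → A
true≢false refl ()

odd-stuck : ∀ {n} (G : Graph (suc (suc (suc n)))) → Odd G → ¬ EvenDegenerate G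
odd-stuck G odd ed = true≢false (odd _) (first-even G ed)

degree-suc : ∀ {n} (S : Vec Bool n) (G : Graph n) v → degree (S ▹ G) (suc v) ≡ lookup S v xor degree G v
degree-suc {n} S G v = cong (lookup S v xor_) (par-map (adj (S ▹ G) (suc v)) suc (verts n))

degree-zero : ∀ {n} (S : Vec Bool n) (G : Graph n) → degree (S ▹ G) zero ≡ par (lookup S) (verts n)
degree-zero {n} S G = par-map (adj (S ▹ G) zero) suc (verts n)

even⇒isolated : ∀ {n} (G : Graph n) → Odd G → ∀ u → degree (zeros n ▹ G) u ≡ false → u ≡ zero
even⇒isolated     G odd zero    _ = refl
even⇒isolated {n} G odd (suc v) e = true≢false (odd v)
  (trans (sym (trans (degree-suc (zeros n) G v) (cong (_xor degree G v) (Vec.lookup-replicate v false)))) e)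

-- The isolated vertex is the only one of even degree and must come first. Its removal changes no
-- degree, so the second vertex would have to be of even degree too, hence the same vertex.
isolated-odd-stuck : ∀ {n} (G : Graph (suc (suc (suc n)))) → Odd G → ¬ EvenDegenerate (zeros (suc (suc (suc n))) ▹ G)
isolated-odd-stuck {n} G odd ed@(π , _) = case trans (sym (FinPerm.inverseˡ π)) (trans (cong (π ⟨$⟩ˡ_) (trans π₀ (sym π₁))) (FinPerm.inverseˡ π)) of λ ()
  where
  H : Graph (suc (suc (suc (suc n))))
  H = zeros (suc (suc (suc n))) ▹ G
  isolated : ∀ u → adj H u zero ≡ false
  isolated zero    = refl
  isolated (suc u) = Vec.lookup-replicate u false
  π₀ : π ⟨$⟩ʳ zero ≡ zero
  π₀ = even⇒isolated G odd _ (first-even H ed)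
  π₁ : π ⟨$⟩ʳ suc zero ≡ zero
  π₁ = even⇒isolated G odd _ (second-even H ed (λ u → subst (λ z → adj H u z ≡ false) (sym π₀) (isolated u)))

par-xor : ∀ {V : Set} (f g : V → Bool) vs → par (λ v → f v xor g v) vs ≡ par f vs xor par g vs
par-xor f g []       = refl
par-xor f g (v ∷ vs) = trans (cong ((f v xor g v) xor_) (par-xor f g vs)) (xor-interchange (f v) (g v) (par f vs) (par g vs))

handshake : ∀ {n} (G : Graph n) → par (degree G) (verts n) ≡ false
handshake ∅ = refl
handshake {suc n} (S ▹ G) = begin
  degree (S ▹ G) zero xor par (degree (S ▹ G)) (List.map suc (verts n))
    ≡⟨ cong₂ _xor_ (degree-zero S G) (trans (par-map (degree (S ▹ G)) suc (verts n)) (trans (par-cong (degree-suc S G) (verts n)) (par-xor (lookup S) (degree G) (verts n)))) ⟩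
  par (lookup S) (verts n) xor (par (lookup S) (verts n) xor par (degree G) (verts n))
    ≡⟨ xor-cancelˡ (par (lookup S) (verts n)) _ ⟩
  par (degree G) (verts n)
    ≡⟨ handshake G ⟩
  false ∎
  where
  open ≡-Reasoning

odd-order : ∀ j → par (λ _ → true) (verts (suc (double j))) ≡ true
odd-order zero    = refl
odd-order (suc j) = trans (cong (λ z → true xor (true xor z))
    (trans (par-map (λ _ → true) Fin.suc (List.map Fin.suc vs)) (par-map (λ _ → true) Fin.suc vs)))
  (trans (xor-cancelˡ true _) (odd-order j))
  where
  vs : List (Fin (suc (double j)))
  vs = verts (suc (double j))

oddRow : ∀ {n} → Graph n → Vec Bool n
oddRow H = tabulate (not ∘ degree H)

not-xor : ∀ b → not b xor b ≡ true
not-xor true  = refl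
not-xor false = refl

oddRow-odd : ∀ j (H : Graph (suc (double j))) → Odd (oddRow H ▹ H)
oddRow-odd j H zero = begin
  degree (oddRow H ▹ H) zero
    ≡⟨ degree-zero (oddRow H) H ⟩
  par (lookup (oddRow H)) vs
    ≡⟨ par-cong (Vec.lookup∘tabulate (not ∘ degree H)) vs ⟩
  par (λ v → true xor degree H v) vs
    ≡⟨ par-xor (λ _ → true) (degree H) vs ⟩
  par (λ _ → true) vs xor par (degree H) vs
    ≡⟨ cong₂ _xor_ (odd-order j) (handshake H) ⟩
  true ∎
  where
  open ≡-Reasoning
  vs : List (Fin (suc (double j)))
  vs = verts (suc (double j))
oddRow-odd j H (suc v) = trans (degree-suc (oddRow H) H v)
  (trans (cong (_xor degree H v) (Vec.lookup∘tabulate (not ∘ degree H) v)) (not-xor (degree H v)))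

hit-* : ∀ {p} (l : Vec Bool p) {q r} → (l ≡ zeros p → q ≼ r) → 0ℚ ≼ r → hit l * q ≼ r
hit-* []          {q} h _   = ℚ.≤-trans (ℚ.≤-reflexive (ℚ.*-identityˡ q)) (h refl)
hit-* (true ∷ l)  {q} _ 0≤r = ℚ.≤-trans (ℚ.≤-reflexive (ℚ.*-zeroˡ q)) 0≤r
hit-* (false ∷ l) h 0≤r = hit-* l (λ e → h (cong (false ∷_) e)) 0≤r

⊕-zeros : ∀ {p} (l m : Vec Bool p) → l ⊕ m ≡ zeros p → l ≡ m
⊕-zeros []      []      _ = refl
⊕-zeros (a ∷ l) (b ∷ m) e = cong₂ _∷_ (sym (xor-false (Vec.∷-injectiveˡ e))) (⊕-zeros l m (Vec.∷-injectiveʳ e))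

-- For each outcome of `M` the prescribed row is one of 2^p equally likely ones.
row-mean : ∀ {p} {G : Set} (M : Mean G) (c : G → Vec Bool p) → 𝔼 (bits p ⊗ M) (λ (S , H) → hit (S ⊕ c H)) ≡ ½ ^ p
row-mean {p} M c = trans (𝔼-swap (bits p) M (λ S H → hit (S ⊕ c H)))
  (trans (𝔼-cong M (λ H → trans (bits-⊕ (c H) hit) (hit-mean p))) (𝔼-const M (½ ^ p)))

-- At most two rows of a graph are prescribed, each of length at most n; hence the base 1/4.
¼^≼½^ : ∀ a b n → a ≤ n → b ≤ n → (+ 1 / 4) ^ n ≼ ½ ^ a * ½ ^ b
¼^≼½^ a b n a≤n b≤n = ℚ.≤-trans (ℚ.≤-reflexive (*-^ ½ ½ n))
  (CauchyLemmas.*-mono-≤ (0≼½^ a) (0≼½^ n) (^-anti 0≼½ ½≼1 a≤n) (^-anti 0≼½ ½≼1 b≤n))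
  where
  ½≼1 : ½ ≼ 1ℚ
  ½≼1 = check≼ _ _

hit≼isBad : ∀ {k} (S : Vec Bool k) H → ¬ EvenDegenerate (oddRow H ▹ H) → hit (S ⊕ oddRow H) ≼ isBad (S ▹ H)
hit≼isBad S H stuck = ℚ.≤-trans (ℚ.≤-reflexive (sym (ℚ.*-identityʳ (hit (S ⊕ oddRow H)))))
  (hit-* (S ⊕ oddRow H) (λ e → ℚ.≤-reflexive (sym (isBad-one (S ▹ H)
    (subst (λ S → ¬ EvenDegenerate (S ▹ H)) (sym (⊕-zeros S (oddRow H) e)) stuck)))) (0≼isBad (S ▹ H)))

hits≼isBad : ∀ {k} S′ (S : Vec Bool k) H → ¬ EvenDegenerate (zeros (suc k) ▹ (oddRow H ▹ H)) →
             hit S′ * hit (S ⊕ oddRow H) ≼ isBad (S′ ▹ (S ▹ H))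
hits≼isBad {k} S′ S H stuck = hit-* S′ (λ e′ → ℚ.≤-trans (ℚ.≤-reflexive (sym (ℚ.*-identityʳ (hit (S ⊕ oddRow H)))))
  (hit-* (S ⊕ oddRow H) (λ e → ℚ.≤-reflexive (sym (isBad-one (S′ ▹ (S ▹ H))
    (subst₂ (λ S′ S → ¬ EvenDegenerate (S′ ▹ (S ▹ H))) (sym e′) (sym (⊕-zeros S (oddRow H) e)) stuck))))
    (0≼isBad (S′ ▹ (S ▹ H)))))
  (0≼isBad (S′ ▹ (S ▹ H)))

bad-odd-graphs : ∀ {n} k → n ≡ suc k → (∀ (H : Graph k) → ¬ EvenDegenerate (oddRow H ▹ H)) → (+ 1 / 4) ^ n ≼ bad n
bad-odd-graphs k refl stuck = begin
  (+ 1 / 4) ^ suc k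
    ≤⟨ ¼^≼½^ 0 k (suc k) ℕ.z≤n (ℕ.n≤1+n k) ⟩
  ½ ^ 0 * ½ ^ k
    ≡⟨ ℚ.*-identityˡ (½ ^ k) ⟩
  ½ ^ k
    ≡⟨ row-mean (randomGraph k) oddRow ⟨
  𝔼 (bits k ⊗ randomGraph k) (λ (S , H) → hit (S ⊕ oddRow H))
    ≤⟨ 𝔼-mono (bits k ⊗ randomGraph k) (λ (S , H) → hit≼isBad S H (stuck H)) ⟩
  𝔼 (randomGraph (suc k)) isBad
    ≡⟨ bad-mean (suc k) ⟨
  bad (suc k) ∎
  where
  open ℚ.≤-Reasoning

bad-isolated-odd-graphs : ∀ {n} k → n ≡ suc (suc k) → (∀ (H : Graph k) → ¬ EvenDegenerate (zeros (suc k) ▹ (oddRow H ▹ H))) →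
                          (+ 1 / 4) ^ n ≼ bad n
bad-isolated-odd-graphs k refl stuck = begin
  (+ 1 / 4) ^ suc (suc k)
    ≤⟨ ¼^≼½^ (suc k) k (suc (suc k)) (ℕ.n≤1+n (suc k)) (ℕ.m≤n+m k 2) ⟩
  ½ ^ suc k * ½ ^ k
    ≡⟨ cong₂ _*_ (hit-mean (suc k)) (row-mean (randomGraph k) oddRow) ⟨
  𝔼 (bits (suc k)) hit * r
    ≡⟨ 𝔼-*ʳ (bits (suc k)) r hit ⟨
  𝔼 (bits (suc k)) (λ S′ → hit S′ * r)
    ≡⟨ 𝔼-cong (bits (suc k)) (λ S′ → 𝔼-* (bits k ⊗ randomGraph k) (hit S′) (λ (S , H) → hit (S ⊕ oddRow H))) ⟨
  𝔼 (bits (suc k) ⊗ bits k ⊗ randomGraph k) (λ (S′ , S , H) → hit S′ * hit (S ⊕ oddRow H))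
    ≤⟨ 𝔼-mono (bits (suc k) ⊗ bits k ⊗ randomGraph k) (λ (S′ , S , H) → hits≼isBad S′ S H (stuck H)) ⟩
  𝔼 (randomGraph (suc (suc k))) isBad
    ≡⟨ bad-mean (suc (suc k)) ⟨
  bad (suc (suc k)) ∎
  where
  open ℚ.≤-Reasoning
  r : ℚ
  r = 𝔼 (bits k ⊗ randomGraph k) (λ (S , H) → hit (S ⊕ oddRow H))

above-odd : ∀ n → 4 ≤ n → ∃[ j ] (n ≡ suc (suc (double (suc j))) ⊎ n ≡ suc (suc (suc (double (suc j)))))
above-odd n 4≤n with halve n
... | suc (suc j) , e         = j , e
... | zero        , inj₁ refl = case 4≤n of λ ()
... | zero        , inj₂ refl = case 4≤n of λ { (ℕ.s≤s ()) }
... | suc zero    , inj₁ refl = case 4≤n of λ { (ℕ.s≤s (ℕ.s≤s ())) }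
... | suc zero    , inj₂ refl = case 4≤n of λ { (ℕ.s≤s (ℕ.s≤s (ℕ.s≤s ()))) }

bad-lower : ∀ n → 4 ≤ n → (+ 1 / 4) ^ n ≼ bad n
bad-lower n 4≤n = let j , parity = above-odd n 4≤n in [
    (λ e → bad-odd-graphs (suc (double (suc j))) e (λ H → odd-stuck (oddRow H ▹ H) (oddRow-odd (suc j) H))) ,
    (λ e → bad-isolated-odd-graphs (suc (double (suc j))) e (λ H → isolated-odd-stuck (oddRow H ▹ H) (oddRow-odd (suc j) H)))
  ]′ parity

mainTheorem4 : ∃[ c ] ∃[ C ] ∃[ n₀ ] (0ᵣ <ᵣ c) × (c <ᵣ C) ×
    (∀ (n : ℕ) → n₀ ≤ n →
    (exp (-ᵣ (C *ᵣ fromℕ n)) ≤ᵣ fromℚ (ℙ n (λ G → ¬? (evenDegenerate? G)))) ×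
    (fromℚ (ℙ n (λ G → ¬? (evenDegenerate? G))) ≤ᵣ exp (-ᵣ (c *ᵣ fromℕ n))))
mainTheorem4 = fromℚ c₀ , fromℚ C₀ , 6400 ,
  (c₀ , check< , 0 , λ _ _ → ℚ.≤-reflexive (ℚ.+-identityˡ c₀)) ,
  (1ℚ , ℚ.positive⁻¹ 1ℚ , 0 , λ _ _ → check≼ (c₀ + 1ℚ) C₀) ,
  λ n 6400≤n →
    (λ ε 0<ε → eventually-map (λ j h → ℚ.≤-trans (ℚ.≤-reflexive (exponent C₀ n j)) (ℚ.≤-trans h (ℚ.+-monoˡ-≤ ε (bad-lower n (ℕ.≤-trans (ℕ.m≤m+n 4 6396) 6400≤n)))))
      (power-above (- C₀) exp-C n ε 0<ε)) ,
    (λ ε 0<ε → eventually-map (λ j h → ℚ.≤-trans (bad-upper n 6400≤n) (ℚ.≤-trans h (ℚ.≤-reflexive (cong (_+ ε) (sym (exponent c₀ n j))))))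
      (power-below (- c₀) (check≼ 0ℚ τ₀) exp-c n ε 0<ε))
  where
  check< : 0ℚ ≺ c₀
  check< = ℚ.positive⁻¹ c₀
  exponent : ∀ q n j → expSum (- (q * ι n)) j ≡ expSum (ι n * (- q)) j
  exponent q n j = cong (λ z → expSum z j) (solve 2 (λ q i → :- (q :* i) := i :* (:- q)) refl q (ι n))
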